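{- Let $T$ be a spider with bipartition $X$ and $Y$, and let $t=\max\{|X|,|Y|\}$. Then every $2$-connected bipartite graph $G$ with minimum degree $\delta(G)\geq t+2$ contains a subgraph $T'$ that is a spider isomorphic to $T$ and such that $G-V(T')$ is still $2$-connected.
   Context: All graphs are finite and undirected, without loops or multiple edges. $\delta(G)$ is the minimum degree of $G$. For $S\subseteq V(G)$, $G-S$ is the graph obtained from $G$ by deleting the vertices of $S$ (and all incident edges). The connectivity $\kappa(G)$ is the minimum size of a vertex set $S$ such that $G-S$ is disconnected or has only one vertex; $G$ is $k$-connected if $\kappa(G)\geq k$. A spider is a tree with at most one vertex of degree more than $2$. The bipartition $X,Y$ of a tree is its partition into two independent sets. -}

module Defs where

open import Data.Fin using (Fin)
open import Data.Fin.Subset using (Subset; _∈_; _∉_; _⊆_; _∪_; _∩_; _─_; ⊥; ∣_∣; Nonempty)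
open import Data.Fin.Subset.Properties using (_∈?_; x∈p∧x∉q⇒x∈p─q)
open import Data.List using (List; _∷_; _∷ʳ_; allFin; filter; length; map)
open import Data.List.Extrema.Nat using (min)
open import Data.List.Relation.Unary.Linked using (Linked)
open import Data.List.Relation.Unary.Unique.Propositional using (Unique)
open import Data.Nat using (ℕ; _≤_; _≥_; _>_)
open import Data.Product using (Σ; ∃; ∃₂; _×_; _,_; proj₁)
open import Data.Sum using (_⊎_)
open import Data.Vec using (tabulate)
open import Function using (_↔_; _⇔_; Inverse)
open import Level using (0ℓ)
open import Relation.Binary using (Rel; Decidable; Symmetric)
open import Relation.Binary.Construct.Closure.ReflexiveTransitive using (Star)
open import Relation.Binary.PropositionalEquality using (_≡_)
open import Relation.Nullary using (¬_; ¬?; does)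
open import Relation.Nullary.Decidable using (_×-dec_)

-- The vertex set V is a subset of an ambient Fin n, so that subgraphs and
-- vertex deletions of a Graph n are again of type Graph n.
record Graph (n : ℕ) : Set₁ where
  infix 4 _~_ _~?_
  field
    V      : Subset n
    _~_    : Rel (Fin n) 0ℓ
    _~?_   : Decidable _~_
    ~-sym  : Symmetric _~_
    ~-irr  : ∀ {x} → ¬ (x ~ x)
    ~⇒∈V   : ∀ {x y} → x ~ y → x ∈ V

  Vertex : Set
  Vertex = Σ (Fin n) (_∈ V)

  degree : Fin n → ℕ
  degree x = ∣ tabulate (λ y → does (x ~? y)) ∣

  -- Every degree is less than n, so the starting value n does not influence
  -- the minimum as soon as there is a vertex.
  δ : ℕ
  δ = min n (map degree (filter (_∈? V) (allFin n)))

open Graph using (V; Vertex; degree; δ) public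

module _ {n : ℕ} (G : Graph n) where
  open Graph G using (_~_; _~?_; ~-sym; ~-irr; ~⇒∈V)

  infixl 6 _∖_
  _∖_ : Subset n → Graph n
  _∖_ S = record
    { V     = V G ─ S
    ; _~_   = λ x y → x ~ y × x ∉ S × y ∉ S
    ; _~?_  = λ x y → (x ~? y) ×-dec (¬? (x ∈? S) ×-dec ¬? (y ∈? S))
    ; ~-sym = λ (x~y , x∉S , y∉S) → ~-sym x~y , y∉S , x∉S
    ; ~-irr = λ (x~x , _) → ~-irr x~x
    ; ~⇒∈V  = λ (x~y , x∉S , _) → x∈p∧x∉q⇒x∈p─q (~⇒∈V x~y) x∉S
    }

  -- Vacuously true of the graph without vertices.
  Connected : Set
  Connected = ∀ {x y} → x ∈ V G → y ∈ V G → Star _~_ x y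

  -- The list x ∷ xs enumerates the distinct vertices in cyclic order.
  IsCycle : Fin n → List (Fin n) → Set
  IsCycle x xs = length (x ∷ xs) ≥ 3 × Unique (x ∷ xs) × Linked _~_ (x ∷ xs ∷ʳ x)

  Acyclic : Set
  Acyclic = ∀ x xs → ¬ IsCycle x xs

  IsTree : Set
  IsTree = Nonempty (V G) × Connected × Acyclic

  IsSpider : Set
  IsSpider = IsTree × (∀ {x y} → degree G x > 2 → degree G y > 2 → x ≡ y)

  Independent : Subset n → Set
  Independent X = ∀ {x y} → x ∈ X → y ∈ X → ¬ (x ~ y)

  IsBipartition : Subset n → Subset n → Set
  IsBipartition X Y = X ∪ Y ≡ V G × X ∩ Y ≡ ⊥ × Independent X × Independent Y

  Bipartite : Set
  Bipartite = ∃₂ IsBipartition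

module _ {n : ℕ} (G : Graph n) where

  IsSeparating : Subset n → Set
  IsSeparating S = S ⊆ V G × (¬ Connected (G ∖ S) ⊎ ∣ V (G ∖ S) ∣ ≡ 1)

  -- k = κ(G), as a relation: k is the minimum of ∣ S ∣ over the separating sets S.
  -- It holds for exactly one k unless G has no vertices, when it holds for none.
  IsConnectivity : ℕ → Set
  IsConnectivity k = (∃ λ S → IsSeparating S × ∣ S ∣ ≡ k)
                   × (∀ S → IsSeparating S → k ≤ ∣ S ∣)

  KConnected : ℕ → Set
  KConnected k = ∃ λ κ → IsConnectivity κ × κ ≥ k

infix 4 _⊆ᴳ_ _≅_

_⊆ᴳ_ : ∀ {n} → Graph n → Graph n → Set
H ⊆ᴳ G = V H ⊆ V G × (∀ {x y} → Graph._~_ H x y → Graph._~_ G x y)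

-- Membership proofs are unique, so _↔_ is a bijection of the vertex sets.
_≅_ : ∀ {m n} → Graph m → Graph n → Set
G ≅ H = Σ (Vertex G ↔ Vertex H) λ f → let φ = λ u → proj₁ (Inverse.to f u) in
  ∀ u v → Graph._~_ G (proj₁ u) (proj₁ v) ⇔ Graph._~_ H (φ u) (φ v)

{-# OPTIONS --safe #-}
-- Fix a bipartite G and consider a nonseparable B ⊆ G, as large as possible, whose complement W
-- contains a copy of T. Suppose that B is not all of G − V(T′) for any copy T′ ⊆ W.
--
-- A vertex of W with two neighbours in B can be absorbed by B, so it lies in every copy T′ ⊆ W; let A
-- be the set of these vertices. The other vertices of W have at least t + 1 neighbours in W.
--
-- If A is empty, let P be a shortest ear of B. A vertex of W off P has at most two neighbours in
-- B ∪ P, hence t neighbours in W − P, so that T can be embedded greedily in W − P while B ∪ P is larger.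
--
-- If A is not empty, fix a copy of T in W with centre c. Whenever a vertex y of a leg has a neighbour
-- off the copy, the leg can be rerouted from y so as to avoid the first vertex of A beyond y; hence A
-- is a subspider around c ∈ A. Truncating legs gives a minimal core D ⊇ A all of whose tips can be
-- prolonged in W − D by distinct vertices avoiding any prescribed one; by minimality the vertices of
-- W − D are adjacent in D to tips only. Among the vertices of W − D coloured like c choose e with the
-- most adjacent tips and let it be the centre of a new copy, in which every tip w adjacent to e starts
-- a leg: its whole core leg, traversed inwards, if that is a full leg of T, and otherwise w followed by
-- the vertex that prolongs it. By the choice of e and by counting colours, the greedy extension of
-- these legs in W − D never stops until at most two vertices of a leg are missing, and those may be
-- taken from an unused core leg of length at least 2. The new copy avoids c ∈ A, a contradiction.
--
-- The argument is by contradiction, which is no loss since the existence of T′ is decidable.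

module Submission where

open import Defs
open import Data.Bool using (Bool; true; false; not; _∧_; _∨_; if_then_else_)
import Data.Bool as Bool
open import Data.Bool.Properties using (not-injective; not-involutive; ¬-not)
open import Data.Empty using (⊥; ⊥-elim)
open import Data.Fin using (Fin; zero; suc)
import Data.Fin as Fin
open import Data.Fin.Properties using (any?; all?)
import Data.Fin.Properties as Finₚ
open import Data.Fin.Subset using (Subset; ∣_∣; ⁅_⁆; _∪_; _─_) renaming (_∈_ to _∈ˢ_; _∉_ to _∉ˢ_; ⊥ to ∅)
open import Data.Fin.Subset.Properties using (anySubset?; _⊆?_; p⊂q⇒∣p∣<∣q∣; p⊆p∪q; q⊆p∪q; x∈p∪q⁻; x∈⁅x⁆; x∈⁅y⁆⇒x≡y; ∣⁅x⁆∣≡1; ∣⊥∣≡0; ∉⊥; ∣p∣≤n; ⊆-antisym; x∈p∧x∉q⇒x∈p─q; p─q⊆p) renaming (_∈?_ to _∈ˢ?_)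
open import Data.List using (List; []; _∷_; [_]; _++_; concat; length; map; allFin; filter; reverse; drop; take; _ʳ++_)
open import Data.List.Extrema.Nat using (min≤xs)
open import Data.List.Membership.DecPropositional as DecMem using ()
open import Data.List.Membership.Propositional using (_∈_; _∉_)
open import Data.List.Membership.Propositional.Properties using (∈-++⁺ˡ; ∈-++⁺ʳ; ∈-++⁻; ∈-∃++; ∈-filter⁺; ∈-filter⁻; ∈-map⁺; ∈-map⁻; ∈-concat⁺′; ∈-concat⁻′; ∈-allFin)
open import Data.List.Properties using (length-++; length-map; length-drop; length-reverse; length-tabulate; ++-assoc; ++-identityʳ; map-id; map-∘; map-cong; map-++; ʳ++-defn; unfold-reverse; reverse-involutive; take++drop≡id; ∷-injectiveˡ; ∷-injectiveʳ)
open import Data.List.Relation.Binary.Permutation.Propositional as Perm using (_↭_; ↭-refl; ↭-sym; ↭-trans; ↭-reflexive; ↭-swap; prep; ↭⇒↭ₛ)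
open import Data.List.Relation.Binary.Permutation.Propositional.Properties using (shift; shifts; ++⁺; ++⁺ˡ; ++⁺ʳ; ++-comm; map⁺; ∈-resp-↭; All-resp-↭; ↭-reverse; ↭-length; ↭-map-inv)
import Data.List.Relation.Binary.Permutation.Setoid.Properties as SetoidPerm
open import Data.List.Relation.Binary.Pointwise using (Pointwise; []; _∷_)
open import Data.List.Relation.Binary.Sublist.Propositional using (_⊆_; ⊆-refl; ⊆-trans; minimum) renaming ([] to []ˢ; _∷_ to _∷ˢ_; _∷ʳ_ to _∷ʳˢ_)
import Data.List.Relation.Binary.Sublist.Propositional.Properties as Sub
open import Data.List.Relation.Unary.All as All using (All; []; _∷_)
import Data.List.Relation.Unary.All.Properties as Allₚ
open import Data.List.Relation.Unary.AllPairs using ([]; _∷_)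
open import Data.List.Relation.Unary.Any using (here; there)
open import Data.List.Relation.Unary.Linked using (Linked; []; [-]; _∷_)
open import Data.List.Relation.Unary.Unique.Propositional using (Unique)
import Data.List.Relation.Unary.Unique.Propositional.Properties as Uniq
open import Data.Nat using (ℕ; zero; suc; pred; _+_; _∸_; _⊓_; _⊔_; _≤_; _<_; _>_; _≥_; z≤n; s≤s; s≤s⁻¹)
open import Data.Nat.ListAction using (sum)
open import Data.Nat.ListAction.Properties using (sum-↭)
open import Data.Nat.Properties using (≤-refl; ≤-trans; ≤-reflexive; ≤-<-trans; <⇒≱; ≮⇒≥; ≰⇒>; _≟_; _≤?_; n≮0; n<1+n; n≤1+n; m≤n⇒m≤1+n; m≤n⇒m<n∨m≡n; suc-injective; +-assoc; +-comm; +-suc; +-identityʳ; +-mono-≤; +-monoˡ-≤; +-monoʳ-≤; +-monoʳ-<; m≤m+n; m≤n+m; m+n∸n≡m; m⊓n≤m; m⊓n+n∸m≡n; m≤m⊔n; m≤n⊔m; module ≤-Reasoning)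
open import Data.Nat.Tactic.RingSolver using (solve-∀)
open import Data.Product using (Σ-syntax; ∃; ∃₂; _×_; _,_; proj₁; proj₂)
open import Data.Sum using (_⊎_; inj₁; inj₂; [_,_]′)
open import Data.Unit using (⊤; tt)
open import Data.Vec using (Vec; []; _∷_; lookup; tabulate; here; there)
open import Data.Vec.Properties using (lookup∘tabulate; []=⇒lookup; lookup⇒[]=)
open import Data.Vec.Properties.WithK using ([]=-irrelevant)
open import Function using (case_of_; mk⇔; mk↔ₛ′)
open import Level using (0ℓ)
open import Relation.Binary using (Rel; Symmetric; Decidable)
open import Relation.Binary.Construct.Closure.ReflexiveTransitive as Star using (Star; ε; _◅_)
open import Relation.Binary.PropositionalEquality using (_≡_; _≢_; refl; sym; trans; cong; cong₂; subst; subst₂; setoid)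
open import Relation.Nullary using (¬_; Dec; does; yes; no)
open import Relation.Nullary.Decidable using (dec-true; dec-false; decidable-stable; map′; _×-dec_; _⊎-dec_; _→-dec_; ¬?)

-- Neighbours of a vertex have the opposite colour, so a greedy step is obstructed only by used
-- vertices of the colour sought; hence the class bound `t` takes the place of the order of T. Of
-- the two surplus neighbours, a vertex outside A loses at most one to B, and the other pays for one
-- additional forbidden vertex, such as the old centre c. The obstacle is that a vertex of A may
-- have hardly any neighbours outside B, so no search for a neighbour may start at it. The colour of
-- e is chosen for the bookkeeping. Tips adjacent to e have the colour opposite to c, all lie on the
-- new copy, and so are counted in its colour class; by the choice of e no vertex coloured like e
-- loses more neighbours to tips. A tip coloured like c is adjacent neither to e nor to c, so its
-- core leg has at least two vertices and remains untouched; postponing the last two vertices of the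
-- corresponding new leg frees one slot for that tip.

bit : Bool → ℕ
bit true  = 1
bit false = 0

∧-true : ∀ {a b} → a ≡ true → b ≡ true → a ∧ b ≡ true
∧-true refl refl = refl

true-∧ : ∀ {a b} → a ∧ b ≡ true → a ≡ true × b ≡ true
true-∧ {true} h = refl , h

does⁻ : ∀ {P : Set} (d : Dec P) → does d ≡ true → P
does⁻ (yes p) _ = p

-- The number of occurrences of b among the n entries that follow x in an alternating sequence.
cnt : Bool → Bool → ℕ → ℕ
cnt b x zero    = 0
cnt b x (suc n) = bit (does (not x Bool.≟ b)) + cnt b (not x) n

cnt-∸2 : ∀ b x r → cnt b x (r ∸ 2) ≤ cnt b x r
cnt-∸2 b x zero          = ≤-refl
cnt-∸2 b x (suc zero)    = z≤n
cnt-∸2 b x (suc (suc r)) =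
  ≤-trans (≤-reflexive (cong (λ y → cnt b y r) (sym (not-involutive x))))
    (≤-trans (m≤n+m _ (bit (does (not (not x) Bool.≟ b)))) (m≤n+m _ (bit (does (not x Bool.≟ b)))))

-- Of two consecutive entries exactly one has colour `x`, so leaving out two vertices of a leg frees
-- exactly one slot; this pays for one reserved tip in the recentring.
cnt-∸2-< : ∀ x r → cnt x x r + 1 ≡ cnt x x (suc (suc r))
cnt-∸2-< true  r = +-comm _ 1
cnt-∸2-< false r = +-comm _ 1

not-fixed : ∀ {x} → x ≡ not x → ⊥
not-fixed {true}  ()
not-fixed {false} ()

-- Lists without repetition, permutations and counting.

module _ {A : Set} where

  ∷-last : ∀ (x : A) xs → ∃₂ λ ys y → x ∷ xs ≡ ys ++ [ y ]
  ∷-last x []       = [] , x , refl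
  ∷-last x (z ∷ xs) with ys , y , eq ← ∷-last z xs = x ∷ ys , y , cong (x ∷_) eq

  Unique-resp-↭ : {xs ys : List A} → xs ↭ ys → Unique xs → Unique ys
  Unique-resp-↭ p = SetoidPerm.Unique-resp-↭ (setoid A) (↭⇒↭ₛ p)

  Unique-resp-⊆ : {xs ys : List A} → xs ⊆ ys → Unique ys → Unique xs
  Unique-resp-⊆ []ˢ         []       = []
  Unique-resp-⊆ (_ ∷ʳˢ s)  (_ ∷ u)  = Unique-resp-⊆ s u
  Unique-resp-⊆ (refl ∷ˢ s) (p ∷ u)  = Sub.All-resp-⊆ s p ∷ Unique-resp-⊆ s u

  Unique-++⁻ˡ : ∀ xs {ys : List A} → Unique (xs ++ ys) → Unique xs
  Unique-++⁻ˡ []       _        = []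
  Unique-++⁻ˡ (x ∷ xs) (p ∷ ps) =
    All.tabulate (λ i → All.lookup p (∈-++⁺ˡ i)) ∷ Unique-++⁻ˡ xs ps

  Unique-++⁻ʳ : ∀ xs {ys : List A} → Unique (xs ++ ys) → Unique ys
  Unique-++⁻ʳ []       u        = u
  Unique-++⁻ʳ (x ∷ xs) (_ ∷ ps) = Unique-++⁻ʳ xs ps

  ++-disjoint : ∀ xs {ys : List A} {v} → Unique (xs ++ ys) → v ∈ xs → v ∉ ys
  ++-disjoint (x ∷ xs) (p ∷ _)  (here refl) j = All.lookup p (∈-++⁺ʳ xs j) refl
  ++-disjoint (x ∷ xs) (_ ∷ ps) (there i)   j = ++-disjoint xs ps i j

  Unique-∷ : ∀ {x} {xs : List A} → x ∉ xs → Unique xs → Unique (x ∷ xs)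
  Unique-∷ x∉xs u = All.tabulate (λ { i refl → x∉xs i }) ∷ u

  Unique-++⁺ : {xs ys : List A} → Unique xs → Unique ys →
               (∀ {v} → v ∈ xs → v ∉ ys) → Unique (xs ++ ys)
  Unique-++⁺ u w d = Uniq.++⁺ u w (λ (i , j) → d i j)

  concat-↭ : {xss yss : List (List A)} → xss ↭ yss → concat xss ↭ concat yss
  concat-↭ Perm.refl                 = ↭-refl
  concat-↭ (Perm.prep xs p)          = ++⁺ˡ xs (concat-↭ p)
  concat-↭ (Perm.swap xs ys p)       = ↭-trans (shifts xs ys) (++⁺ˡ ys (++⁺ˡ xs (concat-↭ p)))
  concat-↭ (Perm.trans p q)          = ↭-trans (concat-↭ p) (concat-↭ q)

  infix 4 _⊑_
  -- The order is disregarded because a core leg may be used reversed.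
  _⊑_ : List A → List A → Set
  xs ⊑ ys = Unique xs × (∀ {v} → v ∈ xs → v ∈ ys)

  concat-⊑-∈ : ∀ {xss yss v} → Pointwise _⊑_ xss yss → v ∈ concat xss → v ∈ concat yss
  concat-⊑-∈ {xs ∷ _} {ys ∷ _} ((_ , s) ∷ ps) i with ∈-++⁻ xs i
  ... | inj₁ j = ∈-++⁺ˡ (s j)
  ... | inj₂ j = ∈-++⁺ʳ ys (concat-⊑-∈ ps j)

  concat-⊑-Unique : ∀ {xss yss} → Pointwise _⊑_ xss yss → Unique (concat yss) → Unique (concat xss)
  concat-⊑-Unique                     []             _ = []
  concat-⊑-Unique {yss = ys ∷ _} ((u , s) ∷ ps) w =
    Unique-++⁺ u (concat-⊑-Unique ps (Unique-++⁻ʳ ys w))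
      λ i j → ++-disjoint ys w (s i) (concat-⊑-∈ ps j)

  Unique-⊆⇒length≤ : ∀ {xs ys : List A} → Unique xs → (∀ {v} → v ∈ xs → v ∈ ys) →
                     length xs ≤ length ys
  Unique-⊆⇒length≤ []       _ = z≤n
  Unique-⊆⇒length≤ {x ∷ xs} (p ∷ u) s with ∈-∃++ (s (here refl))
  ... | as , bs , refl = ≤-trans (s≤s (Unique-⊆⇒length≤ u step)) (≤-reflexive eq)
    where
    step : ∀ {v} → v ∈ xs → v ∈ as ++ bs
    step i with ∈-++⁻ as (s (there i))
    ... | inj₁ j           = ∈-++⁺ˡ j
    ... | inj₂ (here refl) = ⊥-elim (All.lookup p i refl)
    ... | inj₂ (there j)   = ∈-++⁺ʳ as j
    eq : suc (length (as ++ bs)) ≡ length (as ++ x ∷ bs)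
    eq = trans (cong suc (length-++ as)) (trans (sym (+-suc (length as) _)) (sym (length-++ as)))

  count : (A → Bool) → List A → ℕ
  count p []       = 0
  count p (x ∷ xs) = bit (p x) + count p xs

  count-++ : ∀ p xs {ys} → count p (xs ++ ys) ≡ count p xs + count p ys
  count-++ p []       = refl
  count-++ p (x ∷ xs) = trans (cong (bit (p x) +_) (count-++ p xs)) (sym (+-assoc (bit (p x)) _ _))

  count-↭ : ∀ p {xs ys} → xs ↭ ys → count p xs ≡ count p ys
  count-↭ p Perm.refl         = refl
  count-↭ p (Perm.prep x q)   = cong (bit (p x) +_) (count-↭ p q)
  count-↭ p (Perm.swap x y q) rewrite count-↭ p q = lemma (bit (p x)) (bit (p y)) _
    where
    lemma : ∀ a b c → a + (b + c) ≡ b + (a + c)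
    lemma = solve-∀
  count-↭ p (Perm.trans q r)  = trans (count-↭ p q) (count-↭ p r)

  keep : (A → Bool) → List A → List A
  keep p = filter (λ x → p x Bool.≟ true)

  length-keep : ∀ p xs → length (keep p xs) ≡ count p xs
  length-keep p []       = refl
  length-keep p (x ∷ xs) with p x
  ... | true  = cong suc (length-keep p xs)
  ... | false = length-keep p xs

  ∈-keep⁺ : ∀ p {x xs} → x ∈ xs → p x ≡ true → x ∈ keep p xs
  ∈-keep⁺ p = ∈-filter⁺ (λ x → p x Bool.≟ true)

  ∈-keep⁻ : ∀ p {x} xs → x ∈ keep p xs → x ∈ xs × p x ≡ true
  ∈-keep⁻ p xs = ∈-filter⁻ (λ x → p x Bool.≟ true) {xs = xs}

  Unique-keep : ∀ p {xs} → Unique xs → Unique (keep p xs)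
  Unique-keep p = Uniq.filter⁺ (λ x → p x Bool.≟ true)

  count-keep : ∀ (p q : A → Bool) xs → count p (keep q xs) ≡ count (λ x → q x ∧ p x) xs
  count-keep p q []       = refl
  count-keep p q (x ∷ xs) with q x
  ... | true  = cong (bit (p x) +_) (count-keep p q xs)
  ... | false = count-keep p q xs

  count-split : ∀ (p q : A → Bool) xs → count p xs ≡ count (λ x → q x ∧ p x) xs + count (λ x → not (q x) ∧ p x) xs
  count-split p q []       = refl
  count-split p q (x ∷ xs) with q x
  ... | true  rewrite count-split p q xs = sym (+-assoc (bit (p x)) _ _)
  ... | false rewrite count-split p q xs = lemma (bit (p x)) (count (λ y → q y ∧ p y) xs) _
    where
    lemma : ∀ a b c → a + (b + c) ≡ b + (a + c)
    lemma = solve-∀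

  Unique-⊆⇒length≤count : ∀ p {ys xs} → Unique ys → (∀ {y} → y ∈ ys → y ∈ xs × p y ≡ true) →
                           length ys ≤ count p xs
  Unique-⊆⇒length≤count p {ys} {xs} u h =
    ≤-trans (Unique-⊆⇒length≤ u (λ i → ∈-keep⁺ p (proj₁ (h i)) (proj₂ (h i)))) (≤-reflexive (length-keep p xs))

  count-mono : ∀ (p q : A → Bool) xs → (∀ {x} → x ∈ xs → p x ≡ true → q x ≡ true) → count p xs ≤ count q xs
  count-mono p q []       h = z≤n
  count-mono p q (x ∷ xs) h = +-mono-≤ (bit-mono (h (here refl))) (count-mono p q xs (λ i → h (there i)))
    where
    bit-mono : ∀ {a b} → (a ≡ true → b ≡ true) → bit a ≤ bit b
    bit-mono {false} _ = z≤n
    bit-mono {true}  f rewrite f refl = ≤-refl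

  count≤length : ∀ (p : A → Bool) xs → count p xs ≤ length xs
  count≤length p []       = z≤n
  count≤length p (x ∷ xs) with p x
  ... | true  = s≤s (count≤length p xs)
  ... | false = m≤n⇒m≤1+n (count≤length p xs)

  -- The members of `ys` are counted on the right only. This trades core vertices that a
  -- configuration already contains for a flat charge.
  count-without : ∀ (p q : A → Bool) {ys} xs → Unique ys →
                  (∀ {y} → y ∈ ys → y ∈ xs × q y ≡ false × p y ≡ true) →
                  count (λ x → q x ∧ p x) xs + length ys ≤ count p xs
  count-without p q {ys} xs u h = begin
    count (λ x → q x ∧ p x) xs + length ys                              ≤⟨ +-monoʳ-≤ (count (λ x → q x ∧ p x) xs) (Unique-⊆⇒length≤count _ u h′) ⟩
    count (λ x → q x ∧ p x) xs + count (λ x → not (q x) ∧ p x) xs       ≡⟨ sym (count-split p q xs) ⟩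
    count p xs                                                          ∎
    where
    open ≤-Reasoning
    h′ : ∀ {y} → y ∈ ys → y ∈ xs × (not (q y) ∧ p y) ≡ true
    h′ i with h i
    ... | a , b , c rewrite b | c = a , refl

-- Paths and the alternation of colours along them.

module Walks {Node : Set} (_~_ : Rel Node 0ℓ) (~-sym : Symmetric _~_) where

  -- Legs are listed from the far end towards the root c, so that a leg is prolonged by ∷.
  end : Node → List Node → Node
  end c []      = c
  end c (x ∷ _) = x

  Path : Node → List Node → Set
  Path c []       = ⊤
  Path c (x ∷ xs) = x ~ end c xs × Path c xs

  end-++ : ∀ {c} xs {ys} → end c (xs ++ ys) ≡ end (end c ys) xs
  end-++ []      = refl
  end-++ (x ∷ _) = refl

  Path-++⁺ : ∀ {c} xs {ys} → Path (end c ys) xs → Path c ys → Path c (xs ++ ys)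
  Path-++⁺ []           _       q = q
  Path-++⁺ (x ∷ xs) {ys} (e , p) q = subst (x ~_) (sym (end-++ xs {ys})) e , Path-++⁺ xs p q

  Path-++⁻ʳ : ∀ {c} xs {ys} → Path c (xs ++ ys) → Path c ys
  Path-++⁻ʳ []       p       = p
  Path-++⁻ʳ (x ∷ xs) (_ , p) = Path-++⁻ʳ xs p

  Path-++⁻ˡ : ∀ {c} xs {ys} → Path c (xs ++ ys) → Path (end c ys) xs
  Path-++⁻ˡ []            _       = tt
  Path-++⁻ˡ (x ∷ xs) {ys} (e , p) = subst (x ~_) (end-++ xs {ys}) e , Path-++⁻ˡ xs p

  Path-reverse⁺ : ∀ {c v} xs → Path c (v ∷ xs) → Path v (c ∷ reverse xs)
  Path-reverse⁺ []       (e , _) = ~-sym e , tt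
  Path-reverse⁺ {c} {v} (x ∷ xs) (e , p) =
    subst (λ l → Path v (c ∷ l)) (sym (unfold-reverse x xs)) (Path-++⁺ (c ∷ reverse xs) (Path-reverse⁺ xs p) (~-sym e , tt))

  Path-reverse : ∀ {c v} xs → Path c (v ∷ xs) → Path v (reverse xs)
  Path-reverse xs p = proj₂ (Path-reverse⁺ xs p)

  module Coloured (col : Node → Bool) (alt : ∀ {x y} → x ~ y → col x ≡ not (col y)) where

    hue : Bool → Node → Bool
    hue b v = does (col v Bool.≟ b)

    hue-true : ∀ {b v} → col v ≡ b → hue b v ≡ true
    hue-true {b} {v} e with col v Bool.≟ b
    ... | yes _ = refl
    ... | no ne = ⊥-elim (ne e)

    -- The end of a partial leg determines the colours of the vertices still missing, so the leg can
    -- be charged as if it were complete.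
    count+cnt : ∀ b {c} xs → Path c xs → ∀ r →
                count (hue b) xs + cnt b (col (end c xs)) r ≡ cnt b (col c) (length xs + r)
    count+cnt b         []       _       r = refl
    count+cnt b {c} (x ∷ xs) (e , p) r =
      trans (trans (lemma (bit (hue b x)) (count (hue b) xs) (cnt b (col x) r)) eq)
        (trans (count+cnt b xs p (suc r)) (cong (cnt b (col c)) (+-suc (length xs) r)))
      where
      lemma : ∀ a b c → (a + b) + c ≡ b + (a + c)
      lemma = solve-∀
      eq : count (hue b) xs + (bit (hue b x) + cnt b (col x) r) ≡ count (hue b) xs + cnt b (col (end c xs)) (suc r)
      eq rewrite alt e = refl

    count-path : ∀ b {c} xs → Path c xs → count (hue b) xs ≡ cnt b (col c) (length xs)
    count-path b {c} xs p = trans (sym (+-identityʳ _))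
      (trans (count+cnt b xs p 0) (cong (cnt b (col c)) (+-identityʳ (length xs))))

-- Greedy extension of legs in a bipartite host graph.

module Host {n : ℕ} (_~_ : Rel (Fin n) 0ℓ) (~-sym : Symmetric _~_)
            (col : Fin n → Bool) (alt : ∀ {x y} → x ~ y → col x ≡ not (col y)) where

  Node : Set
  Node = Fin n

  open Walks _~_ ~-sym public
  open Coloured col alt public

  infix 4 _∈?_
  _∈?_ : (v : Node) (xs : List Node) → Relation.Nullary.Dec (v ∈ xs)
  _∈?_ = DecMem._∈?_ Fin._≟_

  abstract
    off : List Node → Node → Bool
    off D v = not (does (v ∈? D))

    off-true : ∀ {D v} → v ∉ D → off D v ≡ true
    off-true {D} {v} v∉ = cong not (dec-false (v ∈? D) v∉)

    off-false : ∀ {D v} → v ∈ D → off D v ≡ false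
    off-false {D} {v} v∈ = cong not (dec-true (v ∈? D) v∈)

  true-off : ∀ {D v} → off D v ≡ true → v ∉ D
  true-off h i with trans (sym h) (off-false i)
  ... | ()

  -- At least `k` neighbours in `ω`, in the form in which this is used: fewer than `k` forbidden
  -- vertices cannot block all of them.
  Deg : Node → ℕ → (Node → Bool) → Set
  Deg u k ω = ∀ X → length X < k → ∃ λ v → v ~ u × ω v ≡ true × v ∉ X

  -- Every neighbour of `u` has the opposite colour, so forbidden vertices with the colour of `u`
  -- cost nothing.
  Deg-hue : ∀ {u k ω} → Deg u k ω → ∀ X → count (hue (not (col u))) X < k →
            ∃ λ v → v ~ u × ω v ≡ true × v ∉ X
  Deg-hue {u} d X h with d (keep (hue (not (col u))) X) (subst (_< _) (sym (length-keep _ X)) h)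
  ... | v , e , w , v∉ = v , e , w , λ i → v∉ (∈-keep⁺ (hue (not (col u))) i (hue-true (alt e)))

  -- A task is the end of a leg with the number of vertices missing beyond it; the sum counts the
  -- vertices of colour `b` yet to be added.
  slots : Bool → List (Node × ℕ) → ℕ
  slots b tasks = sum (map (λ (u , r) → cnt b (col u) r) tasks)

  ends : Node → List (List Node × ℕ) → List (Node × ℕ)
  ends c = map (λ (xs , r) → end c xs , r)

  bit-∧-≤ : ∀ a b → bit (a ∧ b) ≤ bit b
  bit-∧-≤ true  b = ≤-refl
  bit-∧-≤ false b = z≤n

  bit≤1 : ∀ a → bit a ≤ 1
  bit≤1 true  = ≤-refl
  bit≤1 false = z≤n

  bit-refl : ∀ x → bit (does (x Bool.≟ x)) ≡ 1
  bit-refl true  = refl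
  bit-refl false = refl

  -- The new vertex takes up the slot of its own colour, so used and pending vertices together do
  -- not increase. Equality may fail because `ρ` may ignore `v`.
  count-advance : ∀ (ρ : Node → Bool) (σ : ℕ) b {u v} S r → v ~ u →
    count (λ x → ρ x ∧ hue b x) (v ∷ S) + (cnt b (col v) r + σ) ≤
    count (λ x → ρ x ∧ hue b x) S + (cnt b (col u) (suc r) + σ)
  count-advance ρ σ b {u} {v} S r e = begin
    bit (ρ v ∧ hue b v) + k + (cnt b (col v) r + σ)
      ≡⟨ cong (λ z → bit (ρ v ∧ hue b v) + k + (cnt b z r + σ)) (alt e) ⟩
    bit (ρ v ∧ hue b v) + k + (cnt b (not (col u)) r + σ)
      ≤⟨ +-monoˡ-≤ _ (+-monoˡ-≤ k (≤-trans (bit-∧-≤ (ρ v) _) (≤-reflexive (cong (λ z → bit (does (z Bool.≟ b))) (alt e))))) ⟩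
    bit (does (not (col u) Bool.≟ b)) + k + (cnt b (not (col u)) r + σ)
      ≡⟨ lemma (bit (does (not (col u) Bool.≟ b))) k _ _ ⟩
    k + (bit (does (not (col u) Bool.≟ b)) + cnt b (not (col u)) r + σ) ∎
    where
    open ≤-Reasoning
    k : ℕ
    k = count (λ x → ρ x ∧ hue b x) S
    lemma : ∀ a k c d → a + k + (c + d) ≡ k + (a + c + d)
    lemma = solve-∀

  -- The pending step itself owns a slot of the colour sought, whence the strict inequality.
  count-room : ∀ (ρ : Node → Bool) (m σ τ : ℕ) {u} S r → m ≤ σ →
    count (λ x → ρ x ∧ hue (not (col u)) x) S + (cnt (not (col u)) (col u) (suc r) + σ) ≤ τ →
    count (λ x → ρ x ∧ hue (not (col u)) x) S + m < τ
  count-room ρ m σ τ {u} S r m≤σ h = begin-strict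
    k + m                          ≤⟨ +-monoʳ-≤ k (≤-trans m≤σ (m≤n+m σ d)) ⟩
    k + (d + σ)                    <⟨ +-monoʳ-< k (n<1+n _) ⟩
    k + (1 + (d + σ))              ≡⟨ cong (λ z → k + (z + d + σ)) (sym (bit-refl (not (col u)))) ⟩
    k + (cnt (not (col u)) (col u) (suc r) + σ) ≤⟨ h ⟩
    τ ∎
    where
    open ≤-Reasoning
    k d : ℕ
    k = count (λ x → ρ x ∧ hue (not (col u)) x) S
    d = cnt (not (col u)) (not (col u)) r

  Grown : (Node → Bool) → Node × ℕ → List Node → Set
  Grown ω (u , r) y = Path u y × length y ≡ r × All (λ v → ω v ≡ true) y

  Extended : (Node → Bool) → Node → List Node × ℕ → List Node → Set
  Extended ω c (xs , r) leg = ∃ λ y → leg ≡ y ++ xs × Grown ω (end c xs , r) y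

  attach : ∀ {ω} c gs {yss} → Pointwise (Grown ω) (ends c gs) yss →
           ∃ λ legs → Pointwise (Extended ω c) gs legs × concat yss ++ concat (map proj₁ gs) ↭ concat legs
  attach c []              []                            = [] , [] , ↭-refl
  attach c ((xs , r) ∷ gs) {y ∷ yss} (gr ∷ grs) with attach c gs grs
  ... | legs , es , p = (y ++ xs) ∷ legs , (y , refl , gr) ∷ es ,
    ↭-trans (↭-trans (↭-reflexive (++-assoc y _ _)) (++⁺ˡ y (shifts (concat yss) xs)))
      (↭-trans (↭-reflexive (sym (++-assoc y xs _))) (++⁺ˡ (y ++ xs) p))

  attach-all : ∀ {ω} E c gs {yss} → Pointwise (Grown ω) (ends c gs) yss →
               Unique (concat yss ++ E ++ c ∷ concat (map proj₁ gs)) →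
               ∃ λ legs → Pointwise (Extended ω c) gs legs × Unique (E ++ c ∷ concat legs)
  attach-all E c gs {yss} grs uq with attach c gs grs
  ... | legs , es , p =
    legs , es , Unique-resp-↭ (↭-trans (shifts (concat yss) E) (++⁺ˡ E (↭-trans (shift c (concat yss) _) (prep c p)))) uq

  extended-path : ∀ {ω c g leg} → Path c (proj₁ g) → Extended ω c g leg → Path c leg
  extended-path p (y , refl , q , _) = Path-++⁺ y q p

  extended-length : ∀ {ω c} g {leg} → Extended ω c g leg → length leg ≡ length (proj₁ g) + proj₂ g
  extended-length (xs , r) (y , refl , _ , refl , _) = trans (length-++ y) (+-comm (length y) _)

  count-concat : ∀ b c {xss} → All (Path c) xss →
                 count (hue b) (concat xss) ≡ sum (map (cnt b (col c)) (map length xss))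
  count-concat b c []                    = refl
  count-concat b c {xs ∷ xss} (p ∷ ps) =
    trans (count-++ (hue b) xs) (cong₂ _+_ (count-path b xs p) (count-concat b c ps))

  -- `ℓ` marks the vertices from which growth can go on, `ρ` the used vertices that are charged one
  -- by one; `μ` is a flat charge per colour for whatever else is forbidden, and `τ` is the
  -- available degree.
  module Growth (ℓ ρ : Node → Bool) (μ : Bool → ℕ) (τ : ℕ)
    (pick : ∀ {u} X → ℓ u ≡ true →
            count (λ x → ρ x ∧ hue (not (col u)) x) X + μ (not (col u)) < τ →
            ∃ λ v → v ~ u × ℓ v ≡ true × v ∉ X) where

    κ : Bool → List Node → ℕ
    κ b = count (λ x → ρ x ∧ hue b x)

    -- `σ` stands for the slots of all the other tasks together with `μ`, so that finishing this leg
    -- leaves room for them.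
    growOne : ∀ (σ : Bool → ℕ) S u r → Unique S → r ≡ 0 ⊎ ℓ u ≡ true → (∀ b → μ b ≤ σ b) →
              (∀ b → κ b S + (cnt b (col u) r + σ b) ≤ τ) →
              ∃ λ y → Grown ℓ (u , r) y × Unique (y ++ S) × (∀ b → κ b (y ++ S) + σ b ≤ τ)
    growOne σ S u zero    uq _         _  h = [] , (tt , refl , []) , uq , h
    growOne σ S u (suc r) uq (inj₂ ℓu) μσ h
      with pick S ℓu (count-room ρ (μ (not (col u))) (σ (not (col u))) τ S r (μσ (not (col u))) (h (not (col u))))
    ... | v , e , ℓv , v∉S
      with growOne σ (v ∷ S) v r (Unique-∷ v∉S uq) (inj₂ ℓv) μσ (λ b → ≤-trans (count-advance ρ (σ b) b S r e) (h b))
    ... | y , (p , len , al) , uq′ , h″ =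
      y ++ [ v ] ,
      (Path-++⁺ y p (e , tt) , trans (length-++ y) (trans (+-comm (length y) 1) (cong suc len)) , Allₚ.++⁺ al (ℓv ∷ [])) ,
      subst Unique (sym (++-assoc y [ v ] S)) uq′ ,
      λ b → subst (λ z → κ b z + σ b ≤ τ) (sym (++-assoc y [ v ] S)) (h″ b)

    -- A task with nothing missing may end anywhere, in particular at a vertex of low degree.
    grow : ∀ S tasks → Unique S → All (λ (u , r) → r ≡ 0 ⊎ ℓ u ≡ true) tasks →
           (∀ b → κ b S + (slots b tasks + μ b) ≤ τ) →
           ∃ λ yss → Pointwise (Grown ℓ) tasks yss × Unique (concat yss ++ S)
    grow S []              uq _        _ = [] , [] , uq
    grow S ((u , r) ∷ tasks) uq (g ∷ gs) h
      with growOne (λ b → slots b tasks + μ b) S u r uq g (λ b → m≤n+m _ _)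
             (λ b → ≤-trans (≤-reflexive (cong (κ b S +_) (sym (+-assoc (cnt b (col u) r) _ _)))) (h b))
    ... | y , gr , uq′ , h′ with grow (y ++ S) tasks uq′ gs h′
    ... | yss , grs , uq″ = y ∷ yss , gr ∷ grs , Unique-resp-↭ perm uq″
      where
      perm : concat yss ++ y ++ S ↭ (y ++ concat yss) ++ S
      perm = ↭-trans (shifts (concat yss) y) (↭-reflexive (sym (++-assoc y (concat yss) S)))

    extend : ∀ E c gs → Unique (E ++ c ∷ concat (map proj₁ gs)) →
             All (λ (xs , r) → r ≡ 0 ⊎ ℓ (end c xs) ≡ true) gs →
             (∀ b → κ b (E ++ c ∷ concat (map proj₁ gs)) + (slots b (ends c gs) + μ b) ≤ τ) →
             ∃ λ legs → Pointwise (Extended ℓ c) gs legs × Unique (E ++ c ∷ concat legs)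
    extend E c gs uq ok h =
      let _ , grs , uq′ = grow (E ++ c ∷ concat (map proj₁ gs)) (ends c gs) uq (Allₚ.map⁺ ok) h
      in attach-all E c gs grs uq′

  -- `cap` bounds both colour classes of a spider with leg lengths `ls`, for either colour `x` of
  -- the centre, since the centre of a copy may lie on either side of the host.
  module Capacity (ls : List ℕ) (t : ℕ)
    (cap : ∀ x b → bit (does (x Bool.≟ b)) + sum (map (cnt b x) ls) ≤ t) where

    record Spider (ω : Node → Bool) (c : Node) (legs : List (List Node)) : Set where
      field
        lens   : map length legs ↭ ls
        paths  : All (Path c) legs
        uniq   : Unique (c ∷ concat legs)
        inside : ∀ {v} → v ∈ c ∷ concat legs → ω v ≡ true

    open Spider public

    restrict : ∀ {ω ω′ c legs} → Spider ω c legs →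
               (∀ {v} → v ∈ c ∷ concat legs → ω v ≡ true → ω′ v ≡ true) → Spider ω′ c legs
    restrict s f = record { lens = lens s ; paths = paths s ; uniq = uniq s ; inside = λ i → f i (inside s i) }

    rearrange : ∀ {ω c legs legs′} → Spider ω c legs → legs ↭ legs′ → Spider ω c legs′
    rearrange s p = record
      { lens   = ↭-trans (map⁺ length (↭-sym p)) (lens s)
      ; paths  = All-resp-↭ p (paths s)
      ; uniq   = Unique-resp-↭ (prep _ (concat-↭ p)) (uniq s)
      ; inside = λ i → inside s (∈-resp-↭ (prep _ (concat-↭ (↭-sym p))) i) }

    size : List Node × ℕ → ℕ
    size (xs , r) = length xs + r

    load : Bool → Node → List (List Node × ℕ) → ℕ
    load b c gs = sum (map (λ (xs , r) → count (hue b) xs + cnt b (col (end c xs)) r) gs)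

    load-sizes : ∀ b c {gs} → All (λ g → Path c (proj₁ g)) gs → load b c gs ≡ sum (map (cnt b (col c)) (map size gs))
    load-sizes b c []                        = refl
    load-sizes b c {(xs , r) ∷ gs} (p ∷ ps) = cong₂ _+_ (count+cnt b xs p r) (load-sizes b c ps)

    load-split : ∀ b c gs → load b c gs ≡ count (hue b) (concat (map proj₁ gs)) +
                                            slots b (ends c gs)
    load-split b c []              = refl
    load-split b c ((xs , r) ∷ gs) =
      trans (cong (count (hue b) xs + cnt b (col (end c xs)) r +_) (load-split b c gs))
        (trans (lemma (count (hue b) xs) (cnt b (col (end c xs)) r) (count (hue b) (concat (map proj₁ gs))) _)
          (cong (_+ (cnt b (col (end c xs)) r + slots b (ends c gs))) (sym (count-++ (hue b) xs))))
      where
      lemma : ∀ a b c d → a + b + (c + d) ≡ a + c + (b + d)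
      lemma = solve-∀

    load≤ : ∀ b c {gs} → All (λ g → Path c (proj₁ g)) gs → map size gs ↭ ls → bit (hue b c) + load b c gs ≤ t
    load≤ b c ps q rewrite load-sizes b c ps | sum-↭ (map⁺ (cnt b (col c)) q) = cap (col c) b

    count-spider≤ : ∀ {ω c legs} → Spider ω c legs → ∀ b → count (hue b) (c ∷ concat legs) ≤ t
    count-spider≤ {c = c} s b
      rewrite count-concat b c (paths s) | sum-↭ (map⁺ (cnt b (col c)) (lens s)) = cap (col c) b

    -- When a vertex of some colour is due, fewer than `t` vertices of that colour have been placed,
    -- so degree `t` suffices.
    greedy : ∀ {ω} → (∀ {u} → ω u ≡ true → Deg u t ω) → ∀ {r} → ω r ≡ true → ∃ λ legs → Spider ω r legs
    greedy {ω} deg {r} ωr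
      with Growth.grow ω (λ _ → true) (λ _ → 0) t
             (λ X ωu h → Deg-hue (deg ωu) X (subst (_< t) (+-identityʳ _) h))
             [ r ] (map (r ,_) ls) ([] ∷ []) (Allₚ.map⁺ (All.universal (λ _ → inj₂ ωr) ls))
             (λ b → ≤-trans (≤-reflexive (eq b)) (cap (col r) b))
      where
      eq : ∀ b → (bit (hue b r) + 0) + (sum (map (λ (u , r) → cnt b (col u) r) (map (r ,_) ls)) + 0)
               ≡ bit (hue b r) + sum (map (cnt b (col r)) ls)
      eq b rewrite sym (map-∘ {g = λ (u , r) → cnt b (col u) r} {f = r ,_} ls) = lemma (bit (hue b r)) _
        where
        lemma : ∀ a b → a + 0 + (b + 0) ≡ a + b
        lemma = solve-∀
    ... | yss , grs , uq = yss , record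
      { lens = ↭-reflexive (lens′ grs) ; paths = paths′ grs
      ; uniq = Unique-resp-↭ (++-comm (concat yss) [ r ]) uq
      ; inside = λ { (here refl) → ωr ; (there i) → ins grs i } }
      where
      lens′ : ∀ {ks yss} → Pointwise (Grown ω) (map (r ,_) ks) yss → map length yss ≡ ks
      lens′ {[]}     []                   = refl
      lens′ {k ∷ ks} ((_ , e , _) ∷ grs) = cong₂ _∷_ e (lens′ grs)
      paths′ : ∀ {ks yss} → Pointwise (Grown ω) (map (r ,_) ks) yss → All (Path r) yss
      paths′ {[]}     []               = []
      paths′ {k ∷ ks} ((p , _) ∷ grs) = p ∷ paths′ grs
      ins : ∀ {ks yss v} → Pointwise (Grown ω) (map (r ,_) ks) yss → v ∈ concat yss → ω v ≡ true
      ins {k ∷ ks} {y ∷ yss} ((_ , _ , al) ∷ grs) i with ∈-++⁻ y i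
      ... | inj₁ j = All.lookup al j
      ... | inj₂ j = ins grs j

-- Rerouting a leg around a vertex that every copy has to use.

module Absorption {n : ℕ} (_~_ : Rel (Fin n) 0ℓ) (_~?_ : Decidable _~_) (~-sym : Symmetric _~_)
  (col : Fin n → Bool) (alt : ∀ {x y} → x ~ y → col x ≡ not (col y))
  (ls : List ℕ) (t : ℕ) (cap : ∀ x b → bit (does (x Bool.≟ b)) + sum (map (cnt b x) ls) ≤ t) where

  open Host _~_ ~-sym col alt
  open Capacity ls t cap

  -- In the application ω is the complement of a block and α consists of its vertices with two
  -- neighbours in the block: these can be absorbed, so every copy of the spider has to use them.
  module Hit (ω α : Node → Bool)
    (rich : ∀ {u} → ω u ≡ true → α u ≡ false → Deg u (suc t) ω)
    (hit : ∀ {c legs x} → Spider ω c legs → α x ≡ true → x ∈ c ∷ concat legs) where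

    outside⇒poor : ∀ {c legs u} → Spider ω c legs → u ∉ c ∷ concat legs → α u ≡ false
    outside⇒poor {u = u} s u∉ with α u in eq
    ... | false = refl
    ... | true  = ⊥-elim (u∉ (hit s eq))

    -- The copy has at most `t` vertices of the colour opposite to `u`, one fewer than `u` has
    -- neighbours in `ω`.
    free-neighbour : ∀ {c legs u} → Spider ω c legs → ω u ≡ true → α u ≡ false →
                     ∃ λ z → z ~ u × ω z ≡ true × z ∉ c ∷ concat legs
    free-neighbour {u = u} s ωu αu = Deg-hue (rich ωu αu) _ (s≤s (count-spider≤ s (not (col u))))

    module _ {c x} tl rest others (s : Spider ω c ((tl ++ x ∷ rest) ∷ others)) (αx : α x ≡ true) where

      private
        old : List Node
        old = c ∷ ((tl ++ rest) ++ concat others)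

        old-↭ : c ∷ ((tl ++ x ∷ rest) ++ concat others) ↭ x ∷ old
        old-↭ = ↭-trans (prep c (++⁺ʳ (concat others) (shift x tl rest))) (↭-swap c x ↭-refl)

        old-Unique : Unique (x ∷ old)
        old-Unique = Unique-resp-↭ old-↭ (uniq s)

        inside-old : ∀ {v} → v ∈ old → ω v ≡ true
        inside-old i = inside s (∈-resp-↭ (↭-sym old-↭) (there i))

        path : Path c (tl ++ x ∷ rest)
        path with p ∷ _ ← paths s = p

        path-others : All (Path c) others
        path-others with _ ∷ ps ← paths s = ps

      -- The leg becomes kept ++ acc ++ rest, where kept comes from the old tail and acc is new.
      miss : ∀ kept acc → kept ⊆ tl → Path c (kept ++ acc ++ rest) →
             length kept + length acc ≡ suc (length tl) → Unique acc →
             (∀ {v} → v ∈ acc → ω v ≡ true × v ∉ x ∷ old) → ⊥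
      miss kept acc sub p len ua fresh = ++-disjoint [ x ] uq-x (here refl) (∈-resp-↭ perm⁻ (hit new αx))
        where
        remaining : List Node
        remaining = c ∷ ((kept ++ rest) ++ concat others)
        sub′ : remaining ⊆ old
        sub′ = refl ∷ˢ Sub.++⁺ (Sub.++⁺ sub ⊆-refl) ⊆-refl
        perm⁻ : c ∷ ((kept ++ acc ++ rest) ++ concat others) ↭ acc ++ remaining
        perm⁻ = ↭-trans (prep c (↭-trans (++⁺ʳ (concat others) (shifts kept acc)) (↭-reflexive (++-assoc acc (kept ++ rest) (concat others)))))
                        (↭-sym (shift c acc ((kept ++ rest) ++ concat others)))
        uq-x : Unique ([ x ] ++ acc ++ remaining)
        uq-x = Unique-resp-↭ (shifts acc [ x ])
                 (Unique-++⁺ ua (Unique-resp-⊆ (refl ∷ˢ sub′) old-Unique)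
                   (λ i j → proj₂ (fresh i) (Sub.Any-resp-⊆ (refl ∷ˢ sub′) j)))
        inside′ : ∀ {v} → v ∈ acc ++ remaining → ω v ≡ true
        inside′ i with ∈-++⁻ acc i
        ... | inj₁ j = proj₁ (fresh j)
        ... | inj₂ j = inside-old (Sub.Any-resp-⊆ sub′ j)
        same : length (kept ++ acc ++ rest) ≡ length (tl ++ x ∷ rest)
        same = trans (length-++ kept) (trans (cong (length kept +_) (length-++ acc))
                 (trans (sym (+-assoc (length kept) _ _)) (trans (cong (_+ length rest) len)
                   (trans (sym (+-suc (length tl) (length rest))) (sym (length-++ tl))))))
        new : Spider ω c ((kept ++ acc ++ rest) ∷ others)
        new = record
          { lens   = subst (λ k → k ∷ map length others ↭ ls) (sym same) (lens s)
          ; paths  = p ∷ path-others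
          ; uniq   = Unique-resp-↭ (↭-sym perm⁻) (Unique-++⁻ʳ [ x ] uq-x)
          ; inside = λ i → inside′ (∈-resp-↭ perm⁻ i) }

      -- acc has taken the places of done and x; at every step its end r has a neighbour off acc,
      -- x and all the parts of the spider except done and the next place q. If this neighbour lies
      -- on the old tail, then the rest of that tail is long enough to complete the leg.
      reroute : ∀ ts done {r} acc → tl ≡ ts ʳ++ done → Path (end c rest) (r ∷ acc) →
                length (r ∷ acc) + length ts ≡ suc (length tl) → Unique (r ∷ acc) →
                (∀ {v} → v ∈ r ∷ acc → ω v ≡ true × v ∉ x ∷ old) → col r ≡ col (end x done) → ⊥
      reroute [] done {r} acc eq p len u fresh _ =
        miss [] (r ∷ acc) (minimum tl) (Path-++⁺ (r ∷ acc) p (proj₂ (Path-++⁻ʳ tl path)))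
          (trans (sym (+-identityʳ _)) len) u fresh
      reroute (q ∷ ts) done {r} acc eq p len u fresh hr
        with Deg-hue (rich (proj₁ (fresh (here refl))) (outside⇒poor s (λ i → proj₂ (fresh (here refl)) (∈-resp-↭ old-↭ i)))) X bound
        where
        X : List Node
        X = x ∷ ts ++ (c ∷ ((r ∷ acc) ++ rest) ++ concat others)
        b : Bool
        b = not (col r)
        q-path : Path x (reverse ts ++ q ∷ done)
        q-path = subst (Path x) (ʳ++-defn ts) (subst (Path x) eq (Path-++⁻ˡ tl path))
        col-q : col q ≡ b
        col-q = trans (alt (proj₁ (Path-++⁻ʳ (reverse ts) q-path))) (cong not (sym hr))
        count-ts : count (hue b) ts ≡ cnt b (not (col r)) (length ts)
        count-ts = trans (count-↭ (hue b) (↭-sym (↭-reverse ts)))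
          (trans (count-path b (reverse ts) (Path-++⁻ˡ (reverse ts) q-path))
            (cong₂ (cnt b) col-q (length-reverse ts)))
        gs : List (List Node × ℕ)
        gs = ((r ∷ acc) ++ rest , suc (length ts)) ∷ map (_, 0) others
        gs-path : All (λ g → Path c (proj₁ g)) gs
        gs-path = Path-++⁺ (r ∷ acc) p (proj₂ (Path-++⁻ʳ tl path)) ∷ Allₚ.map⁺ path-others
        gs-size : map size gs ↭ ls
        gs-size = subst (_↭ ls) (cong₂ _∷_ (sym e₁) (sym e₂)) (lens s)
          where
          e₂ : map size (map (_, 0) others) ≡ map length others
          e₂ = trans (sym (map-∘ {g = size} {f = _, 0} others)) (map-cong (λ l → +-identityʳ (length l)) others)
          e₁ : length ((r ∷ acc) ++ rest) + suc (length ts) ≡ length (tl ++ x ∷ rest)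
          e₁ = trans (cong (_+ suc (length ts)) (length-++ (r ∷ acc)))
            (trans (lemma (length (r ∷ acc)) (length rest) (suc (length ts)))
              (trans (cong (_+ length rest) len) (trans (sym (+-suc (length tl) _)) (sym (length-++ tl)))))
            where
            lemma : ∀ a b c → a + b + c ≡ a + c + b
            lemma = solve-∀
        load-others : ∀ {xss} → All (Path c) xss → load b c (map (_, 0) xss) ≡ count (hue b) (concat xss)
        load-others []                 = refl
        load-others {xs ∷ xss} (p ∷ ps) = trans (cong₂ _+_ (+-identityʳ _) (load-others ps)) (sym (count-++ (hue b) xs))
        one : bit (does (not (col r) Bool.≟ b)) ≡ 1
        one = cong bit (dec-true (b Bool.≟ b) refl)
        eq-count : 1 + count (hue b) (ts ++ (c ∷ ((r ∷ acc) ++ rest) ++ concat others))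
                   ≡ bit (hue b c) + load b c gs
        eq-count = trans (cong suc (trans (count-++ (hue b) ts) (cong₂ _+_ count-ts
                     (cong (bit (hue b c) +_) (trans (count-++ (hue b) ((r ∷ acc) ++ rest))
                       (cong (count (hue b) ((r ∷ acc) ++ rest) +_) (sym (load-others path-others))))))))
                   (trans (lemma (cnt b (not (col r)) (length ts)) (bit (hue b c)) (count (hue b) ((r ∷ acc) ++ rest)) (load b c (map (_, 0) others)))
                     (cong (λ k → bit (hue b c) + (count (hue b) ((r ∷ acc) ++ rest) + (k + cnt b (not (col r)) (length ts)) +
                                                   load b c (map (_, 0) others))) (sym one)))
          where
          lemma : ∀ a b c d → 1 + (a + (b + (c + d))) ≡ b + (c + (1 + a) + d)
          lemma = solve-∀
        -- The vertex `x` costs at most one. This is covered by the slot of `q`, which has the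
        -- colour sought but does not belong to `X`.
        bound : count (hue b) X < suc t
        bound = s≤s (≤-trans (+-monoˡ-≤ _ (bit≤1 (hue b x))) (≤-trans (≤-reflexive eq-count) (load≤ b c gs-path gs-size)))
      ... | v , e , ωv , v∉X with v ∈? x ∷ old
      ... | no v∉old =
        reroute ts (q ∷ done) (r ∷ acc) eq (e , p) (trans (sym (+-suc _ (length ts))) len)
          (Unique-∷ (λ i → v∉X (there (∈-++⁺ʳ ts (there (∈-++⁺ˡ (∈-++⁺ˡ i)))))) u)
          (λ { (here refl) → ωv , v∉old ; (there i) → fresh i })
          (trans (alt e) (trans (cong not hr) (sym (alt q~))))
        where
        q~ : q ~ end x done
        q~ = proj₁ (Path-++⁻ʳ (reverse ts) (subst (Path x) (ʳ++-defn ts) (subst (Path x) eq (Path-++⁻ˡ tl path))))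
      ... | yes v∈old with ∈-∃++ (v∈done v∈old)
        where
        eq′ : tl ≡ reverse ts ++ q ∷ done
        eq′ = trans eq (ʳ++-defn ts)
        v∈done : v ∈ x ∷ old → v ∈ q ∷ done
        v∈done (here refl)         = ⊥-elim (v∉X (here refl))
        v∈done (there (here refl)) = ⊥-elim (v∉X (there (∈-++⁺ʳ ts (here refl))))
        v∈done (there (there i)) with ∈-++⁻ (tl ++ rest) i
        ... | inj₂ j = ⊥-elim (v∉X (there (∈-++⁺ʳ ts (there (∈-++⁺ʳ ((r ∷ acc) ++ rest) j)))))
        ... | inj₁ j with ∈-++⁻ tl j
        ... | inj₂ k = ⊥-elim (v∉X (there (∈-++⁺ʳ ts (there (∈-++⁺ˡ (∈-++⁺ʳ (r ∷ acc) k))))))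
        ... | inj₁ k with ∈-++⁻ (reverse ts) (subst (v ∈_) eq′ k)
        ... | inj₁ l = ⊥-elim (v∉X (there (∈-++⁺ˡ (∈-resp-↭ (↭-reverse ts) l))))
        ... | inj₂ l = l
      ... | as , bs , eq″ =
        miss (kept ++ [ v ]) (r ∷ acc)
          (subst (λ l → kept ++ [ v ] ⊆ l) (sym tl≡) (Sub.++⁺ (Sub.drop-⊆ (length as) far) (refl ∷ˢ minimum bs)))
          (subst (Path c) (sym (++-assoc kept [ v ] _))
            (Path-++⁺ kept kept-path (e , Path-++⁺ (r ∷ acc) p (proj₂ (Path-++⁻ʳ tl path)))))
          (trans (cong (_+ length (r ∷ acc)) (trans (length-++ kept) (+-comm _ 1)))
            (trans (cong (λ k → suc (k + length (r ∷ acc))) len-kept)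
              (trans (lemma (length ts) (length acc)) len)))
          u fresh
        where
        lemma : ∀ a b → suc (a + suc b) ≡ suc b + suc a
        lemma = solve-∀
        far : List Node
        far = reverse ts ++ as
        -- Legs are listed from the far end, so `drop` discards the surplus at the far end of the
        -- old tail.
        kept : List Node
        kept = drop (length as) far
        tl≡ : tl ≡ far ++ v ∷ bs
        tl≡ = trans eq (trans (ʳ++-defn ts) (trans (cong (reverse ts ++_) eq″) (sym (++-assoc (reverse ts) as (v ∷ bs)))))
        kept-path : Path v kept
        kept-path = Path-++⁻ʳ (take (length as) far) (subst (Path v) (sym (take++drop≡id (length as) far))
                      (Path-++⁻ˡ far (subst (Path x) tl≡ (Path-++⁻ˡ tl path))))
        len-kept : length kept ≡ length ts
        len-kept = trans (length-drop (length as) far) (trans (cong (_∸ length as) (trans (length-++ (reverse ts)) (cong (_+ length as) (length-reverse ts))))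
                     (m+n∸n≡m (length ts) (length as)))

      no-reroute : ∀ {z} → z ~ end c rest → ω z ≡ true → z ∉ c ∷ ((tl ++ x ∷ rest) ++ concat others) → ⊥
      no-reroute {z} e ωz z∉ =
        reroute (reverse tl) [] [] (sym (trans (ʳ++-defn (reverse tl)) (trans (++-identityʳ _) (reverse-involutive tl))))
          (e , tt) (cong suc (length-reverse tl)) ([] ∷ [])
          (λ { (here refl) → ωz , λ i → z∉ (∈-resp-↭ (↭-sym old-↭) i) })
          (trans (alt e) (sym (alt (proj₁ (Path-++⁻ʳ tl path)))))

    -- If `pre` is empty, the leg is rerouted through `z`. Otherwise the vertex `y` of `pre` next to
    -- `x` is poor, hence has a free neighbour of its own to reroute through. Either way a vertex
    -- `x` of `α` would be avoided.
    first-poor : ∀ {c} far x pre rest {others} → Spider ω c ((far ++ x ∷ pre ++ rest) ∷ others) →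
                 ∀ {z} → z ~ end c rest → ω z ≡ true → z ∉ c ∷ ((far ++ x ∷ pre ++ rest) ++ concat others) →
                 All (λ v → α v ≡ false) pre → α x ≡ false
    first-poor far x pre rest s e ωz z∉ αpre with α x in αx
    ... | false = refl
    first-poor far x []      rest s e ωz z∉ []       | true = ⊥-elim (no-reroute far rest _ s αx e ωz z∉)
    first-poor far x (y ∷ l) rest s e ωz z∉ (αy ∷ _) | true
      with w , e′ , ωw , w∉ ← free-neighbour s (inside s (there (∈-++⁺ˡ (∈-++⁺ʳ far (there (here refl)))))) αy
      = ⊥-elim (no-reroute far (y ∷ l ++ rest) _ s αx e′ ωw w∉)

    -- The vertices are settled outwards one by one, each poor one supplying the free neighbour for
    -- the next.
    poor-beyond : ∀ {c} far pre rest {others} → Spider ω c ((far ++ pre ++ rest) ∷ others) →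
                  ∀ {z} → z ~ end c rest → ω z ≡ true → z ∉ c ∷ ((far ++ pre ++ rest) ++ concat others) →
                  All (λ v → α v ≡ false) pre
    poor-beyond far []        rest s e ωz z∉ = []
    poor-beyond {c} far (x ∷ pre) rest {others} s {z} e ωz z∉ = first-poor far x pre rest s e ωz z∉ αpre ∷ αpre
      where
      assoc : far ++ x ∷ pre ++ rest ≡ (far ++ [ x ]) ++ pre ++ rest
      assoc = sym (++-assoc far [ x ] (pre ++ rest))
      αpre : All (λ v → α v ≡ false) pre
      αpre = poor-beyond (far ++ [ x ]) pre rest (subst (λ l → Spider ω c (l ∷ others)) assoc s) e ωz
               (subst (λ l → z ∉ c ∷ (l ++ concat others)) assoc z∉)

  -- Cores: truncated copies that still contain `α`.

  module Critical (ω α : Node → Bool)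
    (rich : ∀ {u} → ω u ≡ true → α u ≡ false → Deg u (suc t) ω)
    (hit : ∀ {c legs x} → Spider ω c legs → α x ≡ true → x ∈ c ∷ concat legs)
    (spare : ∀ {c legs} → Spider ω c legs → ∃ λ r → ω r ≡ true × r ∉ c ∷ concat legs)
    {x₀ : Node} (αx₀ : α x₀ ≡ true) (ls⁺ : All (1 ≤_) ls) where

    open Hit ω α rich hit

    -- A free neighbour of the centre makes all legs poor, so that `c` is the only vertex of `α`.
    -- The other vertices then keep `t` neighbours after the deletion of `c`, and a copy grown
    -- greedily from a vertex off the old one misses `c`.
    centre-blocked : ∀ {c legs z} → Spider ω c legs → z ~ c → ω z ≡ true → z ∉ c ∷ concat legs → ⊥
    centre-blocked {c} {legs} s e ωz z∉ =
      let r , ωr , r∉ = spare s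
          _ , s′      = greedy {ω′} deg (ω′-intro ωr (λ q → r∉ (here q)))
      in proj₂ (ω′-elim (inside s′ (hit (restrict s′ (λ _ h → proj₁ (ω′-elim h))) αx₀))) x₀≡c
      where
      ω′ : Node → Bool
      ω′ v = ω v ∧ not (does (v Fin.≟ c))
      ω′-intro : ∀ {v} → ω v ≡ true → v ≢ c → ω′ v ≡ true
      ω′-intro {v} ωv v≢c rewrite ωv | dec-false (v Fin.≟ c) v≢c = refl
      ω′-elim : ∀ {v} → ω′ v ≡ true → ω v ≡ true × v ≢ c
      ω′-elim {v} h with ω v | v Fin.≟ c
      ω′-elim {v} () | true  | yes _
      ω′-elim {v} () | false | _
      ... | true | no v≢c = refl , v≢c
      poor : ∀ {v} → v ∈ concat legs → α v ≡ false
      poor i with ∈-concat⁻′ legs i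
      ... | leg , v∈leg , leg∈ with ∈-∃++ leg∈
      ... | as , bs , refl = All.lookup (poor-beyond [] leg [] s′ e ωz z∉′) v∈leg
        where
        p : legs ↭ (leg ++ []) ∷ as ++ bs
        p = ↭-trans (shift leg as bs) (↭-reflexive (cong (_∷ as ++ bs) (sym (++-identityʳ leg))))
        s′ : Spider ω c ((leg ++ []) ∷ as ++ bs)
        s′ = rearrange s p
        z∉′ : _ ∉ c ∷ (leg ++ []) ++ concat (as ++ bs)
        z∉′ j = z∉ (∈-resp-↭ (prep c (concat-↭ (↭-sym p))) j)
      x₀≡c : x₀ ≡ c
      x₀≡c with hit s αx₀
      ... | here q  = q
      ... | there i with trans (sym αx₀) (poor i)
      ... | ()
      α-false : ∀ {u} → u ≢ c → α u ≡ false
      α-false {u} u≢c with α u in eq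
      ... | false = refl
      ... | true with hit s eq
      ... | here q  = ⊥-elim (u≢c q)
      ... | there i = trans (sym eq) (poor i)
      deg : ∀ {u} → ω′ u ≡ true → Deg u t ω′
      deg h X len with ω′-elim h
      ... | ωu , u≢c with rich ωu (α-false u≢c) (c ∷ X) (s≤s len)
      ... | v , e , ωv , v∉ = v , e , ω′-intro ωv (λ q → v∉ (here q)) , λ i → v∉ (there i)

    -- A centre outside `α` would be rich enough to have a free neighbour.
    critical-centre : ∀ {c legs} → Spider ω c legs → α c ≡ true
    critical-centre {c} s with α c in eq
    ... | true  = refl
    ... | false with free-neighbour s (inside s (here refl)) eq
    ... | z , e , ωz , z∉ = ⊥-elim (centre-blocked s e ωz z∉)

    -- A leg of a core: its tip, the vertices between the tip and the centre, and
    -- the number of vertices that are missing beyond the tip.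
    CLeg : Set
    CLeg = Node × List Node × ℕ

    tip : CLeg → Node
    tip (w , _ , _) = w

    strand : CLeg → List Node
    strand (w , inner , _) = w ∷ inner

    len : CLeg → ℕ
    len (_ , inner , r) = suc (length inner) + r

    body : Node → List CLeg → List Node
    body c cl = c ∷ concat (map strand cl)

    -- Only the first vertex beyond a tip has to be supplied: the tip may belong to `α` and lack
    -- neighbours in `ω`, whereas a vertex off the core is poor and can be prolonged greedily.
    data Out (D : List Node) : CLeg → List Node → Set where
      full : ∀ {w inner} → Out D (w , inner , 0) (w ∷ inner)
      next : ∀ {q w inner r} → q ~ w → ω q ≡ true → q ∉ D → Out D (w , inner , suc r) (q ∷ w ∷ inner)

    -- A system of distinct outer neighbours of the tips of the incomplete legs that avoids z.
    Sdr : List Node → Node → Node → List CLeg → Set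
    Sdr D z c cl = ∃ λ (ps : List (CLeg × List Node)) →
      All (λ (g , o) → Out D g o) ps × map proj₁ ps ↭ cl × Unique (z ∷ c ∷ concat (map proj₂ ps))

    -- The freedom of `z` in `c-sdr` serves twice: it keeps a prescribed vertex off a completed
    -- copy, and it makes a second prolongation available when a leg is cut.
    record Core (c : Node) (cl : List CLeg) : Set where
      field
        c-lens   : map len cl ↭ ls
        c-paths  : All (λ g → Path c (strand g)) cl
        c-uniq   : Unique (body c cl)
        c-inside : ∀ {v} → v ∈ body c cl → ω v ≡ true
        c-cover  : ∀ {x} → α x ≡ true → x ∈ body c cl
        c-sdr    : ∀ {z} → ω z ≡ true → z ∉ body c cl → Sdr (body c cl) z c cl
        c-spare  : ∃ λ r → ω r ≡ true × r ∉ body c cl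

    open Core

    body-↭ : ∀ {c cl cl′} → cl ↭ cl′ → body c cl ↭ body c cl′
    body-↭ p = prep _ (concat-↭ (map⁺ strand p))

    Out-mono : ∀ {D D′ g o} → (∀ {v} → v ∈ D′ → v ∈ D) → Out D g o → Out D′ g o
    Out-mono sub full             = full
    Out-mono sub (next e ωq q∉D) = next e ωq (λ i → q∉D (sub i))

    core-↭ : ∀ {c cl cl′} → cl ↭ cl′ → Core c cl → Core c cl′
    core-↭ p D = record
      { c-lens   = ↭-trans (map⁺ len (↭-sym p)) (c-lens D)
      ; c-paths  = All-resp-↭ p (c-paths D)
      ; c-uniq   = Unique-resp-↭ (body-↭ p) (c-uniq D)
      ; c-inside = λ i → c-inside D (∈-resp-↭ (body-↭ (↭-sym p)) i)
      ; c-cover  = λ αx → ∈-resp-↭ (body-↭ p) (c-cover D αx)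
      ; c-sdr    = λ ωz z∉ → let ps , os , q , u = c-sdr D ωz (λ i → z∉ (∈-resp-↭ (body-↭ p) i)) in
                   ps , All.map (Out-mono (∈-resp-↭ (body-↭ (↭-sym p)))) os , ↭-trans q p , u
      ; c-spare  = let r , ωr , r∉ = c-spare D in r , ωr , λ i → r∉ (∈-resp-↭ (body-↭ (↭-sym p)) i) }

    poor-off : ∀ {c cl u} → Core c cl → u ∉ body c cl → α u ≡ false
    poor-off {u = u} D u∉ with α u in eq
    ... | false = refl
    ... | true  = ⊥-elim (u∉ (c-cover D eq))

    strand⊆out : ∀ {D} {ps : List (CLeg × List Node)} → All (λ (g , o) → Out D g o) ps →
                 ∀ {v} → v ∈ concat (map strand (map proj₁ ps)) → v ∈ concat (map proj₂ ps)
    strand⊆out {ps = (g , o) ∷ ps} (x ∷ os) i with ∈-++⁻ (strand g) i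
    ... | inj₂ j = ∈-++⁺ʳ o (strand⊆out os j)
    strand⊆out {ps = (_ , o) ∷ _} (full ∷ os)       i | inj₁ j = ∈-++⁺ˡ j
    strand⊆out {ps = (_ , o) ∷ _} (next _ _ _ ∷ os) i | inj₁ j = there (∈-++⁺ˡ j)

    -- The whole core is forbidden to new vertices and charged once through `μ`; `ρ` keeps its
    -- vertices, all of which are in the initial configuration, from being charged again. The vertex
    -- `z` uses up the one neighbour by which `t + 1` exceeds the class bound.
    completion : ∀ {c cl z} → Core c cl → ω z ≡ true → z ∉ body c cl →
                 ∃ λ legs → Spider ω c legs × z ∉ c ∷ concat legs ×
                   Pointwise (λ g leg → ∃ λ y → leg ≡ y ++ strand g) cl legs
    completion {c} {cl} {z} D ωz z∉ with c-sdr D ωz z∉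
    ... | ps , os , perm , u with ↭-map-inv proj₁ perm
    ... | ps′ , refl , ps↭ = build
      where
      os′ : All (λ (g , o) → Out (body c cl) g o) ps′
      os′ = All-resp-↭ ps↭ os
      u′ : Unique (z ∷ c ∷ concat (map proj₂ ps′))
      u′ = Unique-resp-↭ (prep z (prep c (concat-↭ (map⁺ proj₂ ps↭)))) u
      B : List Node
      B = body c cl
      μ : Bool → ℕ
      μ b = count (hue b) B
      ℓ : Node → Bool
      ℓ v = ω v ∧ off B v
      pick : ∀ {u} X → ℓ u ≡ true → count (λ x → off B x ∧ hue (not (col u)) x) X + μ (not (col u)) < suc t →
             ∃ λ v → v ~ u × ℓ v ≡ true × v ∉ X
      pick {u} X h lt =
        let ωu , ou         = true-∧ {ω u} h
            v , e , ωv , v∉ = Deg-hue (rich ωu (poor-off D (true-off ou))) (keep (off B) X ++ B) (subst (_< suc t) (sym eq) lt)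
            v∉B             = λ i → v∉ (∈-++⁺ʳ (keep (off B) X) i)
        in v , e , ∧-true ωv (off-true v∉B) , λ i → v∉ (∈-++⁺ˡ (∈-keep⁺ (off B) i (off-true v∉B)))
        where
        eq : count (hue (not (col u))) (keep (off B) X ++ B) ≡ count (λ x → off B x ∧ hue (not (col u)) x) X + μ (not (col u))
        eq = trans (count-++ (hue (not (col u))) (keep (off B) X)) (cong (_+ μ (not (col u))) (count-keep (hue (not (col u))) (off B) X))
      open Growth ℓ (off B) μ (suc t) pick
      -- `Out` has supplied one of the missing vertices, unless none was missing; `pred 0 = 0`
      -- covers the latter case.
      gap : CLeg → ℕ
      gap (_ , _ , r) = pred r
      gs : List (List Node × ℕ)
      gs = map (λ (g , o) → o , gap g) ps′
      outs : map proj₁ gs ≡ map proj₂ ps′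
      outs = sym (map-∘ ps′)
      gs-uniq : Unique ([ z ] ++ c ∷ concat (map proj₁ gs))
      gs-uniq = subst (λ l → Unique (z ∷ c ∷ concat l)) (sym outs) u′
      out-ok : ∀ {g o} → Out B g o → gap g ≡ 0 ⊎ ℓ (end c o) ≡ true
      out-ok full             = inj₁ refl
      out-ok (next _ ωq q∉) = inj₂ (∧-true ωq (off-true q∉))
      out-path : ∀ {g o} → Out B g o → Path c (strand g) → Path c o
      out-path full          p = p
      out-path (next e _ _) p = e , p
      out-size : ∀ {g o} → Out B g o → size (o , gap g) ≡ len g
      out-size full                          = refl
      out-size (next {inner = inner} {r = r} _ _ _) = sym (+-suc (suc (length inner)) r)
      gs-paths : ∀ {ps} → All (λ (g , o) → Out B g o) ps → All (λ g → Path c (strand g)) (map proj₁ ps) →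
                 All (λ g → Path c (proj₁ g)) (map (λ (g , o) → o , gap g) ps)
      gs-paths []       []       = []
      gs-paths (o ∷ os) (p ∷ pp) = out-path o p ∷ gs-paths os pp
      gs-sizes : ∀ {ps} → All (λ (g , o) → Out B g o) ps → map size (map (λ (g , o) → o , gap g) ps) ≡ map len (map proj₁ ps)
      gs-sizes []       = refl
      gs-sizes (o ∷ os) = cong₂ _∷_ (out-size o) (gs-sizes os)
      gs-path : All (λ g → Path c (proj₁ g)) gs
      gs-path = gs-paths os′ (c-paths D)
      gs-size : map size gs ↭ ls
      gs-size = subst (_↭ ls) (sym (gs-sizes os′)) (c-lens D)
      B⊆ : ∀ {v} → v ∈ B → v ∈ z ∷ c ∷ concat (map proj₁ gs)
      B⊆ (here q)  = there (here q)
      B⊆ (there i) = subst (λ l → _ ∈ z ∷ c ∷ concat l) (sym outs) (there (there (strand⊆out os′ i)))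
      bound : ∀ b → κ b (z ∷ c ∷ concat (map proj₁ gs)) + (slots b (ends c gs) + μ b) ≤ suc t
      bound b = begin
        κ b (z ∷ c ∷ O) + (slots b (ends c gs) + μ b)        ≡⟨ lemma (κ b (z ∷ c ∷ O)) _ _ ⟩
        κ b (z ∷ c ∷ O) + μ b + slots b (ends c gs)          ≡⟨ cong (λ k → κ b (z ∷ c ∷ O) + k + slots b (ends c gs)) (sym (length-keep (hue b) B)) ⟩
        κ b (z ∷ c ∷ O) + length (keep (hue b) B) + slots b (ends c gs)
          ≤⟨ +-monoˡ-≤ _ (count-without (hue b) (off B) (z ∷ c ∷ O) (Unique-keep (hue b) (c-uniq D))
               (λ i → let j , h = ∈-keep⁻ (hue b) B i in B⊆ j , off-false j , h)) ⟩
        count (hue b) (z ∷ c ∷ O) + slots b (ends c gs)      ≤⟨ +-monoˡ-≤ _ (+-monoˡ-≤ _ (bit≤1 (hue b z))) ⟩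
        suc (bit (hue b c) + count (hue b) O) + slots b (ends c gs)
          ≡⟨ cong suc (trans (+-assoc (bit (hue b c)) _ _) (cong (bit (hue b c) +_) (sym (load-split b c gs)))) ⟩
        suc (bit (hue b c) + load b c gs)                    ≤⟨ s≤s (load≤ b c gs-path gs-size) ⟩
        suc t ∎
        where
        open ≤-Reasoning
        O : List Node
        O = concat (map proj₁ gs)
        lemma : ∀ a b c → a + (b + c) ≡ a + c + b
        lemma = solve-∀
      legs-ok : ∀ {ps legs} → All (λ (g , o) → Out B g o) ps → All (λ g → Path c (strand g)) (map proj₁ ps) →
                (∀ {v} → v ∈ concat (map strand (map proj₁ ps)) → ω v ≡ true) →
                Pointwise (Extended ℓ c) (map (λ (g , o) → o , gap g) ps) legs →
                map length legs ≡ map len (map proj₁ ps) × All (Path c) legs ×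
                (∀ {v} → v ∈ concat legs → ω v ≡ true) ×
                Pointwise (λ g leg → ∃ λ y → leg ≡ y ++ strand g) (map proj₁ ps) legs
      legs-ok []       []       _  []       = refl , [] , (λ ()) , []
      legs-ok {(g , o) ∷ ps} {leg ∷ legs} (x ∷ os) (p ∷ pp) ins (ex ∷ es)
        with a , b , i , d ← legs-ok os pp (λ k → ins (∈-++⁺ʳ (strand g) k)) es
        = cong₂ _∷_ (trans (extended-length (o , gap g) ex) (out-size x)) a
        , extended-path (out-path x p) ex ∷ b
        , (λ k → [ leg-ω ex , i ]′ (∈-++⁻ leg k))
        , leg-ext x ex ∷ d
        where
        out-ω : ∀ {v g o} → Out B g o → (∀ {v} → v ∈ strand g → ω v ≡ true) → v ∈ o → ω v ≡ true
        out-ω full          h k           = h k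
        out-ω (next _ ωq _) h (here refl) = ωq
        out-ω (next _ _ _)  h (there k)   = h k
        leg-ω : ∀ {v leg} → Extended ℓ c (o , gap g) leg → v ∈ leg → ω v ≡ true
        leg-ω (y , refl , _ , _ , al) k with ∈-++⁻ y k
        ... | inj₁ j = proj₁ (true-∧ (All.lookup al j))
        ... | inj₂ j = out-ω x (λ j → ins (∈-++⁺ˡ j)) j
        leg-ext : ∀ {g o leg} → Out B g o → Extended ℓ c (o , gap g) leg → ∃ λ y → leg ≡ y ++ strand g
        leg-ext full                    (y , q , _) = y , q
        leg-ext (next {q = q} _ _ _) (y , e , _) = y ++ [ q ] , trans e (sym (++-assoc y [ q ] _))
      build : ∃ λ legs → Spider ω c legs × z ∉ c ∷ concat legs ×
                Pointwise (λ g leg → ∃ λ y → leg ≡ y ++ strand g) cl legs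
      build =
        let legs , es , uq = extend [ z ] c gs gs-uniq (Allₚ.map⁺ (All.map out-ok os′)) bound
            a , b , i , d  = legs-ok os′ (c-paths D) (λ i → c-inside D (there i)) es
        in legs , record
             { lens = ↭-trans (↭-reflexive a) (c-lens D) ; paths = b ; uniq = Unique-++⁻ʳ [ z ] uq
             ; inside = λ { (here refl) → c-inside D (here refl) ; (there k) → i k } }
           , (λ k → ++-disjoint [ z ] uq (here refl) k) , d

    out-suffix : ∀ {D g o} → Out D g o → ∃ λ ys → o ≡ ys ++ strand g
    out-suffix full         = [] , refl
    out-suffix (next _ _ _) = [ _ ] , refl

    align : ∀ {D z c g cl} → Sdr D z c (g ∷ cl) →
            ∃₂ λ o ps → Out D g o × All (λ (g , o) → Out D g o) ps × cl ≡ map proj₁ ps ×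
                        Unique (z ∷ c ∷ o ++ concat (map proj₂ ps))
    align (ps , os , perm , u) with ↭-map-inv proj₁ perm
    ... | (_ , o) ∷ ps′ , refl , q with All-resp-↭ q os
    ... | x ∷ xs = o , ps′ , x , xs , refl , Unique-resp-↭ (prep _ (prep _ (concat-↭ (map⁺ proj₂ q)))) u

    -- A vertex z outside the core that is adjacent to y lets the leg be cut at y: its next vertex is
    -- then either the old one, x, or z.
    shrink : ∀ {c w pre y post r cl z} → Core c ((w , pre ++ y ∷ post , r) ∷ cl) →
             z ~ y → ω z ≡ true → z ∉ body c ((w , pre ++ y ∷ post , r) ∷ cl) →
             Core c ((y , post , suc (length pre + r)) ∷ cl)
    shrink {c} {w} {pre} {y} {post} {r} {cl} {z} K e ωz z∉D = record
      { c-lens   = subst (λ k → k ∷ map len cl ↭ ls) len≡ (c-lens K)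
      ; c-paths  = Path-++⁻ʳ (w ∷ pre) path ∷ paths-cl
      ; c-uniq   = Unique-resp-⊆ D′⊆D (c-uniq K)
      ; c-inside = λ i → c-inside K (D′∈ i)
      ; c-cover  = λ αv → cover αv (c-cover K αv)
      ; c-sdr    = sdr
      ; c-spare  = z , ωz , λ i → z∉D (D′∈ i) }
      where
      g g′ : CLeg
      g  = w , pre ++ y ∷ post , r
      g′ = y , post , suc (length pre + r)
      D D′ : List Node
      D  = body c (g ∷ cl)
      D′ = body c (g′ ∷ cl)
      D′⊆D : D′ ⊆ D
      D′⊆D = refl ∷ˢ Sub.++⁺ (Sub.++⁺ˡ (w ∷ pre) ⊆-refl) ⊆-refl
      D′∈ : ∀ {v} → v ∈ D′ → v ∈ D
      D′∈ = Sub.Any-resp-⊆ D′⊆D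
      path : Path c (w ∷ pre ++ y ∷ post)
      path with p ∷ _ ← c-paths K = p
      paths-cl : All (λ g → Path c (strand g)) cl
      paths-cl with _ ∷ ps ← c-paths K = ps
      len≡ : len g ≡ len g′
      len≡ = cong suc (trans (cong (_+ r) (length-++ pre)) (lemma (length pre) (length post) r))
        where
        lemma : ∀ a b c → a + suc b + c ≡ b + suc (a + c)
        lemma = solve-∀
      -- In a completion that avoids `z`, this vertex is a free neighbour of `y`, so the part beyond
      -- `y` is poor and can be cut off.
      beyond : All (λ v → α v ≡ false) (w ∷ pre)
      beyond with completion K ωz z∉D
      ... | _ , s , z∉ , (ys , refl) ∷ _ = poor-beyond ys (w ∷ pre) (y ∷ post) s e ωz z∉
      cover : ∀ {v} → α v ≡ true → v ∈ D → v ∈ D′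
      cover αv (here q)  = here q
      cover {v} αv (there i) with ∈-++⁻ (strand g) i
      ... | inj₂ j = there (∈-++⁺ʳ (strand g′) j)
      ... | inj₁ j with ∈-++⁻ (w ∷ pre) j
      ... | inj₂ k = there (∈-++⁺ˡ k)
      ... | inj₁ k with trans (sym αv) (All.lookup beyond k)
      ... | ()
      as : List Node
      as = proj₁ (∷-last w pre)
      x : Node
      x = proj₁ (proj₂ (∷-last w pre))
      strand≡ : strand g ≡ as ++ x ∷ y ∷ post
      strand≡ = trans (cong (_++ y ∷ post) (proj₂ (proj₂ (∷-last w pre)))) (++-assoc as [ x ] (y ∷ post))
      x∈strand : x ∈ strand g
      x∈strand = subst (x ∈_) (sym strand≡) (∈-++⁺ʳ as (here refl))
      x~y : x ~ y
      x~y = proj₁ (Path-++⁻ʳ as (subst (Path c) strand≡ path))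
      x∉D′ : x ∉ D′
      x∉D′ (here refl) = ++-disjoint [ c ] (c-uniq K) (here refl) (∈-++⁺ˡ x∈strand)
      x∉D′ (there i) = ++-disjoint as′ uq (∈-++⁺ʳ as (here refl)) i
        where
        as′ : List Node
        as′ = as ++ [ x ]
        uq : Unique (as′ ++ strand g′ ++ concat (map strand cl))
        uq = subst Unique (trans (cong (_++ concat (map strand cl)) (trans strand≡ (sym (++-assoc as [ x ] (y ∷ post))))) (++-assoc as′ (strand g′) _))
               (Unique-++⁻ʳ [ c ] (c-uniq K))
      module _ {o : List Node} {ps : List (CLeg × List Node)} (out : Out D g o) (os : All (λ (g , o) → Out D g o) ps) where
        co : List Node
        co = concat (map proj₂ ps)
        suffix : ∃ λ ys → o ≡ ys ++ x ∷ y ∷ post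
        suffix = let ys , q = out-suffix out in ys ++ as , trans q (trans (cong (ys ++_) strand≡) (sym (++-assoc ys as _)))
        strand∈o : ∀ {v} → v ∈ strand g → v ∈ o
        strand∈o {v} i = let ys , q = out-suffix out in subst (v ∈_) (sym q) (∈-++⁺ʳ ys i)
        suffix⊆ : ∀ {zs} → zs ⊆ x ∷ y ∷ post → c ∷ zs ++ co ⊆ c ∷ o ++ co
        suffix⊆ s = refl ∷ˢ Sub.++⁺ (subst (_ ⊆_) (sym (proj₂ suffix)) (Sub.++⁺ˡ (proj₁ suffix) s)) ⊆-refl
      os-D′ : ∀ {ps} → All (λ (g , o) → Out D g o) ps → All (λ (g , o) → Out D′ g o) ps
      os-D′ = All.map (Out-mono D′∈)
      -- Here `x` prolongs `y`. If `z′` belongs to the old core, any old system avoids it except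
      -- perhaps on the strand that is cut, and the one avoiding `z` will do; otherwise the old
      -- system has to avoid `z′` itself.
      old-next : ∀ {z′ z″} → z′ ∉ D′ → z′ ≢ x → (z′ ∈ D ⊎ z′ ≡ z″) → Sdr D z″ c (g ∷ cl) → Sdr D′ z′ c (g′ ∷ cl)
      old-next {z′} {z″} z′∉ z′≢x why sd with align sd
      ... | o , ps , out , os , refl , uq =
        ((g′ , x ∷ y ∷ post) ∷ ps) , (next x~y (c-inside K (there (∈-++⁺ˡ x∈strand))) x∉D′ ∷ os-D′ os) , ↭-refl ,
        Unique-∷ z′∉new (Unique-resp-⊆ (suffix⊆ out os ⊆-refl) uq′)
        where
        uq′ : Unique (c ∷ o ++ concat (map proj₂ ps))
        uq′ = Unique-++⁻ʳ [ z″ ] uq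
        z′∉co : z′ ∈ D ⊎ z′ ≡ z″ → z′ ∉ concat (map proj₂ ps)
        z′∉co (inj₂ refl)      j = ++-disjoint [ z″ ] uq (here refl) (there (∈-++⁺ʳ o j))
        z′∉co (inj₁ (here q))  j = z′∉ (here q)
        z′∉co (inj₁ (there i)) j with ∈-++⁻ (strand g) i
        ... | inj₁ k = ++-disjoint o (Unique-++⁻ʳ [ c ] uq′) (strand∈o out os k) j
        ... | inj₂ k = z′∉ (there (∈-++⁺ʳ (strand g′) k))
        z′∉new : z′ ∉ c ∷ (x ∷ y ∷ post) ++ concat (map proj₂ ps)
        z′∉new (here q)          = z′∉ (here q)
        z′∉new (there (here q))  = z′≢x q
        z′∉new (there (there i)) with ∈-++⁻ (y ∷ post) i
        ... | inj₁ j = z′∉ (there (∈-++⁺ˡ j))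
        ... | inj₂ j = z′∉co why j
      -- If `x` is the vertex to be avoided, `z` prolongs `y`; the old system must leave `z` free
      -- for this.
      new-next : Sdr D z c (g ∷ cl) → Sdr D′ x c (g′ ∷ cl)
      new-next sd with align sd
      ... | o , ps , out , os , refl , uq =
        ((g′ , z ∷ y ∷ post) ∷ ps) , (next e ωz (λ i → z∉D (D′∈ i)) ∷ os-D′ os) , ↭-refl ,
        Unique-resp-↭ perm (Unique-resp-⊆ (refl ∷ˢ suffix⊆ out os ⊆-refl) uq)
        where
        perm : z ∷ c ∷ x ∷ y ∷ post ++ concat (map proj₂ ps) ↭ x ∷ c ∷ z ∷ y ∷ post ++ concat (map proj₂ ps)
        perm = ↭-trans (prep z (↭-swap c x ↭-refl)) (↭-trans (↭-swap z x ↭-refl) (prep x (↭-swap z c ↭-refl)))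
      sdr : ∀ {z′} → ω z′ ≡ true → z′ ∉ D′ → Sdr D′ z′ c (g′ ∷ cl)
      sdr {z′} ωz′ z′∉ with z′ Fin.≟ x
      ... | yes refl = new-next (c-sdr K ωz z∉D)
      ... | no z′≢x with z′ ∈? D
      ... | yes z′∈ = old-next z′∉ z′≢x (inj₁ z′∈) (c-sdr K ωz z∉D)
      ... | no  z′∉D = old-next z′∉ z′≢x (inj₂ refl) (c-sdr K ωz′ z′∉D)

    -- The new spider is centred at e.
    module Recentre {c cl} (K : Core c cl)
      (tips-only : ∀ {z y} → ω z ≡ true → z ∉ body c cl → y ∈ body c cl → z ~ y → y ∈ map tip cl)
      {e} (ωe : ω e ≡ true) (e∉ : e ∉ body c cl) (hue-e : col e ≡ col c)
      (maximal : ∀ {u} → ω u ≡ true → u ∉ body c cl → col u ≡ col c →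
                 count (λ w → does (w ~? u)) (map tip cl) ≤ count (λ w → does (w ~? e)) (map tip cl)) where

      B tips : List Node
      B    = body c cl
      tips = map tip cl

      b₀ : Bool
      b₀ = col c

      adj : Node → Node → Bool
      adj u w = does (w ~? u)

      adj⁺ : ∀ {u w} → w ~ u → adj u w ≡ true
      adj⁺ {u} {w} = dec-true (w ~? u)

      adj⁻ : ∀ {u w} → adj u w ≡ true → w ~ u
      adj⁻ {u} {w} = does⁻ (w ~? u)

      tip∈ : ∀ cl {w} → w ∈ map tip cl → w ∈ concat (map strand cl)
      tip∈ (g ∷ cl) (here refl) = here refl
      tip∈ (g ∷ cl) (there i)   = ∈-++⁺ʳ (strand g) (tip∈ cl i)

      tips-unique : Unique tips
      tips-unique = go cl (Unique-++⁻ʳ [ c ] (c-uniq K))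
        where
        go : ∀ cl → Unique (concat (map strand cl)) → Unique (map tip cl)
        go []       _ = []
        go (g ∷ cl) u = Unique-∷ (λ i → ++-disjoint (strand g) u (here refl) (tip∈ cl i)) (go cl (Unique-++⁻ʳ (strand g) u))

      -- Bounds the tips of colour `b` adjacent to one vertex off the core: trivially for the colour
      -- of `c`, by `maximal` for the other.
      μ : Bool → ℕ
      μ b with b Bool.≟ b₀
      ... | yes _ = count (hue b₀) tips
      ... | no _  = count (adj e) tips

      adj≤μ : ∀ {u} → ω u ≡ true → u ∉ B → count (adj u) tips ≤ μ (not (col u))
      adj≤μ {u} ωu u∉ with not (col u) Bool.≟ b₀
      ... | yes q = count-mono (adj u) (hue b₀) tips (λ _ h → hue-true (trans (alt (adj⁻ h)) q))
      ... | no  q = maximal ωu u∉ (not-injective (¬-not q))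

      ℓ : Node → Bool
      ℓ v = ω v ∧ off B v

      ℓ⁺ : ∀ {v} → ω v ≡ true → v ∉ B → ℓ v ≡ true
      ℓ⁺ ωv v∉ = ∧-true ωv (off-true v∉)

      ℓ⁻ : ∀ {v} → ℓ v ≡ true → ω v ≡ true × v ∉ B
      ℓ⁻ {v} h = let a , b = true-∧ {ω v} h in a , true-off b

      -- By `tips-only`, forbidding the tips adjacent to `u` is enough to stay off the core.
      pick : ∀ {u} X → ℓ u ≡ true → count (λ x → off B x ∧ hue (not (col u)) x) X + μ (not (col u)) < suc t →
             ∃ λ v → v ~ u × ℓ v ≡ true × v ∉ X
      pick {u} X h lt =
        let ωu , u∉B        = ℓ⁻ h
            v , e , ωv , v∉ = Deg-hue (rich ωu (poor-off K u∉B)) (keep (off B) X ++ keep (adj u) tips) (≤-<-trans (bound ωu u∉B) lt)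
            v∉B             = λ i → v∉ (∈-++⁺ʳ (keep (off B) X) (∈-keep⁺ (adj u) (tips-only ωu u∉B i (~-sym e)) (adj⁺ e)))
        in v , e , ℓ⁺ ωv v∉B , λ i → v∉ (∈-++⁺ˡ (∈-keep⁺ (off B) i (off-true v∉B)))
        where
        b : Bool
        b = not (col u)
        bound : ω u ≡ true → u ∉ B → count (hue b) (keep (off B) X ++ keep (adj u) tips) ≤ count (λ x → off B x ∧ hue b x) X + μ b
        bound ωu u∉ = begin
          count (hue b) (keep (off B) X ++ keep (adj u) tips)                    ≡⟨ count-++ (hue b) (keep (off B) X) ⟩
          count (hue b) (keep (off B) X) + count (hue b) (keep (adj u) tips)     ≡⟨ cong (_+ count (hue b) (keep (adj u) tips)) (count-keep (hue b) (off B) X) ⟩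
          count (λ x → off B x ∧ hue b x) X + count (hue b) (keep (adj u) tips)
            ≤⟨ +-monoʳ-≤ _ (≤-trans (count≤length (hue b) (keep (adj u) tips)) (≤-trans (≤-reflexive (length-keep (adj u) tips)) (adj≤μ ωu u∉))) ⟩
          count (λ x → off B x ∧ hue b x) X + μ b ∎
          where open ≤-Reasoning

      -- Every tip adjacent to `e` occurs in its start, and is thereby charged as a vertex of the
      -- new copy. An `outward` start places two vertices, which leaves `length inner + r` of the
      -- leg.
      data Start : CLeg → List Node → List Node × ℕ → Set where
        inward  : ∀ {w inner} → w ~ e → Start (w , inner , 0) (w ∷ inner) (reverse (w ∷ inner) , 0)
        outward : ∀ {w inner r q} → w ~ e → q ~ w → ω q ≡ true → q ∉ B →
                  Start (w , inner , suc r) (q ∷ w ∷ inner) (q ∷ w ∷ [] , length inner + r)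
        fresh   : ∀ {g o} → ¬ tip g ~ e → Start g o ([] , len g)

      start : ∀ {g o} → Out B g o → ∃ (Start g o)
      start {w , _} out with w ~? e
      start out | no w≁e = _ , fresh w≁e
      start full            | yes w~e = _ , inward w~e
      start (next q~w ωq q∉) | yes w~e = _ , outward w~e q~w ωq q∉

      Starts : List (CLeg × List Node) → List (List Node × ℕ) → Set
      Starts = Pointwise (λ (g , o) → Start g o)

      starts : ∀ {ps} → All (λ (g , o) → Out B g o) ps → ∃ (Starts ps)
      starts []       = [] , []
      starts (o ∷ os) = _ , proj₂ (start o) ∷ proj₂ (starts os)

      start-path : ∀ {g o s} → Path c (strand g) → Start g o s → Path e (proj₁ s)
      start-path p (inward {w} {inner} w~e) =
        subst (Path e) (sym (unfold-reverse w inner)) (Path-++⁺ (reverse inner) (Path-reverse inner p) (w~e , tt))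
      start-path p (outward w~e q~w _ _) = q~w , w~e , tt
      start-path p (fresh _)             = tt

      start-size : ∀ {g o s} → Start g o s → size s ≡ len g
      start-size (inward {w} {inner} _)              = cong (_+ 0) (length-reverse (w ∷ inner))
      start-size (outward {inner = inner} {r} _ _ _ _) = sym (cong suc (+-suc (length inner) r))
      start-size (fresh _)                           = refl

      start-⊑ : ∀ {g o s} → Unique o → Start g o s → proj₁ s ⊑ o
      start-⊑ u (inward {w} {inner} _) = Unique-resp-↭ (↭-sym (↭-reverse (w ∷ inner))) u , ∈-resp-↭ (↭-reverse (w ∷ inner))
      start-⊑ u (outward {inner = inner} _ _ _ _) =
        Unique-resp-⊆ (refl ∷ˢ refl ∷ˢ minimum inner) u , λ { (here q) → here q ; (there (here q)) → there (here q) }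
      start-⊑ u (fresh _) = [] , λ ()

      start-end : ∀ {g o s} → Start g o s → proj₂ s ≡ 0 ⊎ ℓ (end e (proj₁ s)) ≡ true
      start-end (inward _)             = inj₁ refl
      start-end (outward _ _ ωq q∉) = inj₂ (ℓ⁺ ωq q∉)
      start-end (fresh _)              = inj₂ (ℓ⁺ ωe e∉)

      start-inside : ∀ {g o s} → (∀ {v} → v ∈ strand g → ω v ≡ true) → Start g o s → ∀ {v} → v ∈ proj₁ s → ω v ≡ true
      start-inside h (inward {w} {inner} _) i                = h (∈-resp-↭ (↭-reverse (w ∷ inner)) i)
      start-inside h (outward _ _ ωq _)     (here refl)         = ωq
      start-inside h (outward _ _ _ _)      (there (here refl)) = h (here refl)

      start-tip : ∀ {g o s} → Start g o s → tip g ~ e → tip g ∈ proj₁ s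
      start-tip (inward {w} {inner} _) _ = ∈-resp-↭ (↭-sym (↭-reverse (w ∷ inner))) (here refl)
      start-tip (outward _ _ _ _)      _ = there (here refl)
      start-tip (fresh w≁e)            h = ⊥-elim (w≁e h)

      -- A tip with the colour of c is not adjacent to c, so its leg has length at least 2.
      start-slots : ∀ {g o s} → Path c (strand g) → Start g o s →
                    cnt b₀ (col (end e (proj₁ s))) (proj₂ s ∸ 2) + bit (hue b₀ (tip g)) ≤ cnt b₀ (col (end e (proj₁ s))) (proj₂ s)
      start-slots {g} {o} {s} p st with col (tip g) Bool.≟ b₀
      ... | no _  = ≤-trans (≤-reflexive (+-identityʳ _)) (cnt-∸2 b₀ (col (end e (proj₁ s))) (proj₂ s))
      start-slots p (inward w~e) | yes q        = ⊥-elim (not-fixed (trans (trans (sym q) (alt w~e)) (cong not hue-e)))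
      start-slots p (outward w~e _ _ _) | yes q = ⊥-elim (not-fixed (trans (trans (sym q) (alt w~e)) (cong not hue-e)))
      start-slots {w , [] , r} p (fresh _) | yes q = ⊥-elim (not-fixed (trans (sym q) (alt (proj₁ p))))
      start-slots {w , a ∷ inner , r} p (fresh _) | yes q rewrite hue-e = ≤-reflexive (cnt-∸2-< b₀ (length inner + r))

      starts-slots : ∀ {ps gs} → All (λ g → Path c (strand g)) (map proj₁ ps) → Starts ps gs →
                     sum (map (λ (xs , r) → cnt b₀ (col (end e xs)) (r ∸ 2)) gs) + count (hue b₀) (map tip (map proj₁ ps)) ≤ slots b₀ (ends e gs)
      starts-slots []       []       = z≤n
      starts-slots {(g , _) ∷ ps} {(xs , r) ∷ gs} (p ∷ pp) (s ∷ st) = begin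
        x + X + (y + Y)   ≡⟨ lemma x X y Y ⟩
        (x + y) + (X + Y) ≤⟨ +-mono-≤ (start-slots p s) (starts-slots pp st) ⟩
        cnt b₀ (col (end e xs)) r + slots b₀ (ends e gs) ∎
        where
        open ≤-Reasoning
        x X y Y : ℕ
        x = cnt b₀ (col (end e xs)) (r ∸ 2)
        X = sum (map (λ (xs , r) → cnt b₀ (col (end e xs)) (r ∸ 2)) gs)
        y = bit (hue b₀ (tip g))
        Y = count (hue b₀) (map tip (map proj₁ ps))
        lemma : ∀ a b c d → a + b + (c + d) ≡ (a + c) + (b + d)
        lemma = solve-∀

      starts-size : ∀ {ps gs} → Starts ps gs → map size gs ≡ map len (map proj₁ ps)
      starts-size []       = refl
      starts-size (s ∷ st) = cong₂ _∷_ (start-size s) (starts-size st)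

      starts-path : ∀ {ps gs} → All (λ g → Path c (strand g)) (map proj₁ ps) → Starts ps gs → All (λ g → Path e (proj₁ g)) gs
      starts-path []       []       = []
      starts-path (p ∷ pp) (s ∷ st) = start-path p s ∷ starts-path pp st

      starts-end : ∀ {ps gs} → Starts ps gs → All (λ (xs , r) → r ≡ 0 ⊎ ℓ (end e xs) ≡ true) gs
      starts-end []       = []
      starts-end (s ∷ st) = start-end s ∷ starts-end st

      starts-⊑ : ∀ {ps gs} → Unique (concat (map proj₂ ps)) → Starts ps gs → Pointwise _⊑_ (map proj₁ gs) (map proj₂ ps)
      starts-⊑ u []                       = []
      starts-⊑ {(_ , o) ∷ _} u (s ∷ st) = start-⊑ (Unique-++⁻ˡ o u) s ∷ starts-⊑ (Unique-++⁻ʳ o u) st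

      starts-inside : ∀ {ps gs} → (∀ {v} → v ∈ concat (map strand (map proj₁ ps)) → ω v ≡ true) → Starts ps gs →
                      ∀ {v} → v ∈ concat (map proj₁ gs) → ω v ≡ true
      starts-inside {(g , _) ∷ _} {(xs , _) ∷ _} h (s ∷ st) i with ∈-++⁻ xs i
      ... | inj₁ j = start-inside (λ k → h (∈-++⁺ˡ k)) s j
      ... | inj₂ j = starts-inside (λ k → h (∈-++⁺ʳ (strand g) k)) st j

      starts-tip : ∀ {ps gs} → Starts ps gs → ∀ {w} → w ∈ map tip (map proj₁ ps) → w ~ e → w ∈ concat (map proj₁ gs)
      starts-tip {gs = (xs , _) ∷ _} (s ∷ st) (here refl) h = ∈-++⁺ˡ (start-tip s h)
      starts-tip {gs = (xs , _) ∷ _} (s ∷ st) (there i)   h = ∈-++⁺ʳ xs (starts-tip st i h)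

      start-⊆ : ∀ {g o s} → Start g o s → ∀ {v} → v ∈ proj₁ s → v ∈ o
      start-⊆ (inward {w} {inner} _)  i                   = ∈-resp-↭ (↭-reverse (w ∷ inner)) i
      start-⊆ (outward _ _ _ _)       (here q)            = here q
      start-⊆ (outward _ _ _ _)       (there (here q))    = there (here q)

      starts-⊆ : ∀ {ps gs} → Starts ps gs → ∀ {v} → v ∈ concat (map proj₁ gs) → v ∈ concat (map proj₂ ps)
      starts-⊆ {(_ , o) ∷ _} {(xs , _) ∷ _} (s ∷ st) i with ∈-++⁻ xs i
      ... | inj₁ j = ∈-++⁺ˡ (start-⊆ s j)
      ... | inj₂ j = ∈-++⁺ʳ o (starts-⊆ st j)

      -- A tip of colour `b₀` is not adjacent to `e`, which has the same colour; so its leg starts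
      -- afresh and its strand is left alone.
      starts-inner : ∀ {ps gs} → All (λ (g , o) → Out B g o) ps → Unique (concat (map proj₂ ps)) → Starts ps gs →
                     ∀ {g} → g ∈ map proj₁ ps → col (tip g) ≡ b₀ → ∀ {a} → a ∈ strand g → a ∉ concat (map proj₁ gs)
      starts-inner {(_ , o) ∷ _} {(xs , _) ∷ _} (out ∷ os) u (s ∷ st) (here refl) q i j with ∈-++⁻ xs j
      ... | inj₂ k = ++-disjoint o u (strand⊆o out i) (starts-⊆ st k)
        where
        strand⊆o : ∀ {g o} → Out B g o → ∀ {a} → a ∈ strand g → a ∈ o
        strand⊆o full         i = i
        strand⊆o (next _ _ _) i = there i
      starts-inner (out ∷ os) u (inward w~e ∷ st) (here refl) q i j | inj₁ k =
        not-fixed (trans (trans (sym q) (alt w~e)) (cong not hue-e))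
      starts-inner (out ∷ os) u (outward w~e _ _ _ ∷ st) (here refl) q i j | inj₁ k =
        not-fixed (trans (trans (sym q) (alt w~e)) (cong not hue-e))
      starts-inner {(_ , o) ∷ _} {(xs , _) ∷ _} (out ∷ os) u (s ∷ st) (there g∈) q i j with ∈-++⁻ xs j
      ... | inj₂ k = starts-inner os (Unique-++⁻ʳ o u) st g∈ q i k
      ... | inj₁ k = ++-disjoint o u (start-⊆ s k)
        (strand⊆out os (∈-concat⁺′ i (∈-map⁺ strand g∈)))

      b₁ : Bool
      b₁ = not b₀

      κ : Bool → List Node → ℕ
      κ b = count (λ x → off B x ∧ hue b x)

      -- The old centre `c` is listed only to be avoided. It lies off the new copy and accounts for
      -- the additional one.
      total-bound : ∀ b {gs} → All (λ g → Path e (proj₁ g)) gs → map size gs ↭ ls →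
                    count (hue b) (c ∷ e ∷ concat (map proj₁ gs)) + slots b (ends e gs) ≤ suc t
      total-bound b {gs} ps q = begin
        bit (hue b c) + (bit (hue b e) + C) + S   ≤⟨ +-monoˡ-≤ S (+-monoˡ-≤ (bit (hue b e) + C) (bit≤1 (hue b c))) ⟩
        suc (bit (hue b e) + C + S)               ≡⟨ cong suc (+-assoc (bit (hue b e)) C S) ⟩
        suc (bit (hue b e) + (C + S))             ≡⟨ cong (λ k → suc (bit (hue b e) + k)) (sym (load-split b e gs)) ⟩
        suc (bit (hue b e) + load b e gs)         ≤⟨ s≤s (load≤ b e ps q) ⟩
        suc t ∎
        where
        open ≤-Reasoning
        C S : ℕ
        C = count (hue b) (concat (map proj₁ gs))
        S = slots b (ends e gs)

      -- The tips adjacent to `e` are vertices of the new copy of colour `b₁`. Since `κ` omits the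
      -- core, counting them by `adj e` charges them only once.
      adjacent-bound : ∀ {gs} → All (λ g → Path e (proj₁ g)) gs → map size gs ↭ ls →
                       (∀ {w} → w ∈ tips → w ~ e → w ∈ concat (map proj₁ gs)) →
                       κ b₁ (c ∷ e ∷ concat (map proj₁ gs)) + (slots b₁ (ends e gs) + count (adj e) tips) ≤ suc t
      adjacent-bound {gs} ps q h = begin
        κ b₁ X + (S + count (adj e) tips)             ≡⟨ lemma (κ b₁ X) S _ ⟩
        κ b₁ X + count (adj e) tips + S               ≡⟨ cong (λ k → κ b₁ X + k + S) (sym (length-keep (adj e) tips)) ⟩
        κ b₁ X + length (keep (adj e) tips) + S       ≤⟨ +-monoˡ-≤ S (count-without (hue b₁) (off B) X (Unique-keep (adj e) tips-unique) adjacent) ⟩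
        count (hue b₁) X + S                          ≤⟨ total-bound b₁ ps q ⟩
        suc t ∎
        where
        open ≤-Reasoning
        X : List Node
        X = c ∷ e ∷ concat (map proj₁ gs)
        S : ℕ
        S = slots b₁ (ends e gs)
        lemma : ∀ a b c → a + (b + c) ≡ a + c + b
        lemma = solve-∀
        adjacent : ∀ {w} → w ∈ keep (adj e) tips → w ∈ X × off B w ≡ false × hue b₁ w ≡ true
        adjacent i with ∈-keep⁻ (adj e) tips i
        ... | j , k = there (there (h j (adj⁻ k))) , off-false (there (tip∈ cl j)) , hue-true (trans (alt (adj⁻ k)) (cong not hue-e))

      μ-b₁ : μ b₁ ≡ count (adj e) tips
      μ-b₁ with b₁ Bool.≟ b₀
      ... | yes q = ⊥-elim (not-fixed (sym q))
      ... | no _  = refl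

      strand-injective : ∀ {cl′} → Unique (concat (map strand cl′)) → ∀ {g g′} → g ∈ cl′ → g′ ∈ cl′ →
                         ∀ {a} → a ∈ strand g → a ∈ strand g′ → g ≡ g′
      strand-injective u (here refl) (here refl) i j = refl
      strand-injective {h ∷ cl′} u (here refl) (there y) i j = ⊥-elim (++-disjoint (strand h) u i (∈-concat⁺′ j (∈-map⁺ strand y)))
      strand-injective {h ∷ cl′} u (there x) (here refl) i j = ⊥-elim (++-disjoint (strand h) u j (∈-concat⁺′ i (∈-map⁺ strand x)))
      strand-injective {h ∷ cl′} u (there x) (there y) i j = strand-injective (Unique-++⁻ʳ (strand h) u) x y i j

      same-leg : ∀ {g g′} → g ∈ cl → g′ ∈ cl → ∀ {a} → a ∈ strand g → a ∈ strand g′ → g ≡ g′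
      same-leg = strand-injective (Unique-++⁻ʳ [ c ] (c-uniq K))

      strand∈body : ∀ {g a} → g ∈ cl → a ∈ strand g → a ∈ B
      strand∈body g∈ i = there (∈-concat⁺′ i (∈-map⁺ strand g∈))

      -- Only tips with the colour of `c` can be run into during the final phase; a leg ceases to be
      -- in reserve as soon as its tip is used.
      Untouched : List Node → Set
      Untouched S = ∀ {g} → g ∈ cl → col (tip g) ≡ b₀ → tip g ∉ S → ∀ {a} → a ∈ strand g → a ∉ S

      Untouched-outer : ∀ {S v} → v ∉ B → Untouched S → Untouched (v ∷ S)
      Untouched-outer v∉ un g∈ q t∉ i (here refl) = v∉ (strand∈body g∈ i)
      Untouched-outer v∉ un g∈ q t∉ i (there j)   = un g∈ q (λ k → t∉ (there k)) i j

      Untouched-leg : ∀ {S g v} → g ∈ cl → tip g ∈ v ∷ S → v ∈ strand g → Untouched S → Untouched (v ∷ S)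
      Untouched-leg g∈ t∈ v∈ un g′∈ q t∉ i (there j)   = un g′∈ q (λ k → t∉ (there k)) i j
      Untouched-leg g∈ t∈ v∈ un g′∈ q t∉ i (here refl) with refl ← same-leg g∈ g′∈ v∈ i = t∉ t∈

      -- `i-room` charges all used vertices and serves ends coloured unlike `c`. `i-off` omits the
      -- core and serves ends coloured like `c`, whose next vertex has colour `b₁`.
      record Inv (S : List Node) (σ : Bool → ℕ) : Set where
        field
          i-uniq : Unique S
          i-room : ∀ b → count (hue b) S + σ b ≤ suc t
          i-off  : κ b₁ S + (σ b₁ + μ b₁) ≤ suc t
          i-free : Untouched S
      open Inv

      Inv-∷ : ∀ (σ : Bool → ℕ) {S u v} r → Inv S (λ b → cnt b (col u) (suc r) + σ b) → v ~ u → v ∉ S → Untouched (v ∷ S) →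
              Inv (v ∷ S) (λ b → cnt b (col v) r + σ b)
      Inv-∷ σ {S} {u} {v} r I v~u v∉S un = record
        { i-uniq = Unique-∷ v∉S (i-uniq I)
        ; i-room = λ b → ≤-trans (count-advance (λ _ → true) (σ b) b S r v~u) (i-room I b)
        ; i-off  = ≤-trans (≤-reflexive (cong (κ b₁ (v ∷ S) +_) (+-assoc (cnt b₁ (col v) r) (σ b₁) (μ b₁))))
                     (≤-trans (count-advance (off B) (σ b₁ + μ b₁) b₁ S r v~u)
                       (≤-trans (≤-reflexive (cong (κ b₁ S +_) (sym (+-assoc (cnt b₁ (col u) (suc r)) (σ b₁) (μ b₁))))) (i-off I)))
        ; i-free = un }

      Grown-∷ʳ : ∀ {u v r y} → v ~ u → ω v ≡ true → Grown ω (v , r) y → Grown ω (u , suc r) (y ++ [ v ])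
      Grown-∷ʳ {y = y} v~u ωv (p , l , al) =
        Path-++⁺ y p (v~u , tt) , trans (length-++ y) (trans (+-comm (length y) 1) (cong suc l)) , Allₚ.++⁺ al (ωv ∷ [])

      -- Ends coloured like c always have a new neighbour outside the core. The other ends may be forced into
      -- a tip of the core, whose leg is untouched and provides the last vertex.
      finishOne : ∀ (σ : Bool → ℕ) S u r → r ≤ 2 → r ≡ 0 ⊎ ℓ u ≡ true → Inv S (λ b → cnt b (col u) r + σ b) →
                  ∃ λ y → Grown ω (u , r) y × Inv (y ++ S) σ
      finishOne σ S u zero    _   _         I = [] , (tt , refl , []) , I
      finishOne σ S u (suc r) r≤2 (inj₂ ℓu) I with col u Bool.≟ b₀
      ... | yes q =
        let v , v~u , ℓv , v∉S = pick S ℓu room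
            ωv , v∉B           = ℓ⁻ ℓv
            y , gr , I′        = finishOne σ (v ∷ S) v r (≤-trans (n≤1+n r) r≤2) (inj₂ ℓv)
                                   (Inv-∷ σ r I v~u v∉S (Untouched-outer v∉B (i-free I)))
        in y ++ [ v ] , Grown-∷ʳ v~u ωv gr , subst (λ l → Inv l σ) (sym (++-assoc y [ v ] S)) I′
        where
        room : count (λ x → off B x ∧ hue (not (col u)) x) S + μ (not (col u)) < suc t
        room = count-room (off B) (μ (not (col u))) (σ (not (col u)) + μ (not (col u))) (suc t) S r (m≤n+m _ (σ (not (col u))))
          (≤-trans (≤-reflexive (cong (κ (not (col u)) S +_) (sym (+-assoc (cnt (not (col u)) (col u) (suc r)) (σ (not (col u))) (μ (not (col u)))))))
            (subst (λ z → κ (not z) S + (cnt (not z) (col u) (suc r) + σ (not z) + μ (not z)) ≤ suc t) (sym q) (i-off I)))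
      ... | no q = step (v ∈? B)
        where
        found : ∃ λ v → v ~ u × ω v ≡ true × v ∉ S
        found = Deg-hue (rich (proj₁ (ℓ⁻ ℓu)) (poor-off K (proj₂ (ℓ⁻ ℓu)))) S
          (subst (_< suc t) (+-identityʳ _) (count-room (λ _ → true) 0 (σ (not (col u))) (suc t) S r z≤n (i-room I (not (col u)))))
        v : Node
        v = proj₁ found
        v~u : v ~ u
        v~u = proj₁ (proj₂ found)
        ωv : ω v ≡ true
        ωv = proj₁ (proj₂ (proj₂ found))
        v∉S : v ∉ S
        v∉S = proj₂ (proj₂ (proj₂ found))
        col-v : col v ≡ b₀
        col-v = trans (alt v~u) (trans (cong not (¬-not q)) (not-involutive b₀))
        through : ∀ {g} → g ∈ cl → v ≡ tip g → ∀ r → suc r ≤ 2 → Inv S (λ b → cnt b (col u) (suc r) + σ b) →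
                  ∃ λ y → Grown ω (u , suc r) y × Inv (y ++ S) σ
        through {g} g∈ refl zero _ I =
          [ v ] , ((v~u , tt) , refl , ωv ∷ []) , Inv-∷ σ 0 I v~u v∉S (Untouched-leg g∈ (here refl) (here refl) (i-free I))
        -- A tip without inner vertices is adjacent to `c`, hence not coloured like `c`.
        through {w , [] , _} g∈ refl (suc zero) _ I =
          ⊥-elim (not-fixed (trans (sym col-v) (alt (proj₁ (All.lookup (c-paths K) g∈)))))
        through {w , a ∷ inner , _} g∈ refl (suc zero) _ I =
          a ∷ [ v ] , ((a~v , v~u , tt) , refl , c-inside K (strand∈body g∈ (there (here refl))) ∷ ωv ∷ []) ,
          Inv-∷ σ 0 (Inv-∷ σ 1 I v~u v∉S un) a~v a∉ (Untouched-leg g∈ (there (here refl)) (there (here refl)) un)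
          where
          un : Untouched (v ∷ S)
          un = Untouched-leg g∈ (here refl) (here refl) (i-free I)
          a~v : a ~ v
          a~v = ~-sym (proj₁ (All.lookup (c-paths K) g∈))
          a∉ : a ∉ v ∷ S
          a∉ (here refl) = ++-disjoint [ v ] (leg-unique (Unique-++⁻ʳ [ c ] (c-uniq K)) g∈) (here refl) (here refl)
            where
            leg-unique : ∀ {cl′} → Unique (concat (map strand cl′)) → ∀ {g} → g ∈ cl′ → Unique (strand g)
            leg-unique {h ∷ _} u (here refl) = Unique-++⁻ˡ (strand h) u
            leg-unique {h ∷ _} u (there i)   = leg-unique (Unique-++⁻ʳ (strand h) u) i
          a∉ (there i) = i-free I g∈ col-v v∉S (there (here refl)) i
        through g∈ refl (suc (suc _)) (s≤s (s≤s ())) I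
        step : Dec (v ∈ B) → ∃ λ y → Grown ω (u , suc r) y × Inv (y ++ S) σ
        step (yes v∈B) =
          let g , g∈ , q′ = ∈-map⁻ tip (tips-only (proj₁ (ℓ⁻ ℓu)) (proj₂ (ℓ⁻ ℓu)) v∈B (~-sym v~u))
          in through g∈ q′ r r≤2 I
        step (no v∉B) =
          let y , gr , I′ = finishOne σ (v ∷ S) v r (≤-trans (n≤1+n r) r≤2) (inj₂ (ℓ⁺ ωv v∉B))
                              (Inv-∷ σ r I v~u v∉S (Untouched-outer v∉B (i-free I)))
          in y ++ [ v ] , Grown-∷ʳ v~u ωv gr , subst (λ l → Inv l σ) (sym (++-assoc y [ v ] S)) I′

      finish : ∀ S tasks → All (λ (u , r) → r ≤ 2 × (r ≡ 0 ⊎ ℓ u ≡ true)) tasks → Inv S (λ b → slots b tasks) →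
               ∃ λ yss → Pointwise (Grown ω) tasks yss × Unique (concat yss ++ S)
      finish S []              []               I = [] , [] , i-uniq I
      finish S ((u , r) ∷ tasks) ((r≤2 , ok) ∷ oks) I =
        let y , gr , I′      = finishOne (λ b → slots b tasks) S u r r≤2 ok I
            yss , grs , uniq = finish (y ++ S) tasks oks I′
        in y ∷ yss , gr ∷ grs , Unique-resp-↭ (↭-trans (shifts (concat yss) y) (↭-reflexive (sym (++-assoc y (concat yss) S)))) uniq

      -- Two is the number of postponed vertices that frees one slot of colour `b₀`, and also the
      -- number that a reserve leg is certain to have.
      trim : List Node × ℕ → List Node × ℕ
      trim (xs , r) = xs , r ∸ 2

      regroup : ∀ gs → All (λ g → Path e (proj₁ g)) gs → All (λ (xs , r) → r ≡ 0 ⊎ ℓ (end e xs) ≡ true) gs →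
                (∀ {v} → v ∈ concat (map proj₁ gs) → ω v ≡ true) → ∀ {legs} → Pointwise (Extended ℓ e) (map trim gs) legs →
                ∃ λ hs → map proj₁ hs ≡ legs × map size hs ≡ map size gs × All (λ h → Path e (proj₁ h)) hs ×
                  All (λ (u , r) → r ≤ 2 × (r ≡ 0 ⊎ ℓ u ≡ true)) (ends e hs) ×
                  (∀ {v} → v ∈ concat legs → ω v ≡ true) ×
                  (∀ {v} → v ∈ concat (map proj₁ gs) → v ∈ concat legs) ×
                  (∀ {v} → v ∈ concat legs → v ∈ concat (map proj₁ gs) ⊎ v ∉ B)
      regroup []              []       []       _   []       = [] , refl , refl , [] , [] , (λ ()) , (λ ()) , λ ()
      regroup ((xs , r) ∷ gs) (p ∷ ps) (ok ∷ oks) ins {_ ∷ legs} ((y , refl , p′ , l , al) ∷ es)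
        with regroup gs ps oks (λ i → ins (∈-++⁺ʳ xs i)) es
      ... | hs , a , b , d , f , i , j , k =
        (y ++ xs , 2 ⊓ r) ∷ hs , cong ((y ++ xs) ∷_) a , cong₂ _∷_ sz b , Path-++⁺ y p′ p ∷ d , (m⊓n≤m 2 r , ok′) ∷ f ,
        (λ m → [ own-ω , i ]′ (∈-++⁻ (y ++ xs) m)) ,
        (λ m → [ (λ o → ∈-++⁺ˡ (∈-++⁺ʳ y o)) , (λ o → ∈-++⁺ʳ (y ++ xs) (j o)) ]′ (∈-++⁻ xs m)) ,
        λ m → [ own-off , (λ o → [ (λ o → inj₁ (∈-++⁺ʳ xs o)) , inj₂ ]′ (k o)) ]′ (∈-++⁻ (y ++ xs) m)
        where
        sz : length (y ++ xs) + 2 ⊓ r ≡ length xs + r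
        sz = trans (cong (_+ 2 ⊓ r) (trans (length-++ y) (cong (_+ length xs) l)))
          (trans (lemma (r ∸ 2) (length xs) (2 ⊓ r)) (cong (length xs +_) (m⊓n+n∸m≡n 2 r)))
          where
          lemma : ∀ a b c → a + b + c ≡ b + (c + a)
          lemma = solve-∀
        ends-ok : ∀ y → All (λ v → ℓ v ≡ true) y → r ≡ 0 ⊎ ℓ (end e xs) ≡ true → 2 ⊓ r ≡ 0 ⊎ ℓ (end e (y ++ xs)) ≡ true
        ends-ok (v ∷ _) (ℓv ∷ _) _           = inj₂ ℓv
        ends-ok []      _        (inj₁ refl) = inj₁ refl
        ends-ok []      _        (inj₂ q)    = inj₂ q
        ok′ : 2 ⊓ r ≡ 0 ⊎ ℓ (end e (y ++ xs)) ≡ true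
        ok′ = ends-ok y al ok
        own-ω : ∀ {v} → v ∈ y ++ xs → ω v ≡ true
        own-ω m = [ (λ o → proj₁ (ℓ⁻ (All.lookup al o))) , (λ o → ins (∈-++⁺ˡ o)) ]′ (∈-++⁻ y m)
        own-off : ∀ {v} → v ∈ y ++ xs → v ∈ xs ++ concat (map proj₁ gs) ⊎ v ∉ B
        own-off m = [ (λ o → inj₂ (proj₂ (ℓ⁻ (All.lookup al o)))) , (λ o → inj₁ (∈-++⁺ˡ o)) ]′ (∈-++⁻ y m)

      extended-lengths : ∀ hs {legs} → Pointwise (Extended ω e) hs legs → map length legs ≡ map size hs
      extended-lengths []       []        = refl
      extended-lengths (h ∷ hs) (x ∷ xs) = cong₂ _∷_ (extended-length h x) (extended-lengths hs xs)

      extended-paths : ∀ {hs legs} → All (λ h → Path e (proj₁ h)) hs → Pointwise (Extended ω e) hs legs → All (Path e) legs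
      extended-paths []       []       = []
      extended-paths (p ∷ ps) (x ∷ xs) = extended-path p x ∷ extended-paths ps xs

      extended-inside : ∀ {hs legs} → (∀ {v} → v ∈ concat (map proj₁ hs) → ω v ≡ true) → Pointwise (Extended ω e) hs legs →
                        ∀ {v} → v ∈ concat legs → ω v ≡ true
      extended-inside {(xs , _) ∷ hs} ins ((y , refl , _ , _ , al) ∷ es) i with ∈-++⁻ (y ++ xs) i
      ... | inj₂ j = extended-inside (λ k → ins (∈-++⁺ʳ xs k)) es j
      ... | inj₁ j with ∈-++⁻ y j
      ... | inj₁ k = All.lookup al k
      ... | inj₂ k = ins (∈-++⁺ˡ k)

      slots-trim : ∀ b gs → slots b (ends e (map trim gs)) ≤ slots b (ends e gs)
      slots-trim b []              = z≤n
      slots-trim b ((xs , r) ∷ gs) = +-mono-≤ (cnt-∸2 b (col (end e xs)) r) (slots-trim b gs)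

      slots-trim₀ : ∀ gs → slots b₀ (ends e (map trim gs)) ≡ sum (map (λ (xs , r) → cnt b₀ (col (end e xs)) (r ∸ 2)) gs)
      slots-trim₀ []       = refl
      slots-trim₀ (g ∷ gs) = cong (_ +_) (slots-trim₀ gs)

      proj-trim : ∀ gs → map proj₁ (map trim gs) ≡ map proj₁ gs
      proj-trim []       = refl
      proj-trim (g ∷ gs) = cong (proj₁ g ∷_) (proj-trim gs)

      trim-ok : ∀ {gs} → All (λ (xs , r) → r ≡ 0 ⊎ ℓ (end e xs) ≡ true) gs →
                All (λ (xs , r) → r ≡ 0 ⊎ ℓ (end e xs) ≡ true) (map trim gs)
      trim-ok []              = []
      trim-ok (inj₁ refl ∷ a) = inj₁ refl ∷ trim-ok a
      trim-ok (inj₂ q ∷ a)    = inj₂ q ∷ trim-ok a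

      record Half (hs : List (List Node × ℕ)) : Set where
        field
          h-path : All (λ h → Path e (proj₁ h)) hs
          h-size : map size hs ↭ ls
          h-ends : All (λ (u , r) → r ≤ 2 × (r ≡ 0 ⊎ ℓ u ≡ true)) (ends e hs)
          h-in   : ∀ {v} → v ∈ concat (map proj₁ hs) → ω v ≡ true
          h-uniq : Unique (c ∷ e ∷ concat (map proj₁ hs))
          h-tips : ∀ {w} → w ∈ tips → w ~ e → w ∈ concat (map proj₁ hs)
          h-free : ∀ {g} → g ∈ cl → col (tip g) ≡ b₀ → ∀ {a} → a ∈ strand g → a ∉ concat (map proj₁ hs)
      open Half

      half-inv : ∀ {hs} → Half hs → Inv (c ∷ e ∷ concat (map proj₁ hs)) (λ b → slots b (ends e hs))
      half-inv {hs} H = record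
        { i-uniq = h-uniq H
        ; i-room = λ b → total-bound b (h-path H) (h-size H)
        ; i-off  = subst (λ k → κ b₁ (c ∷ e ∷ concat (map proj₁ hs)) + (slots b₁ (ends e hs) + k) ≤ suc t) (sym μ-b₁)
                     (adjacent-bound (h-path H) (h-size H) (h-tips H))
        ; i-free = λ g∈ q _ → free g∈ q }
        where
        free : ∀ {g} → g ∈ cl → col (tip g) ≡ b₀ → ∀ {a} → a ∈ strand g → a ∉ c ∷ e ∷ concat (map proj₁ hs)
        free g∈ q i (here refl)         = ++-disjoint [ c ] (c-uniq K) (here refl) (∈-concat⁺′ i (∈-map⁺ strand g∈))
        free g∈ q i (there (here refl)) = e∉ (strand∈body g∈ i)
        free g∈ q i (there (there j))   = h-free H g∈ q i j

      complete : ∀ {hs} → Half hs → ∃ λ legs → Spider ω e legs × c ∉ e ∷ concat legs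
      complete {hs} H =
        let yss , grs , uq = finish (c ∷ e ∷ concat (map proj₁ hs)) (ends e hs) (h-ends H) (half-inv H)
            legs , es , uq′ = attach-all [ c ] e hs grs uq
        in legs , record
             { lens = subst (_↭ ls) (sym (extended-lengths hs es)) (h-size H) ; paths = extended-paths (h-path H) es
             ; uniq = Unique-++⁻ʳ [ c ] uq′
             ; inside = λ { (here refl) → ωe ; (there i) → extended-inside (h-in H) es i } }
           , ++-disjoint [ c ] uq′ (here refl)

      module _ {ps gs} (os : All (λ (g , o) → Out B g o) ps) (cl≡ : map proj₁ ps ≡ cl)
               (u : Unique (c ∷ e ∷ concat (map proj₂ ps))) (st : Starts ps gs) where

        private
          paths-ps : All (λ g → Path c (strand g)) (map proj₁ ps)
          paths-ps = subst (All (λ g → Path c (strand g))) (sym cl≡) (c-paths K)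

          gs-path : All (λ g → Path e (proj₁ g)) gs
          gs-path = starts-path paths-ps st

          gs-size : map size gs ↭ ls
          gs-size = subst (_↭ ls) (sym (trans (starts-size st) (cong (map len) cl≡))) (c-lens K)

          gs-in : ∀ {v} → v ∈ concat (map proj₁ gs) → ω v ≡ true
          gs-in = starts-inside (λ {v} i → c-inside K (there (subst (λ l → v ∈ concat (map strand l)) cl≡ i))) st

          gs-uniq : Unique (c ∷ e ∷ concat (map proj₁ gs))
          gs-uniq = concat-⊑-Unique {xss = [ c ] ∷ [ e ] ∷ map proj₁ gs} {yss = [ c ] ∷ [ e ] ∷ map proj₂ ps}
            ((([] ∷ []) , λ i → i) ∷ (([] ∷ []) , λ i → i) ∷ starts-⊑ (Unique-++⁻ʳ (c ∷ [ e ]) u) st) u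

          gs-tips : ∀ {w} → w ∈ tips → w ~ e → w ∈ concat (map proj₁ gs)
          gs-tips {w} i = starts-tip st (subst (λ l → w ∈ map tip l) (sym cl≡) i)

          X : List Node
          X = c ∷ e ∷ concat (map proj₁ gs)

          -- For `b₀` the reserved tips are paid for by trimming; for the other colour the tips
          -- adjacent to `e` already occur in `X`.
          bound : ∀ b → κ b X + (slots b (ends e (map trim gs)) + μ b) ≤ suc t
          bound b with b Bool.≟ b₀
          ... | yes refl = begin
            κ b₀ X + (slots b₀ (ends e (map trim gs)) + count (hue b₀) tips)
              ≡⟨ cong₂ (λ k l → κ b₀ X + (k + count (hue b₀) (map tip l))) (slots-trim₀ gs) (sym cl≡) ⟩
            κ b₀ X + (sum (map (λ (xs , r) → cnt b₀ (col (end e xs)) (r ∸ 2)) gs) + count (hue b₀) (map tip (map proj₁ ps)))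
              ≤⟨ +-mono-≤ (count-mono (λ x → off B x ∧ hue b₀ x) (hue b₀) X (λ {x} _ h → proj₂ (true-∧ {off B x} h))) (starts-slots paths-ps st) ⟩
            count (hue b₀) X + slots b₀ (ends e gs)  ≤⟨ total-bound b₀ gs-path gs-size ⟩
            suc t ∎
            where open ≤-Reasoning
          ... | no q = subst (λ z → κ z X + (slots z (ends e (map trim gs)) + count (adj e) tips) ≤ suc t) (sym (¬-not q))
            (≤-trans (+-monoʳ-≤ (κ b₁ X) (+-monoˡ-≤ _ (slots-trim b₁ gs))) (adjacent-bound gs-path gs-size gs-tips))

        half : ∃ Half
        half =
          let legs , es , uq = Growth.extend ℓ (off B) μ (suc t) pick [ c ] e (map trim gs)
                (subst (λ l → Unique (c ∷ e ∷ concat l)) (sym (proj-trim gs)) gs-uniq) (trim-ok (starts-end st))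
                (λ b → subst (λ l → κ b (c ∷ e ∷ concat l) + (slots b (ends e (map trim gs)) + μ b) ≤ suc t) (sym (proj-trim gs)) (bound b))
              hs , hs-legs , hs-size , hs-path , hs-ends , hs-in , sup , sub = regroup gs gs-path (starts-end st) gs-in es
          in hs , record
            { h-path = hs-path
            ; h-size = subst (_↭ ls) (sym hs-size) gs-size
            ; h-ends = hs-ends
            ; h-in   = λ {v} i → hs-in (subst (λ l → v ∈ concat l) hs-legs i)
            ; h-uniq = subst (λ l → Unique (c ∷ e ∷ concat l)) (sym hs-legs) uq
            ; h-tips = λ {w} i h → subst (λ l → w ∈ concat l) (sym hs-legs) (sup (gs-tips i h))
            ; h-free = λ g∈ q {a} i j → [ starts-inner os (Unique-++⁻ʳ (c ∷ [ e ]) u) st (subst (_ ∈_) (sym cl≡) g∈) q i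
                                        , (λ a∉ → a∉ (strand∈body g∈ i)) ]′ (sub (subst (λ l → a ∈ concat l) hs-legs j)) }

      -- The system avoids `e`, so its outer vertices are available to a spider centred there.
      avoiding-centre : Sdr B e c cl → ∃ λ legs → Spider ω e legs × c ∉ e ∷ concat legs
      avoiding-centre (ps , os , perm , u) = go (↭-map-inv proj₁ perm)
        where
        go : (∃ λ ps′ → cl ≡ map proj₁ ps′ × ps ↭ ps′) → ∃ λ legs → Spider ω e legs × c ∉ e ∷ concat legs
        go (ps′ , cl≡ , ps↭) = complete (proj₂ (half os′ (sym cl≡) u′ (proj₂ (starts os′))))
          where
          os′ : All (λ (g , o) → Out B g o) ps′
          os′ = All-resp-↭ ps↭ os
          u′ : Unique (c ∷ e ∷ concat (map proj₂ ps′))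
          u′ = Unique-resp-↭ (↭-trans (prep e (prep c (concat-↭ (map⁺ proj₂ ps↭)))) (↭-swap e c ↭-refl)) u

      contradictory : ∀ {legs legs′} → Spider ω c legs → Spider ω e legs′ → c ∉ e ∷ concat legs′ → ⊥
      contradictory s₀ s c∉ = c∉ (hit s (critical-centre s₀))

      impossible : ⊥
      impossible = contradictory (proj₁ (proj₂ (completion K ωe e∉))) (proj₁ (proj₂ (avoiding-centre (c-sdr K ωe e∉))))
                     (proj₂ (proj₂ (avoiding-centre (c-sdr K ωe e∉))))

    -- Descent to a minimal core and the choice of the new centre.

    inner-length : CLeg → ℕ
    inner-length (_ , inner , _) = length inner

    measure : List CLeg → ℕ
    measure cl = sum (map inner-length cl)

    -- Every leg begins with a vertex of the colour opposite to the centre.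
    ls≤cnt : ∀ x {ks} → All (1 ≤_) ks → length ks ≤ sum (map (cnt (not x) x) ks)
    ls≤cnt x []               = z≤n
    ls≤cnt x {suc k ∷ ks} (_ ∷ h) = +-mono-≤ (≤-trans (≤-reflexive (sym (bit-refl (not x)))) (m≤m+n _ _)) (ls≤cnt x h)

    fromLegs : ∀ {legs} → All (1 ≤_) (map length legs) →
               ∃ λ cl → map strand cl ≡ legs × map len cl ≡ map length legs × All (λ g → Out [] g (strand g)) cl
    fromLegs {[]}                 []      = [] , refl , refl , []
    fromLegs {(w ∷ inner) ∷ legs} (_ ∷ h) with fromLegs h
    ... | cl , p , q , os = (w , inner , 0) ∷ cl , cong (_ ∷_) p , cong₂ _∷_ (cong suc (+-identityʳ _)) q , full ∷ os

    -- With nothing missing, the strands themselves form the required system.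
    core : ∀ {c legs} → Spider ω c legs → ∃ (Core c)
    core {c} s with fromLegs (All-resp-↭ (↭-sym (lens s)) ls⁺)
    ... | cl , refl , q , os = cl , record
      { c-lens = subst (_↭ ls) (sym q) (lens s) ; c-paths = Allₚ.map⁻ (paths s) ; c-uniq = uniq s ; c-inside = inside s
      ; c-cover = hit s ; c-spare = spare s
      ; c-sdr = λ _ z∉ → map (λ g → g , strand g) cl , Allₚ.map⁺ (All.map Out-full os) ,
          ↭-reflexive (trans (sym (map-∘ cl)) (map-id cl)) ,
          subst (λ l → Unique (_ ∷ c ∷ concat l)) (map-∘ cl) (Unique-∷ z∉ (uniq s)) }
      where
      Out-full : ∀ {D g} → Out [] g (strand g) → Out D g (strand g)
      Out-full {g = _ , _ , .0} full = full

    -- Cutting a leg at `y` removes at least `y` from the inner vertices, so the measure drops; a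
    -- core that cannot be cut satisfies `tips-only`.
    no-core : ∀ k {c cl} → Core c cl → measure cl < k → ⊥
    no-core (suc k) {c} {cl} K (s≤s m≤k) = start (c-spare K)
      where
      tips : List Node
      tips = map tip cl
      no-inner : ∀ {z y g} → ω z ≡ true → z ∉ body c cl → g ∈ cl → y ∈ proj₁ (proj₂ g) → z ~ y → ⊥
      no-inner {z} {y} {w , inner , r} ωz z∉ g∈ y∈ e with ∈-∃++ g∈ | ∈-∃++ y∈
      ... | as , bs , refl | pre , post , refl =
        no-core k (shrink (core-↭ p K) e ωz (λ i → z∉ (∈-resp-↭ (body-↭ (↭-sym p)) i))) (≤-trans smaller m≤k)
        where
        p : as ++ (w , inner , r) ∷ bs ↭ (w , pre ++ y ∷ post , r) ∷ as ++ bs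
        p = shift (w , inner , r) as bs
        smaller : length post + measure (as ++ bs) < measure (as ++ (w , inner , r) ∷ bs)
        smaller = ≤-trans (+-monoˡ-≤ _ (≤-trans (m≤n+m _ (length pre)) (≤-reflexive (sym (length-++ pre)))))
                    (≤-reflexive (sym (sum-↭ (map⁺ inner-length p))))
      tips-only : ∀ {z y} → ω z ≡ true → z ∉ body c cl → y ∈ body c cl → z ~ y → y ∈ tips
      tips-only ωz z∉ (here refl) e = let _ , s , z∉s , _ = completion K ωz z∉ in ⊥-elim (centre-blocked s e ωz z∉s)
      tips-only ωz z∉ (there i) e with ∈-concat⁻′ (map strand cl) i
      ... | xs , y∈ , xs∈ with ∈-map⁻ strand xs∈
      tips-only ωz z∉ (there i) e | _ , here refl , _ | g , g∈ , refl = ∈-map⁺ tip g∈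
      tips-only ωz z∉ (there i) e | _ , there y∈ , _  | g , g∈ , refl = ⊥-elim (no-inner ωz z∉ g∈ y∈ e)
      adj : Node → Node → Bool
      adj u w = does (w ~? u)
      -- `j` bounds how often the number of adjacent tips can still increase before all tips are
      -- adjacent.
      climb : ∀ j {e} → ω e ≡ true → e ∉ body c cl → col e ≡ col c → length tips ≤ count (adj e) tips + j → ⊥
      climb j {e} ωe e∉ hue-e len≤ = Recentre.impossible K tips-only ωe e∉ hue-e maximal
        where
        better : ∀ j → length tips ≤ count (adj e) tips + j → ∀ {u} → ω u ≡ true → u ∉ body c cl → col u ≡ col c →
                 count (adj e) tips < count (adj u) tips → ⊥
        better zero    len≤ {u} _ _ _ lt = <⇒≱ lt (≤-trans (count≤length (adj u) tips) (≤-trans len≤ (≤-reflexive (+-identityʳ _))))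
        better (suc j) len≤ ωu u∉ hue-u lt = climb j ωu u∉ hue-u
          (≤-trans len≤ (≤-trans (≤-reflexive (+-suc _ j)) (+-monoˡ-≤ j lt)))
        maximal : ∀ {u} → ω u ≡ true → u ∉ body c cl → col u ≡ col c → count (adj u) tips ≤ count (adj e) tips
        maximal {u} ωu u∉ hue-u with count (adj u) tips ≤? count (adj e) tips
        ... | yes le = le
        ... | no  gt = ⊥-elim (better j len≤ ωu u∉ hue-u (≰⇒> gt))
      begin-climb : ∀ {e} → ω e ≡ true → e ∉ body c cl → col e ≡ col c → ⊥
      begin-climb ωe e∉ h = climb (length tips) ωe e∉ h (m≤n+m _ _)
      tips≤t : length tips ≤ t
      tips≤t = ≤-trans (≤-reflexive (trans (length-map tip cl) (trans (sym (length-map len cl)) (↭-length (c-lens K)))))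
        (≤-trans (ls≤cnt (col c) ls⁺) (≤-trans (m≤n+m _ (bit (does (col c Bool.≟ not (col c))))) (cap (col c) (not (col c)))))
      start : (∃ λ r → ω r ≡ true × r ∉ body c cl) → ⊥
      start (r , ωr , r∉) with col r Bool.≟ col c
      ... | yes q = begin-climb ωr r∉ q
      -- The vertex `r` has `t + 1` neighbours in `ω` and there are at most `t` tips, so one
      -- neighbour is off the core, and it is coloured like `c`.
      ... | no  q with rich ωr (poor-off K r∉) tips (s≤s tips≤t)
      ... | v , e , ωv , v∉ = begin-climb ωv (λ v∈ → v∉ (tips-only ωr r∉ v∈ (~-sym e)))
        (trans (alt e) (trans (cong not (¬-not q)) (not-involutive (col c))))

    critical-impossible : ∀ {c legs} → Spider ω c legs → ⊥
    critical-impossible s = let cl , K = core s in no-core (suc (measure cl)) K ≤-refl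

-- Connectedness by cuts, nonseparable vertex sets and ears.

module Blocks {n : ℕ} (_~_ : Rel (Fin n) 0ℓ) (~-sym : Symmetric _~_) where

  open Walks _~_ ~-sym

  private
    Node : Set
    Node = Fin n

  -- Connectedness in terms of cuts, which makes it decidable.
  Conn : (Node → Bool) → Set
  Conn χ = ∀ (U : Subset n) {x y} → χ x ≡ true → x ∈ˢ U → χ y ≡ true → y ∉ˢ U →
           ∃₂ λ u v → χ u ≡ true × u ∈ˢ U × χ v ≡ true × v ∉ˢ U × u ~ v

  infixl 6 _∖∖_
  infixl 5 _∪∪_

  abstract
    _∖∖_ : (Node → Bool) → Node → Node → Bool
    (χ ∖∖ v) x = χ x ∧ not (does (x Fin.≟ v))

    ∖∖⁺ : ∀ {χ v x} → χ x ≡ true → x ≢ v → (χ ∖∖ v) x ≡ true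
    ∖∖⁺ {v = v} {x} h x≢v rewrite h = cong not (dec-false (x Fin.≟ v) x≢v)

    ∖∖⁻ : ∀ {χ v x} → (χ ∖∖ v) x ≡ true → χ x ≡ true × x ≢ v
    ∖∖⁻ {χ} {v} {x} h with χ x | x Fin.≟ v
    ∖∖⁻ () | true | yes _
    ... | true | no x≢v = refl , x≢v

    _∪∪_ : (Node → Bool) → List Node → Node → Bool
    (χ ∪∪ P) x = χ x ∨ does (DecMem._∈?_ Fin._≟_ x P)

    ∪∪⁺ˡ : ∀ {χ P x} → χ x ≡ true → (χ ∪∪ P) x ≡ true
    ∪∪⁺ˡ h rewrite h = refl

    ∪∪⁺ʳ : ∀ {χ P x} → x ∈ P → (χ ∪∪ P) x ≡ true
    ∪∪⁺ʳ {χ} {P} {x} i with χ x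
    ... | true  = refl
    ... | false = dec-true (DecMem._∈?_ Fin._≟_ x P) i

    ∪∪⁻ : ∀ {χ P x} → (χ ∪∪ P) x ≡ true → χ x ≡ true ⊎ x ∈ P
    ∪∪⁻ {χ} {P} {x} h with χ x | DecMem._∈?_ Fin._≟_ x P
    ... | true  | _     = inj₁ refl
    ... | false | yes i = inj₂ i

    ∪∪-false : ∀ {χ P x} → χ x ≡ false → x ∉ P → (χ ∪∪ P) x ≡ false
    ∪∪-false {P = P} {x} h x∉ rewrite h = dec-false (DecMem._∈?_ Fin._≟_ x P) x∉

  -- A single edge qualifies, which gives the extremal argument its starting point.
  Nonseparable : (Node → Bool) → Set
  Nonseparable χ = Conn χ × (∀ v → Conn (χ ∖∖ v))

  Conn-resp : ∀ {χ χ′} → (∀ {x} → χ x ≡ true → χ′ x ≡ true) → (∀ {x} → χ′ x ≡ true → χ x ≡ true) → Conn χ → Conn χ′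
  Conn-resp f g conn U χx x∈ χy y∉ with conn U (g χx) x∈ (g χy) y∉
  ... | u , v , χu , u∈ , χv , v∉ , e = u , v , f χu , u∈ , f χv , v∉ , e

  Nonseparable-resp : ∀ {χ χ′} → (∀ {x} → χ x ≡ true → χ′ x ≡ true) → (∀ {x} → χ′ x ≡ true → χ x ≡ true) →
                      Nonseparable χ → Nonseparable χ′
  Nonseparable-resp {χ} {χ′} f g (conn , conn′) = Conn-resp f g conn , λ v → Conn-resp (map-∖∖ f) (map-∖∖ g) (conn′ v)
    where
    map-∖∖ : ∀ {φ ψ v x} → (∀ {x} → φ x ≡ true → ψ x ≡ true) → (φ ∖∖ v) x ≡ true → (ψ ∖∖ v) x ≡ true
    map-∖∖ {φ} {ψ} h q = let a , b = ∖∖⁻ {φ} q in ∖∖⁺ {ψ} (h a) b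

  Conn-subsingleton : ∀ {χ} → (∀ {x y} → χ x ≡ true → χ y ≡ true → x ≡ y) → Conn χ
  Conn-subsingleton h U χx x∈ χy y∉ = ⊥-elim (y∉ (subst (_∈ˢ U) (h χx χy) x∈))

  -- If the cut separates `v` from `s`, the new edge crosses it; otherwise `s` can stand in for `v`.
  Conn-attach : ∀ {χ χ′ s v} → (∀ {x} → χ x ≡ true → χ′ x ≡ true) → χ′ v ≡ true →
                (∀ {x} → χ′ x ≡ true → χ x ≡ true ⊎ x ≡ v) → χ s ≡ true → v ~ s → Conn χ → Conn χ′
  Conn-attach {s = s} {v} f χ′v g χs e conn U {x} {y} χ′x x∈ χ′y y∉ with v ∈ˢ? U | s ∈ˢ? U
  ... | yes v∈ | no s∉  = v , s , χ′v , v∈ , f χs , s∉ , e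
  ... | no v∉  | yes s∈ = s , v , f χs , s∈ , χ′v , v∉ , ~-sym e
  ... | yes v∈ | yes s∈ with g χ′y
  ...   | inj₂ refl = ⊥-elim (y∉ v∈)
  ...   | inj₁ χy with conn U χs s∈ χy y∉
  ...   | a , b , χa , a∈ , χb , b∉ , e′ = a , b , f χa , a∈ , f χb , b∉ , e′
  Conn-attach {s = s} {v} f χ′v g χs e conn U {x} {y} χ′x x∈ χ′y y∉ | no v∉ | no s∉ with g χ′x
  ...   | inj₂ refl = ⊥-elim (v∉ x∈)
  ...   | inj₁ χx with conn U χx x∈ χs s∉
  ...   | a , b , χa , a∈ , χb , b∉ , e′ = a , b , f χa , a∈ , f χb , b∉ , e′

  Conn-∪∪ : ∀ {χ s} P → χ s ≡ true → Path s P → Conn χ → Conn (χ ∪∪ P)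
  Conn-∪∪ {χ} []      χs _       conn = Conn-resp (∪∪⁺ˡ {χ}) (λ h → [ (λ q → q) , (λ ()) ]′ (∪∪⁻ {χ} {[]} h)) conn
  Conn-∪∪ {χ} {s} (v ∷ P) χs (e , p) conn =
    Conn-attach {χ ∪∪ P} {χ ∪∪ (v ∷ P)} (λ h → [ ∪∪⁺ˡ {χ} , (λ i → ∪∪⁺ʳ {χ} (there i)) ]′ (∪∪⁻ {χ} h)) (∪∪⁺ʳ {χ} (here refl))
      (λ h → [ (λ q → inj₁ (∪∪⁺ˡ {χ} q)) , (λ { (here q) → inj₂ q ; (there i) → inj₁ (∪∪⁺ʳ {χ} i) }) ]′ (∪∪⁻ {χ} h))
      (end-in P) e (Conn-∪∪ P χs p conn)
    where
    end-in : ∀ P → (χ ∪∪ P) (end s P) ≡ true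
    end-in []      = ∪∪⁺ˡ {χ} χs
    end-in (x ∷ P) = ∪∪⁺ʳ {χ} (here refl)

  -- When a vertex off the ear is deleted, at least one end remains to which the whole ear is
  -- attached. When a vertex of the ear is deleted, each of the two pieces is still attached at its
  -- own end.
  Nonseparable-ear : ∀ {β b b′} P → Nonseparable β → β b ≡ true → β b′ ≡ true → b ≢ b′ → Path b (b′ ∷ P) →
                     Unique P → (∀ {x} → x ∈ P → β x ≡ false) → Nonseparable (β ∪∪ P)
  Nonseparable-ear {β} {b} {b′} P (conn , conn′) βb βb′ b≢b′ path u out = Conn-∪∪ P βb (proj₂ path) conn , without
    where
    without : ∀ v → Conn ((β ∪∪ P) ∖∖ v)
    without v with DecMem._∈?_ Fin._≟_ v P
    ... | no v∉ = Conn-resp to from attached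
      where
      attached : Conn ((β ∖∖ v) ∪∪ P)
      attached with v Fin.≟ b
      ... | no v≢b = Conn-∪∪ P (∖∖⁺ {β} βb (λ q → v≢b (sym q))) (proj₂ path) (conn′ v)
      ... | yes refl = Conn-resp
        (λ h → [ ∪∪⁺ˡ {β ∖∖ v} , (λ i → ∪∪⁺ʳ {β ∖∖ v} (∈-resp-↭ (↭-reverse P) i)) ]′ (∪∪⁻ {β ∖∖ v} h))
        (λ h → [ ∪∪⁺ˡ {β ∖∖ v} , (λ i → ∪∪⁺ʳ {β ∖∖ v} (∈-resp-↭ (↭-sym (↭-reverse P)) i)) ]′ (∪∪⁻ {β ∖∖ v} h))
        (Conn-∪∪ (reverse P) (∖∖⁺ {β} βb′ (λ q → b≢b′ (sym q))) (Path-reverse P path) (conn′ v))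
      to : ∀ {x} → ((β ∖∖ v) ∪∪ P) x ≡ true → ((β ∪∪ P) ∖∖ v) x ≡ true
      to h with ∪∪⁻ {β ∖∖ v} h
      ... | inj₁ q = let a , c = ∖∖⁻ {β} q in ∖∖⁺ {β ∪∪ P} (∪∪⁺ˡ {β} a) c
      ... | inj₂ i = ∖∖⁺ {β ∪∪ P} (∪∪⁺ʳ {β} i) (λ { refl → v∉ i })
      from : ∀ {x} → ((β ∪∪ P) ∖∖ v) x ≡ true → ((β ∖∖ v) ∪∪ P) x ≡ true
      from h with ∖∖⁻ {β ∪∪ P} h
      ... | q , x≢v with ∪∪⁻ {β} q
      ... | inj₁ a = ∪∪⁺ˡ {β ∖∖ v} (∖∖⁺ {β} a x≢v)
      ... | inj₂ i = ∪∪⁺ʳ {β ∖∖ v} i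
    ... | yes v∈ with ∈-∃++ v∈
    ... | as , bs , refl = Conn-resp to from
      (Conn-∪∪ (reverse as) (∪∪⁺ˡ {β} βb′) (Path-reverse as (Path-++⁻ˡ (b′ ∷ as) path))
        (Conn-∪∪ bs βb (proj₂ (Path-++⁻ʳ (b′ ∷ as) path)) conn))
      where
      v≢as : ∀ {x} → x ∈ as → x ≢ v
      v≢as i refl = ++-disjoint as u i (here refl)
      v≢bs : ∀ {x} → x ∈ bs → x ≢ v
      v≢bs i refl = ++-disjoint [ v ] (Unique-++⁻ʳ as u) (here refl) i
      to : ∀ {x} → (β ∪∪ bs ∪∪ reverse as) x ≡ true → ((β ∪∪ (as ++ v ∷ bs)) ∖∖ v) x ≡ true
      to h with ∪∪⁻ {β ∪∪ bs} h
      ... | inj₂ i = ∖∖⁺ {β ∪∪ (as ++ v ∷ bs)} (∪∪⁺ʳ {β} (∈-++⁺ˡ (∈-resp-↭ (↭-reverse as) i))) (v≢as (∈-resp-↭ (↭-reverse as) i))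
      ... | inj₁ q with ∪∪⁻ {β} q
      ... | inj₂ i = ∖∖⁺ {β ∪∪ (as ++ v ∷ bs)} (∪∪⁺ʳ {β} (∈-++⁺ʳ as (there i))) (v≢bs i)
      ... | inj₁ a = ∖∖⁺ {β ∪∪ (as ++ v ∷ bs)} (∪∪⁺ˡ {β} a) λ { refl → case trans (sym a) (out v∈) of λ () }
      from : ∀ {x} → ((β ∪∪ (as ++ v ∷ bs)) ∖∖ v) x ≡ true → (β ∪∪ bs ∪∪ reverse as) x ≡ true
      from h with ∖∖⁻ {β ∪∪ (as ++ v ∷ bs)} h
      ... | q , x≢v with ∪∪⁻ {β} q
      ... | inj₁ a = ∪∪⁺ˡ {β ∪∪ bs} (∪∪⁺ˡ {β} a)
      ... | inj₂ i with ∈-++⁻ as i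
      ... | inj₁ j         = ∪∪⁺ʳ {β ∪∪ bs} (∈-resp-↭ (↭-sym (↭-reverse as)) j)
      ... | inj₂ (here q′) = ⊥-elim (x≢v q′)
      ... | inj₂ (there j) = ∪∪⁺ˡ {β ∪∪ bs} (∪∪⁺ʳ {β} j)

duplicate : ∀ {n} (P : List (Fin n)) → Unique P ⊎ ∃₂ λ as v → ∃₂ λ bs cs → P ≡ as ++ v ∷ bs ++ v ∷ cs
duplicate []      = inj₁ []
duplicate (x ∷ P) with DecMem._∈?_ Fin._≟_ x P
... | yes i with ∈-∃++ i
...   | bs , cs , refl = inj₂ ([] , x , bs , cs , refl)
duplicate (x ∷ P) | no x∉ with duplicate P
...   | inj₁ u                              = inj₁ (Unique-∷ x∉ u)
...   | inj₂ (as , v , bs , cs , refl)      = inj₂ (x ∷ as , v , bs , cs , refl)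

-- Enlarging a nonseparable set whose complement contains a copy.

module Extremal {n : ℕ} (_~_ : Rel (Fin n) 0ℓ) (_~?_ : Decidable _~_) (~-sym : Symmetric _~_)
  (col : Fin n → Bool) (alt : ∀ {x y} → x ~ y → col x ≡ not (col y))
  (ls : List ℕ) (t : ℕ) (cap : ∀ x b → bit (does (x Bool.≟ b)) + sum (map (cnt b x) ls) ≤ t)
  (ls⁺ : All (1 ≤_) ls) where

  open Host _~_ ~-sym col alt
  open Capacity ls t cap
  open Blocks _~_ ~-sym
  open Absorption _~_ _~?_ ~-sym col alt ls t cap

  irrefl : ∀ {x} → x ~ x → ⊥
  irrefl {x} e with col x | alt e
  ... | true  | ()
  ... | false | ()

  module Main (χ : Node → Bool) (~⇒χ : ∀ {x y} → x ~ y → χ x ≡ true)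
    (deg : ∀ {x} → χ x ≡ true → Deg x (2 + t) χ)
    -- Connectivity is known as the absence of small separating sets, so walks are at hand only up
    -- to double negation.
    (link : ∀ {x y} → χ x ≡ true → χ y ≡ true → ¬ ¬ Star _~_ x y)
    (link-off : ∀ {x y} v → χ v ≡ true → χ x ≡ true → χ y ≡ true → x ≢ v → y ≢ v →
                ¬ ¬ Star (λ a b → a ~ b × a ≢ v × b ≢ v) x y)
    (bad : ∀ {c legs} → Spider χ c legs → ¬ Nonseparable (λ x → χ x ∧ off (c ∷ concat legs) x)) where

    module Step (β : Node → Bool) (β⊆χ : ∀ {x} → β x ≡ true → χ x ≡ true) (nonsep : Nonseparable β)
      {p q : Node} (βp : β p ≡ true) (βq : β q ≡ true) (p≢q : p ≢ q)
      -- The induction hypothesis: no larger nonseparable set leaves room for a copy.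
      (bigger : ∀ P → (∀ {x} → x ∈ P → χ x ≡ true × β x ≡ false) → ∀ {x} → x ∈ P → Nonseparable (β ∪∪ P) →
                ∀ {c legs} → Spider (λ x → χ x ∧ not ((β ∪∪ P) x)) c legs → ⊥) where

      ω : Node → Bool
      ω x = χ x ∧ not (β x)

      ω⁺ : ∀ {x} → χ x ≡ true → β x ≡ false → ω x ≡ true
      ω⁺ a b = ∧-true a (cong not b)

      ω⁻ : ∀ {x} → ω x ≡ true → χ x ≡ true × β x ≡ false
      ω⁻ {x} h = let a , b = true-∧ {χ x} h in a , not-injective b

      Two : Node → Set
      Two x = ∃₂ λ b b′ → b ≢ b′ × (β b ≡ true × β b′ ≡ true) × (x ~ b × x ~ b′)

      two? : ∀ x → Dec (Two x)
      two? x = any? λ b → any? λ b′ → ¬? (b Fin.≟ b′) ×-dec ((β b Bool.≟ true ×-dec β b′ Bool.≟ true) ×-dec (x ~? b ×-dec x ~? b′))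

      α : Node → Bool
      α x = ω x ∧ does (two? x)

      single : ∀ {u} → ¬ Two u → ∃ λ Y → length Y ≤ 1 × (∀ {v} → v ~ u → β v ≡ true → v ∈ Y)
      single {u} ¬two with any? (λ b → β b Bool.≟ true ×-dec u ~? b)
      ... | no none = [] , z≤n , λ e βv → ⊥-elim (none (_ , βv , ~-sym e))
      ... | yes (b , βb , e) = [ b ] , ≤-refl , only
        where
        only : ∀ {v} → v ~ u → β v ≡ true → v ∈ [ b ]
        only {v} e′ βv with v Fin.≟ b
        ... | yes q  = here q
        ... | no v≢b = ⊥-elim (¬two (v , b , v≢b , (βv , βb) , (~-sym e′ , e)))

      Deg-inside : ∀ {u k} ω′ Y → χ u ≡ true → length Y + k ≤ 2 + t → (∀ {v} → v ~ u → χ v ≡ true → v ∉ Y → ω′ v ≡ true) → Deg u k ω′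
      Deg-inside {u} {k} ω′ Y χu le h X lt
        with deg χu (Y ++ X) (≤-trans (s≤s (≤-reflexive (length-++ Y)))
               (≤-trans (≤-reflexive (sym (+-suc (length Y) _))) (≤-trans (+-monoʳ-≤ (length Y) lt) le)))
      ... | v , e , χv , v∉ = v , e , h e χv (λ i → v∉ (∈-++⁺ˡ i)) , λ i → v∉ (∈-++⁺ʳ Y i)

      β-false : ∀ {v} → (β v ≡ true → ⊥) → β v ≡ false
      β-false {v} h with β v
      ... | true  = ⊥-elim (h refl)
      ... | false = refl

      -- Of the `t + 2` neighbours at most one lies in `β`.
      rich : ∀ {u} → ω u ≡ true → α u ≡ false → Deg u (suc t) ω
      rich {u} ωu αu with single {u} ¬two
        where
        ¬two : ¬ Two u
        ¬two tw with trans (sym αu) (∧-true ωu (dec-true (two? u) tw))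
        ... | ()
      ... | Y , le , h = Deg-inside ω Y (proj₁ (ω⁻ ωu)) (+-monoˡ-≤ (suc t) le)
        λ e χv v∉ → ω⁺ χv (β-false (λ βv → v∉ (h e βv)))

      ω-∪∪ : ∀ {P x} → ω x ≡ true → x ∉ P → χ x ∧ not ((β ∪∪ P) x) ≡ true
      ω-∪∪ {P} {x} ωx x∉ = ∧-true (proj₁ (ω⁻ ωx)) (cong not (∪∪-false {β} (proj₂ (ω⁻ ωx)) x∉))

      hit : ∀ {c legs x} → Spider ω c legs → α x ≡ true → x ∈ c ∷ concat legs
      hit {c} {legs} {x} s αx with x ∈? c ∷ concat legs
      ... | yes i = i
      ... | no x∉ with true-∧ {ω x} αx
      ... | ωx , tw with two? x
      ... | yes (b , b′ , b≢b′ , (βb , βb′) , (e , e′)) =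
        ⊥-elim (bigger [ x ] (λ { (here refl) → ω⁻ ωx }) (here refl)
          (Nonseparable-ear [ x ] nonsep βb βb′ b≢b′ (~-sym e′ , e , tt) ([] ∷ []) (λ { (here refl) → proj₂ (ω⁻ ωx) }))
          (restrict s (λ i ωv → ω-∪∪ ωv (λ { (here refl) → x∉ i }))))

      -- A copy filling `ω` would leave exactly `β`, which is nonseparable.
      spare : ∀ {c legs} → Spider ω c legs → ∃ λ r → ω r ≡ true × r ∉ c ∷ concat legs
      spare {c} {legs} s with any? (λ r → ω r Bool.≟ true ×-dec ¬? (r ∈? c ∷ concat legs))
      ... | yes r = r
      ... | no none = ⊥-elim (bad (restrict s (λ _ h → proj₁ (ω⁻ h)))
        (Nonseparable-resp (λ βx → ∧-true (β⊆χ βx) (off-true (λ i → case trans (sym βx) (proj₂ (ω⁻ (inside s i))) of λ ())))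
          (λ {x} h → back (true-∧ {χ x} h)) nonsep))
        where
        back : ∀ {x} → χ x ≡ true × off (c ∷ concat legs) x ≡ true → β x ≡ true
        back {x} (χx , o) with β x in eq
        ... | true  = refl
        ... | false = ⊥-elim (none (x , ω⁺ χx eq , true-off o))

      module Sparse (¬two : ∀ {u} → ω u ≡ true → ¬ Two u) where

        -- Repetitions are permitted because short cuts yield walks; in a shortest ear they cannot
        -- occur. The interior is listed from `b′` to `b`.
        Ear : Node → Node → List Node → Set
        Ear b b′ P = β b ≡ true × β b′ ≡ true × b ≢ b′ × Path b (b′ ∷ P) × (∀ {x} → x ∈ P → ω x ≡ true)

        splice : ∀ {b b′} as {x} bs {y} cs {m} → Ear b b′ (as ++ x ∷ bs ++ y ∷ cs) → Path y (x ∷ m) → (∀ {v} → v ∈ m → ω v ≡ true) →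
                 Ear b b′ (as ++ x ∷ m ++ y ∷ cs)
        splice {b} {b′} as {x} bs {y} cs {m} (βb , βb′ , ne , p , h) pm hm =
          βb , βb′ , ne ,
          Path-++⁺ (b′ ∷ as) (Path-++⁻ˡ (b′ ∷ as) p)
            (Path-++⁺ (x ∷ m) pm (Path-++⁻ʳ (b′ ∷ as ++ x ∷ bs) (subst (Path b) (cong (b′ ∷_) (sym (++-assoc as (x ∷ bs) (y ∷ cs)))) p))) ,
          λ i → case ∈-++⁻ as i of λ where
            (inj₁ j) → h (∈-++⁺ˡ j)
            (inj₂ (here refl)) → h (∈-++⁺ʳ as (here refl))
            (inj₂ (there j)) → case ∈-++⁻ m j of λ where
              (inj₁ k) → hm k
              (inj₂ k) → h (∈-++⁺ʳ as (there (∈-++⁺ʳ bs k)))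

        length-++-< : ∀ as {xs ys : List Node} → length xs < length ys → length (as ++ xs) < length (as ++ ys)
        length-++-< []       h = h
        length-++-< (_ ∷ as) h = s≤s (length-++-< as h)

        module Shortest {b b′} (P : List Node) (ear : Ear b b′ P) {p₁ P′} (P≡ : P ≡ p₁ ∷ P′)
          (shorter : ∀ {b b′} x Q → Ear b b′ (x ∷ Q) → length (x ∷ Q) < length P → ⊥) where

          shorter′ : ∀ {b b′} as x Q → Ear b b′ (as ++ x ∷ Q) → length (as ++ x ∷ Q) < length P → ⊥
          shorter′ []       x Q e lt = shorter x Q e lt
          shorter′ (a ∷ as) x Q e lt = shorter a (as ++ x ∷ Q) e lt

          P-unique : Unique P
          P-unique with duplicate P
          ... | inj₁ u = u
          ... | inj₂ (as , v , bs , cs , eq) = ⊥-elim (shorter′ as v cs ear′ lt)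
            where
            e′ : Ear b b′ (as ++ v ∷ bs ++ v ∷ cs)
            e′ = subst (Ear b b′) eq ear
            ear′ : Ear b b′ (as ++ v ∷ cs)
            ear′ with e′
            ... | βb , βb′ , ne , p , h = βb , βb′ , ne ,
              Path-++⁺ (b′ ∷ as) (Path-++⁻ˡ (b′ ∷ as) p) (Path-++⁻ʳ (b′ ∷ as ++ v ∷ bs) (subst (Path b) (cong (b′ ∷_) (sym (++-assoc as (v ∷ bs) (v ∷ cs)))) p)) ,
              λ i → h ([ ∈-++⁺ˡ , (λ j → ∈-++⁺ʳ as (there (∈-++⁺ʳ bs j))) ]′ (∈-++⁻ as i))
            lt : length (as ++ v ∷ cs) < length P
            lt = subst (λ l → length (as ++ v ∷ cs) < length l) (sym eq)
              (length-++-< as (s≤s (≤-trans (m≤n+m (suc (length cs)) (length bs)) (≤-reflexive (sym (length-++ bs))))))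

          U : Node → Bool
          U x = ω x ∧ off P x

          U⁻ : ∀ {x} → U x ≡ true → ω x ≡ true × x ∉ P
          U⁻ {x} h = let a , c = true-∧ {ω x} h in a , true-off c

          Blocked : Node → Set
          Blocked u = ∃ λ Y → length Y ≤ 2 × (∀ {v} → v ~ u → β v ≡ true ⊎ v ∈ P → v ∈ Y)

          first-in : ∀ u Q → (∀ {v} → v ∈ Q → ¬ (v ~ u)) ⊎ ∃₂ λ as x → ∃ λ bs → Q ≡ as ++ x ∷ bs × x ~ u × (∀ {v} → v ∈ as → ¬ (v ~ u))
          first-in u []      = inj₁ λ ()
          first-in u (x ∷ Q) with x ~? u
          ... | yes e = inj₂ ([] , x , Q , refl , e , λ ())
          ... | no ¬e with first-in u Q
          ...   | inj₁ h = inj₁ λ { (here refl) → ¬e ; (there i) → h i }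
          ...   | inj₂ (as , y , bs , eq , e , h) = inj₂ (x ∷ as , y , bs , cong (x ∷_) eq , e , λ { (here refl) → ¬e ; (there i) → h i })

          -- Two neighbours of u on the ear have distance 2 there, as otherwise the path through u is a short cut;
          -- and then u has no neighbour in β.
          blocked : ∀ {u} → ω u ≡ true → u ∉ P → Blocked u
          blocked {u} ωu u∉ with single (¬two ωu) | first-in u P
          ... | Y , le , h | inj₁ none = Y , ≤-trans le (n≤1+n 1) , λ { e (inj₁ βv) → h e βv ; e (inj₂ i) → ⊥-elim (none i e) }
          ... | Y , le , h | inj₂ (as , x , bs , eq , e , none) = around bs eq
            where
            -- The graph is bipartite, so it has no triangles.
            colour : ∀ {x y} → x ~ u → y ~ x → ¬ (y ~ u)
            colour e₁ e₂ e₃ = not-fixed (trans (sym (alt e₃)) (trans (alt e₂) (cong not (alt e₁))))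
            path : ∀ {Q} → P ≡ Q → Path b (b′ ∷ Q)
            path refl = proj₁ (proj₂ (proj₂ (proj₂ ear)))
            one : ∀ Z → (∀ {v} → v ∈ P → v ~ u → v ∈ Z) → length Z ≤ 1 → Blocked u
            one Z f le′ = Y ++ Z , ≤-trans (≤-reflexive (length-++ Y)) (+-mono-≤ le le′) ,
              λ { e (inj₁ βv) → ∈-++⁺ˡ (h e βv) ; e (inj₂ i) → ∈-++⁺ʳ Y (f i e) }
            split : ∀ {Q v} → P ≡ Q → v ∈ P → v ∈ Q
            split refl i = i
            -- The short cut through `u` saves at least the two vertices `y` and `z`.
            far : ∀ y z ds {v} fs → v ~ u → P ≡ as ++ x ∷ y ∷ z ∷ ds ++ v ∷ fs → ⊥
            far y z ds {v} fs e″ eq = shorter′ as x (u ∷ v ∷ fs)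
              (splice as (y ∷ z ∷ ds) fs {[ u ]} (subst (Ear b b′) eq ear) (e , ~-sym e″ , tt) (λ { (here refl) → ωu }))
              (subst (λ l → length (as ++ x ∷ u ∷ v ∷ fs) < length l) (sym eq)
                (length-++-< as (s≤s (s≤s (s≤s (≤-trans (m≤n+m (suc (length fs)) (length ds)) (≤-reflexive (sym (length-++ ds)))))))))
            near : ∀ y z cs → P ≡ as ++ x ∷ y ∷ z ∷ cs → ∀ {v} → v ∈ P → v ~ u → v ≡ x ⊎ v ≡ z
            near y z cs eq i e′ with ∈-++⁻ as (split eq i)
            ... | inj₁ j = ⊥-elim (none j e′)
            ... | inj₂ (here q) = inj₁ q
            ... | inj₂ (there (here refl)) = ⊥-elim (colour e (~-sym (proj₁ (Path-++⁻ʳ (b′ ∷ as) (path eq)))) e′)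
            ... | inj₂ (there (there (here q))) = inj₂ q
            ... | inj₂ (there (there (there j))) with ∈-∃++ j
            ... | ds , fs , refl = ⊥-elim (far y z ds fs e′ eq)
            -- If `d` differs from `b′`, the part of the ear up to `x` followed by `u` joins `b′` to
            -- `d`; if `d` is `b′`, then `u` followed by the part from `z` on joins `b′` to `b`.
            -- Both ears are shorter.
            no-β : ∀ y z cs → P ≡ as ++ x ∷ y ∷ z ∷ cs → z ~ u → ∀ {d} → β d ≡ true → d ~ u → ⊥
            no-β y z cs eq ez {d} βd ed = cut (d Fin.≟ b′)
              where
              βb : β b ≡ true
              βb = proj₁ ear
              βb′ : β b′ ≡ true
              βb′ = proj₁ (proj₂ ear)
              hP : ∀ {v} → v ∈ P → ω v ≡ true
              hP = proj₂ (proj₂ (proj₂ (proj₂ ear)))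
              in-P : ∀ {v} → v ∈ as ++ x ∷ y ∷ z ∷ cs → ω v ≡ true
              in-P i = hP (subst (_ ∈_) (sym eq) i)
              cut : Dec (d ≡ b′) → ⊥
              cut (no d≢b′) = shorter′ as x [ u ]
                (βd , βb′ , d≢b′ , Path-++⁺ (b′ ∷ as) (Path-++⁻ˡ (b′ ∷ as) (path eq)) (e , ~-sym ed , tt) ,
                  λ i → case ∈-++⁻ as i of λ where
                    (inj₁ j) → in-P (∈-++⁺ˡ j)
                    (inj₂ (here refl)) → in-P (∈-++⁺ʳ as (here refl))
                    (inj₂ (there (here refl))) → ωu)
                (subst (λ l → length (as ++ x ∷ [ u ]) < length l) (sym eq) (length-++-< as (s≤s (s≤s (s≤s z≤n)))))
              cut (yes refl) = shorter u (z ∷ cs)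
                (βb , βd , proj₁ (proj₂ (proj₂ ear)) ,
                  (ed , ~-sym ez , Path-++⁻ʳ (b′ ∷ as ++ x ∷ [ y ]) (subst (Path b) (cong (b′ ∷_) (sym (++-assoc as (x ∷ [ y ]) (z ∷ cs)))) (path eq))) ,
                  λ { (here refl) → ωu ; (there i) → in-P (∈-++⁺ʳ as (there (there i))) })
                (subst (λ l → length (u ∷ z ∷ cs) < length l) (sym eq)
                  (≤-trans (m≤n+m _ (length as)) (≤-reflexive (sym (length-++ as)))))
            around : ∀ bs → P ≡ as ++ x ∷ bs → Blocked u
            around [] eq = one [ x ] (λ i e → case ∈-++⁻ as (split eq i) of λ where
              (inj₁ j) → ⊥-elim (none j e)
              (inj₂ j) → j) ≤-refl
            around (y ∷ []) eq = one [ x ] (λ i e′ → case ∈-++⁻ as (split eq i) of λ where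
              (inj₁ j) → ⊥-elim (none j e′)
              (inj₂ (here j)) → here j
              (inj₂ (there (here refl))) → ⊥-elim (colour e (~-sym (proj₁ (Path-++⁻ʳ (b′ ∷ as) (path eq)))) e′)) ≤-refl
            around (y ∷ z ∷ cs) eq with z ~? u
            ... | no ¬e = one [ x ] (λ i e′ → [ (λ q → here q) , (λ { refl → ⊥-elim (¬e e′) }) ]′ (only i e′)) ≤-refl
              where
              only : ∀ {v} → v ∈ P → v ~ u → v ≡ x ⊎ v ≡ z
              only = near y z cs eq
            ... | yes ez = x ∷ [ z ] , ≤-refl , λ
              { e′ (inj₁ βv) → ⊥-elim (no-β y z cs eq ez βv e′)
              ; e′ (inj₂ i) → [ (λ q → here q) , (λ q → there (here q)) ]′ (near y z cs eq i e′) }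

          p₁∈ : p₁ ∈ P
          p₁∈ = subst (p₁ ∈_) (sym P≡) (here refl)

          in-ω : ∀ {v} → v ∈ P → ω v ≡ true
          in-ω = proj₂ (proj₂ (proj₂ (proj₂ ear)))

          -- Although `p₁` is on the ear, the bound is of use: it yields `t ≥ 1` neighbours in `U`,
          -- hence a root for the greedy copy.
          first-blocked : Blocked p₁
          first-blocked with single (¬two (in-ω p₁∈))
          ... | Y , le , h = around P′ P≡
            where
            split : ∀ {Q v} → P ≡ Q → v ∈ P → v ∈ Q
            split refl i = i
            around : ∀ P′ → P ≡ p₁ ∷ P′ → Blocked p₁
            around [] eq = Y , ≤-trans le (n≤1+n 1) , λ
              { e (inj₁ βv) → h e βv
              ; e (inj₂ i) → case split eq i of λ { (here refl) → ⊥-elim (irrefl e) } }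
            around (y ∷ Q) eq = Y ++ [ y ] , ≤-trans (≤-reflexive (length-++ Y)) (+-monoˡ-≤ 1 le) , λ
              { e (inj₁ βv) → ∈-++⁺ˡ (h e βv)
              ; e (inj₂ i) → ∈-++⁺ʳ Y (near (split eq i) e) }
              where
              near : ∀ {v} → v ∈ p₁ ∷ y ∷ Q → v ~ p₁ → v ∈ [ y ]
              near (here refl)       e = ⊥-elim (irrefl e)
              near (there (here q))  e = here q
              near {v} (there (there j)) e with ∈-∃++ j
              ... | ds , fs , refl = ⊥-elim (shorter p₁ (v ∷ fs)
                (splice [] (y ∷ ds) fs {[]} (subst (Ear b b′) eq ear) (~-sym e , tt) (λ ()))
                (subst (λ l → length (p₁ ∷ v ∷ fs) < length l) (sym eq)
                  (s≤s (s≤s (≤-trans (m≤n+m (suc (length fs)) (length ds)) (≤-reflexive (sym (length-++ ds))))))))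

          U⁺ : ∀ {x} → χ x ≡ true → β x ≡ false → x ∉ P → U x ≡ true
          U⁺ a b c = ∧-true (ω⁺ a b) (off-true c)

          Blocked⇒Deg : ∀ {u} → χ u ≡ true → Blocked u → Deg u t U
          Blocked⇒Deg χu (Y , le , h) = Deg-inside U Y χu (+-monoˡ-≤ t le)
            λ e χv v∉ → U⁺ χv (β-false (λ βv → v∉ (h e (inj₁ βv)))) (λ i → v∉ (h e (inj₂ i)))

          1≤t : 1 ≤ t
          1≤t = ≤-trans (m≤m+n 1 _) (cap true true)

          absurd : ⊥
          absurd with Blocked⇒Deg (proj₁ (ω⁻ (in-ω p₁∈))) first-blocked [] 1≤t
          ... | _ , _ , Uv , _ = refute (greedy {U} (λ Uu → let ωu , u∉ = U⁻ Uu in Blocked⇒Deg (proj₁ (ω⁻ ωu)) (blocked ωu u∉)) Uv)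
            where
            refute : ∀ {c} → (∃ λ legs → Spider U c legs) → ⊥
            refute (_ , s) = case ear of λ where
              (βb , βb′ , ne , p , h) → bigger P (λ i → ω⁻ (h i)) (subst (p₁ ∈_) (sym P≡) (here refl))
                (Nonseparable-ear P nonsep βb βb′ ne p P-unique (λ i → proj₂ (ω⁻ (h i))))
                (restrict s (λ _ Uv → let ωv , v∉ = U⁻ Uv in ω-∪∪ ωv v∉))

        -- Descent on the length stands in for the choice of a shortest ear.
        no-ear : ∀ k {b b′} x Q → Ear b b′ (x ∷ Q) → length (x ∷ Q) < k → ⊥
        no-ear (suc k) x Q ear (s≤s le) =
          Shortest.absurd (x ∷ Q) ear refl (λ y R ear′ lt → no-ear k y R ear′ (≤-trans lt le))

        crossing : ∀ {x y} → Star _~_ x y → β x ≡ true → β y ≡ false → ∃₂ λ u v → β u ≡ true × β v ≡ false × u ~ v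
        crossing ε         βx βy = case trans (sym βx) βy of λ ()
        crossing (_◅_ {j = z} e es) βx βy with β z in eq
        ... | true  = crossing es eq βy
        ... | false = _ , z , βx , eq , e

        walk : ∀ {v x y} → Star (λ a b → a ~ b × a ≢ v × b ≢ v) x y → β x ≡ false → β y ≡ true →
               ∃₂ λ b P → β b ≡ true × b ≢ v × Path b (x ∷ P) × (∀ {z} → z ∈ x ∷ P → ω z ≡ true)
        walk ε βx βy = case trans (sym βx) βy of λ ()
        walk (_◅_ {j = z} (e , _ , z≢v) es) βx βy with β z in eq
        ... | true  = z , [] , eq , z≢v , (e , tt) , λ { (here refl) → ω⁺ (~⇒χ e) βx }
        ... | false with walk es eq βy
        ...   | b , P , βb , b≢v , p , h = b , z ∷ P , βb , b≢v , (e , p) , λ { (here refl) → ω⁺ (~⇒χ e) βx ; (there i) → h i }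

        other : ∀ v → ∃ λ b → β b ≡ true × b ≢ v
        other v with p Fin.≟ v
        ... | no  p≢v  = p , βp , p≢v
        ... | yes refl = q , βq , λ q≡p → p≢q (sym q≡p)

        -- Some edge from `u` to `v` leaves `β`. A walk from `v` that avoids `u` returns to `β` at
        -- another vertex, and its part before the first return is the interior of an ear.
        sparse-impossible : ∀ {w} → ω w ≡ true → ⊥
        sparse-impossible ωw = link (β⊆χ βp) (proj₁ (ω⁻ ωw)) λ path → cross (crossing path βp (proj₂ (ω⁻ ωw)))
          where
          cross : (∃₂ λ u v → β u ≡ true × β v ≡ false × u ~ v) → ⊥
          cross (u , v , βu , βv , e) with other u
          ... | b , βb , b≢u = link-off u (β⊆χ βu) (~⇒χ (~-sym e)) (β⊆χ βb) (λ { refl → irrefl e }) b≢u λ path → ear (walk path βv βb)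
            where
            ear : (∃₂ λ b P → β b ≡ true × b ≢ u × Path b (v ∷ P) × (∀ {z} → z ∈ v ∷ P → ω z ≡ true)) → ⊥
            ear (b , P , βb , b≢u , p , h) = no-ear _ v P (βb , βu , b≢u , (e , p) , h) ≤-refl

      step-impossible : ∀ {c legs} → Spider ω c legs → ⊥
      step-impossible s with any? (λ x → α x Bool.≟ true)
      ... | yes (x , αx) = Critical.critical-impossible ω α rich hit spare αx ls⁺ s
      ... | no none = Sparse.sparse-impossible (λ {u} ωu tw → none (u , ∧-true ωu (dec-true (two? u) tw))) (inside s (here refl))

    missing : (Node → Bool) → ℕ
    missing β = count (λ x → not (β x)) (allFin n)

    missing-∪∪ : ∀ β P {x} → x ∈ P → β x ≡ false → missing (β ∪∪ P) < missing β
    missing-∪∪ β P {x} i βx = go (allFin n) (∈-allFin x)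
      where
      le : ∀ v → bit (not ((β ∪∪ P) v)) ≤ bit (not (β v))
      le v with β v in eq
      ... | true  = ≤-reflexive (cong (λ b → bit (not b)) (∪∪⁺ˡ {β} eq))
      ... | false = bit≤1 (not ((β ∪∪ P) v))
      le* : ∀ xs → count (λ x → not ((β ∪∪ P) x)) xs ≤ count (λ x → not (β x)) xs
      le* []       = z≤n
      le* (v ∷ xs) = +-mono-≤ (le v) (le* xs)
      go : ∀ xs → x ∈ xs → count (λ x → not ((β ∪∪ P) x)) xs < count (λ x → not (β x)) xs
      go (v ∷ xs) (here refl) rewrite βx | ∪∪⁺ʳ {β} i = s≤s (le* xs)
      go (v ∷ xs) (there j)   = ≤-trans (≤-reflexive (sym (+-suc _ _))) (+-mono-≤ (le v) (go xs j))

    -- Induction on the number of vertices off `β`, which absorbing an ear decreases.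
    no-block : ∀ k β → missing β < k → (∀ {x} → β x ≡ true → χ x ≡ true) → Nonseparable β →
               ∀ {p q} → β p ≡ true → β q ≡ true → p ≢ q →
               ∀ {c legs} → Spider (λ x → χ x ∧ not (β x)) c legs → ⊥
    no-block (suc k) β (s≤s le) β⊆χ nonsep βp βq p≢q =
      Step.step-impossible β β⊆χ nonsep βp βq p≢q λ P h i nonsep′ →
        no-block k (β ∪∪ P) (≤-trans (missing-∪∪ β P i (proj₂ (h i))) le)
          (λ m → [ β⊆χ , (λ j → proj₁ (h j)) ]′ (∪∪⁻ {β} m)) nonsep′ (∪∪⁺ˡ {β} βp) (∪∪⁺ˡ {β} βq) p≢q

    pair-nonseparable : ∀ {x y} → x ~ y → Nonseparable (λ v → does (v ∈? x ∷ [ y ]))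
    pair-nonseparable {x} {y} e = both , without
      where
      is : Node → Node → Bool
      is a v = does (v Fin.≟ a)
      is⁻ : ∀ {a v} → is a v ≡ true → v ≡ a
      is⁻ {a} {v} = does⁻ (v Fin.≟ a)
      pair : Node → Bool
      pair v = does (v ∈? x ∷ [ y ])
      pair⁻ : ∀ {v} → pair v ≡ true → v ∈ x ∷ [ y ]
      pair⁻ {v} = does⁻ (v ∈? x ∷ [ y ])
      both : Conn pair
      both = Conn-attach {is x} {pair} (λ {v} h → dec-true (v ∈? x ∷ [ y ]) (here (is⁻ {x} h))) (dec-true (y ∈? x ∷ [ y ]) (there (here refl)))
        (λ {z} h → case pair⁻ {z} h of λ { (here refl) → inj₁ (dec-true (x Fin.≟ x) refl) ; (there (here refl)) → inj₂ refl })
        (dec-true (x Fin.≟ x) refl) (~-sym e) (Conn-subsingleton {is x} (λ a b → trans (is⁻ {x} a) (sym (is⁻ {x} b))))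
      without : ∀ v → Conn (pair ∖∖ v)
      without v with v ∈? x ∷ [ y ]
      ... | no v∉ = Conn-resp {pair} (λ {z} h → ∖∖⁺ {pair} h (λ { refl → v∉ (pair⁻ {z} h) })) (λ h → proj₁ (∖∖⁻ {pair} h)) both
      ... | yes i = Conn-subsingleton λ a b → same i (pair⁻ (proj₁ (∖∖⁻ {pair} a))) (pair⁻ (proj₁ (∖∖⁻ {pair} b))) (proj₂ (∖∖⁻ {pair} a)) (proj₂ (∖∖⁻ {pair} b))
        where
        same : ∀ {v a b} → v ∈ x ∷ [ y ] → a ∈ x ∷ [ y ] → b ∈ x ∷ [ y ] → a ≢ v → b ≢ v → a ≡ b
        same _           (here refl)         (here refl)         _ _ = refl
        same _           (there (here refl)) (there (here refl)) _ _ = refl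
        same (here refl)         (here refl) (there (here refl)) h _ = ⊥-elim (h refl)
        same (there (here refl)) (here refl) (there (here refl)) _ h = ⊥-elim (h refl)
        same (here refl)         (there (here refl)) (here refl) _ h = ⊥-elim (h refl)
        same (there (here refl)) (there (here refl)) (here refl) h _ = ⊥-elim (h refl)

    Deg-outside : ∀ {c legs u} → Spider χ c legs → χ u ≡ true → ∃ λ v → v ~ u × χ v ≡ true × v ∉ c ∷ concat legs
    Deg-outside {u = u} s χu = Deg-hue (deg χu) _ (≤-trans (s≤s (count-spider≤ s (not (col u)))) (n≤1+n _))

    -- The initial nonseparable set is an edge off a greedily found copy: a neighbour of its centre
    -- `x₀` and a neighbour of that neighbour, both off the copy by the degree condition.
    impossible : ∀ {x} → χ x ≡ true → ⊥
    impossible {x₀} χx₀ = from-spider (greedy {χ} (λ χu X lt → deg χu X (≤-trans lt (m≤n+m t 2))) χx₀)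
      where
      from-edge : ∀ {c legs x} → Spider χ c legs → x ∉ c ∷ concat legs →
                  (∃ λ y → y ~ x × χ y ≡ true × y ∉ c ∷ concat legs) → ⊥
      from-edge {x = x} s x∉ (y , e , χy , y∉) =
        no-block _ (λ v → does (v ∈? y ∷ [ x ])) ≤-refl sub (pair-nonseparable e) {y} {x}
          (dec-true (y ∈? y ∷ [ x ]) (here refl)) (dec-true (x ∈? y ∷ [ x ]) (there (here refl))) (λ { refl → irrefl e })
          (restrict s (λ {v} i χv → ∧-true χv (cong not (dec-false (v ∈? y ∷ [ x ]) λ { (here refl) → y∉ i ; (there (here refl)) → x∉ i }))))
        where
        sub : ∀ {v} → does (v ∈? y ∷ [ x ]) ≡ true → χ v ≡ true
        sub {v} h with does⁻ (v ∈? y ∷ [ x ]) h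
        ... | here refl         = χy
        ... | there (here refl) = ~⇒χ (~-sym e)
      from-spider : (∃ λ legs → Spider χ x₀ legs) → ⊥
      from-spider (legs , s) with Deg-outside s χx₀
      ... | x , _ , χx , x∉ = from-edge s x∉ (Deg-outside s χx)

-- Subsets as lists without repetition.

elements : ∀ {n} → Subset n → List (Fin n)
elements []            = []
elements (true ∷ p)  = zero ∷ map suc (elements p)
elements (false ∷ p) = map suc (elements p)

length-elements : ∀ {n} (p : Subset n) → length (elements p) ≡ ∣ p ∣
length-elements []            = refl
length-elements (true ∷ p)  = cong suc (trans (length-map suc (elements p)) (length-elements p))
length-elements (false ∷ p) = trans (length-map suc (elements p)) (length-elements p)

∈-elements⁺ : ∀ {n} {p : Subset n} {x} → x ∈ˢ p → x ∈ elements p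
∈-elements⁺ {p = true ∷ p}  {zero}  here      = here refl
∈-elements⁺ {p = true ∷ p}  {suc x} (there i) = there (∈-map⁺ suc (∈-elements⁺ i))
∈-elements⁺ {p = false ∷ p} {suc x} (there i) = ∈-map⁺ suc (∈-elements⁺ i)

∈-elements⁻ : ∀ {n} (p : Subset n) {x} → x ∈ elements p → x ∈ˢ p
∈-elements⁻ (true ∷ p) (here refl) = here
∈-elements⁻ (true ∷ p) (there i) with ∈-map⁻ suc i
... | _ , j , refl = there (∈-elements⁻ p j)
∈-elements⁻ (false ∷ p) i with ∈-map⁻ suc i
... | _ , j , refl = there (∈-elements⁻ p j)

elements-Unique : ∀ {n} (p : Subset n) → Unique (elements p)
elements-Unique []            = []
elements-Unique (true ∷ p)  = Unique-∷ (λ i → case′ (∈-map⁻ suc i)) (Uniq.map⁺ Finₚ.suc-injective (elements-Unique p))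
  where
  case′ : (∃ λ x → x ∈ elements p × zero ≡ suc x) → ⊥
  case′ (_ , _ , ())
elements-Unique (false ∷ p) = Uniq.map⁺ Finₚ.suc-injective (elements-Unique p)

Unique⇒length≤∣∣ : ∀ {n} {p : Subset n} {xs} → Unique xs → (∀ {x} → x ∈ xs → x ∈ˢ p) → length xs ≤ ∣ p ∣
Unique⇒length≤∣∣ {p = p} u h =
  ≤-trans (Unique-⊆⇒length≤ u (λ i → ∈-elements⁺ (h i))) (≤-reflexive (length-elements p))

∣∣≤length : ∀ {n} (p : Subset n) {xs} → (∀ {x} → x ∈ˢ p → x ∈ xs) → ∣ p ∣ ≤ length xs
∣∣≤length p h = ≤-trans (≤-reflexive (sym (length-elements p))) (Unique-⊆⇒length≤ (elements-Unique p) (λ i → h (∈-elements⁻ p i)))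

∈-tabulate⁺ˢ : ∀ {n} (f : Fin n → Bool) {x} → f x ≡ true → x ∈ˢ tabulate f
∈-tabulate⁺ˢ f {x} h = lookup⇒[]= x (tabulate f) (trans (lookup∘tabulate f x) h)

∈-tabulate⁻ˢ : ∀ {n} (f : Fin n → Bool) {x} → x ∈ˢ tabulate f → f x ≡ true
∈-tabulate⁻ˢ f {x} i = trans (sym (lookup∘tabulate f x)) ([]=⇒lookup i)

Unique-Fin⇒length≤ : ∀ {m} {xs : List (Fin m)} → Unique xs → length xs ≤ m
Unique-Fin⇒length≤ {m} u = ≤-trans (Unique-⊆⇒length≤ u (λ {v} _ → ∈-allFin v)) (≤-reflexive (length-tabulate (λ i → i)))

bipartition-alternates : ∀ {n} (G : Graph n) {X Y} → IsBipartition G X Y →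
  ∀ {x y} → Graph._~_ G x y → does (x ∈ˢ? X) ≡ not (does (y ∈ˢ? X))
bipartition-alternates G {X} {Y} (X∪Y , _ , indX , indY) {x} {y} e with x ∈ˢ? X | y ∈ˢ? X
... | yes x∈ | yes y∈ = ⊥-elim (indX x∈ y∈ e)
... | yes _  | no _   = refl
... | no _   | yes _  = refl
... | no x∉  | no y∉  = ⊥-elim (indY (right x∉ (Graph.~⇒∈V G e)) (right y∉ (Graph.~⇒∈V G (Graph.~-sym G e))) e)
  where
  right : ∀ {v} → v ∉ˢ X → v ∈ˢ V G → v ∈ˢ Y
  right v∉ v∈ with x∈p∪q⁻ X Y (subst (_ ∈ˢ_) (sym X∪Y) v∈)
  ... | inj₁ i = ⊥-elim (v∉ i)
  ... | inj₂ i = i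

-- Decomposition of a spider into legs around its centre.

module Legs {m : ℕ} (T : Graph m) (connected : Connected T) (acyclic : Acyclic T)
  (c : Fin m) (c∈V : c ∈ˢ V T) (thin : ∀ {u} → u ≢ c → ¬ (degree T u > 2)) where

  open Graph T using (_~_; _~?_; ~-sym; ~-irr; ~⇒∈V)
  open Walks _~_ ~-sym

  private
    N : Set
    N = Fin m

  Linked-path : ∀ {v} x ps → Path v (x ∷ ps) → Linked _~_ (x ∷ ps ++ [ v ])
  Linked-path x []       (e , _) = e ∷ [-]
  Linked-path x (y ∷ ps) (e , p) = e ∷ Linked-path y ps p

  no-cycle : ∀ {v x y} ps → Path v (x ∷ y ∷ ps) → Unique (v ∷ x ∷ y ∷ ps) → v ~ x → ⊥
  no-cycle ps p u e = acyclic _ _ (s≤s (s≤s (s≤s z≤n)) , u , e ∷ Linked-path _ _ p)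

  leg-⊆ : ∀ {leg : List N} {legs} → leg ∈ legs → leg ⊆ concat legs
  leg-⊆ {legs = l ∷ ls} (here refl) = subst (_⊆ l ++ concat ls) (++-identityʳ l) (Sub.++⁺ (⊆-refl {x = l}) (minimum (concat ls)))
  leg-⊆ {legs = l ∷ ls} (there i)   = Sub.++⁺ˡ l (leg-⊆ i)

  -- Otherwise the path from `x` back to `v`, along its own leg or through `c` into another one,
  -- would close a cycle with the edge between `v` and `x`.
  unused : ∀ {x xs others v} → Path c (x ∷ xs) → All (Path c) others → Unique (c ∷ (x ∷ xs) ++ concat others) →
           v ~ x → v ≢ end c xs → v ∉ c ∷ (x ∷ xs) ++ concat others
  unused {xs = []}     p ps u e v≢ (here refl) = v≢ refl
  unused {xs = y ∷ xs} p ps u e v≢ (here refl) = no-cycle xs p (Unique-++⁻ˡ (c ∷ _ ∷ y ∷ xs) u) e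
  unused {x} {xs} {others} {v} p ps u e v≢ (there i) with ∈-++⁻ (x ∷ xs) i
  ... | inj₁ (here refl) = ~-irr e
  ... | inj₁ (there j) with ∈-∃++ j
  ...   | [] , bs , refl = v≢ refl
  ...   | a ∷ as , bs , refl = no-cycle as (Path-++⁻ˡ (x ∷ a ∷ as) p) uq e
    where
    uq : Unique (v ∷ x ∷ a ∷ as)
    uq = Unique-++⁻ˡ (v ∷ x ∷ a ∷ as) (Unique-resp-↭ (shift v (x ∷ a ∷ as) bs) (Unique-++⁻ˡ (x ∷ a ∷ as ++ v ∷ bs) (Unique-++⁻ʳ [ c ] u)))
  unused {x} {xs} {others} {v} p ps u e v≢ (there i) | inj₂ j with ∈-concat⁻′ others j
  ... | leg , v∈ , leg∈ with ∈-∃++ v∈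
  ... | as , q , refl = loop (Path-++⁺ (x ∷ xs) p (Path-reverse⁺ q (Path-++⁻ʳ as (All.lookup ps leg∈)))) uq
    where
    sub : c ∷ (x ∷ xs) ++ v ∷ q ⊆ c ∷ (x ∷ xs) ++ concat others
    sub = Sub.++⁺ (⊆-refl {x = c ∷ x ∷ xs}) (⊆-trans (Sub.++⁺ˡ as (⊆-refl {x = v ∷ q})) (leg-⊆ leg∈))
    uq : Unique (v ∷ (x ∷ xs) ++ c ∷ reverse q)
    uq = Unique-resp-↭ (↭-trans (shift v (c ∷ x ∷ xs) q) (prep v (↭-trans (↭-sym (shift c (x ∷ xs) q)) (++⁺ˡ (x ∷ xs) (prep c (↭-sym (↭-reverse q)))))))
           (Unique-resp-⊆ sub u)
    loop : Path v ((x ∷ xs) ++ c ∷ reverse q) → Unique (v ∷ (x ∷ xs) ++ c ∷ reverse q) → ⊥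
    loop = go xs
      where
      go : ∀ xs → Path v ((x ∷ xs) ++ c ∷ reverse q) → Unique (v ∷ (x ∷ xs) ++ c ∷ reverse q) → ⊥
      go []       p u = no-cycle (reverse q) p u e
      go (y ∷ ys) p u = no-cycle (ys ++ c ∷ reverse q) p u e

  Closed : List N → Set
  Closed leg = ∃₂ λ w ws → leg ≡ w ∷ ws × (∀ {v} → v ~ w → v ≡ end c ws)

  -- The fuel `k` cannot run out, since distinct vertices number at most `m`.
  growLeg : ∀ k x xs others → Path c (x ∷ xs) → All (Path c) others → Unique (c ∷ (x ∷ xs) ++ concat others) →
            m < k + length (c ∷ (x ∷ xs) ++ concat others) →
            ∃ λ y → Path c (y ++ x ∷ xs) × Unique (c ∷ (y ++ x ∷ xs) ++ concat others) × Closed (y ++ x ∷ xs)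
  growLeg zero    x xs others p ps u lt = ⊥-elim (<⇒≱ lt (Unique-Fin⇒length≤ u))
  growLeg (suc k) x xs others p ps u lt with any? (λ v → (v ~? x) ×-dec ¬? (v Fin.≟ end c xs))
  ... | no none = [] , p , u , x , xs , refl , closed
    where
    closed : ∀ {v} → v ~ x → v ≡ end c xs
    closed {v} e with v Fin.≟ end c xs
    ... | yes q = q
    ... | no ne = ⊥-elim (none (v , e , ne))
  ... | yes (v , e , v≢) with growLeg k v (x ∷ xs) others (e , p) ps u′ (≤-trans lt (≤-reflexive (sym (+-suc k _))))
    where
    v∉ : v ∉ c ∷ (x ∷ xs) ++ concat others
    v∉ = unused p ps u e v≢
    u′ : Unique (c ∷ (v ∷ x ∷ xs) ++ concat others)
    u′ = Unique-resp-↭ (↭-swap v c ↭-refl) (Unique-∷ v∉ u)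
  ... | y , p′ , u″ , cl = y ++ [ v ] , subst (Path c) eq p′ , subst (λ l → Unique (c ∷ l ++ concat others)) eq u″ , subst Closed eq cl
    where
    eq : y ++ v ∷ x ∷ xs ≡ (y ++ [ v ]) ++ x ∷ xs
    eq = sym (++-assoc y [ v ] (x ∷ xs))

  Rooted : List (List N) → Set
  Rooted legs = ∀ {v} → v ~ c → ∃₂ λ leg p → leg ∈ legs × leg ≡ p ++ [ v ]

  NonEmpty : List N → Set
  NonEmpty leg = 1 ≤ length leg

  -- All neighbours of `c` are present from the outset as legs of length one, so `Rooted` only has
  -- to be preserved.
  growAll : ∀ todo done → All NonEmpty todo → All (Path c) todo → All (Path c) done → All Closed done →
            Unique (c ∷ concat (todo ++ done)) → Rooted (todo ++ done) →
            ∃ λ legs → All (Path c) legs × All Closed legs × Unique (c ∷ concat legs) × Rooted legs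
  growAll []               done _        _        ps cs u r = done , ps , cs , u , r
  growAll ((x ∷ xs) ∷ todo) done (_ ∷ ne) (p ∷ pt) ps cs u r
    with growLeg (suc m) x xs (todo ++ done) p (Allₚ.++⁺ pt ps) u (m≤m+n (suc m) _)
  ... | y , p′ , u′ , cl = growAll todo ((y ++ x ∷ xs) ∷ done) ne pt (p′ ∷ ps) (cl ∷ cs)
      (Unique-resp-↭ (prep c (concat-↭ (↭-sym (shift (y ++ x ∷ xs) todo done)))) u′) rooted
    where
    rooted : Rooted (todo ++ (y ++ x ∷ xs) ∷ done)
    rooted e with r e
    ... | leg , q , here refl , eq = y ++ x ∷ xs , y ++ q , ∈-++⁺ʳ todo (here refl) , trans (cong (y ++_) eq) (sym (++-assoc y q _))
    ... | leg , q , there i , eq = leg , q , [ ∈-++⁺ˡ , (λ j → ∈-++⁺ʳ todo (there j)) ]′ (∈-++⁻ todo i) , eq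

  singletons : List (List N)
  singletons = map [_] (elements (tabulate (λ y → does (c ~? y))))

  concat-singletons : ∀ (xs : List N) → concat (map [_] xs) ≡ xs
  concat-singletons []       = refl
  concat-singletons (x ∷ xs) = cong (x ∷_) (concat-singletons xs)

  Consecutive : List (List N) → N → N → Set
  Consecutive legs u v = ∃₂ λ leg p → ∃ λ q → leg ∈ legs × leg ≡ p ++ u ∷ q × end c q ≡ v

  neighbour⇒∈ : ∀ {u} → c ~ u → u ∈ elements (tabulate (λ y → does (c ~? y)))
  neighbour⇒∈ {u} e = ∈-elements⁺ (∈-tabulate⁺ˢ (λ y → does (c ~? y)) (dec-true (c ~? u) e))

  ∈⇒neighbour : ∀ {u} → u ∈ elements (tabulate (λ y → does (c ~? y))) → c ~ u
  ∈⇒neighbour {u} i = does⁻ (c ~? u) (∈-tabulate⁻ˢ (λ y → does (c ~? y)) (∈-elements⁻ (tabulate (λ y → does (c ~? y))) i))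

  three-neighbours : ∀ {u a b d} → Unique (a ∷ b ∷ d ∷ []) → u ~ a → u ~ b → u ~ d → degree T u > 2
  three-neighbours {u} uq ea eb ed = Unique⇒length≤∣∣ uq λ
    { (here refl) → nb ea ; (there (here refl)) → nb eb ; (there (there (here refl))) → nb ed }
    where
    nb : ∀ {v} → u ~ v → v ∈ˢ tabulate (λ y → does (u ~? y))
    nb {v} e = ∈-tabulate⁺ˢ (λ y → does (u ~? y)) (dec-true (u ~? v) e)

  record Decomposition : Set where
    field
      legs     : List (List N)
      nonempty : All NonEmpty legs
      paths    : All (Path c) legs
      uniq     : Unique (c ∷ concat legs)
      edges    : ∀ {u v} → u ~ v → Consecutive legs u v ⊎ Consecutive legs v u
      covers   : ∀ {v} → v ∈ˢ V T → v ∈ c ∷ concat legs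
      inside   : ∀ {v} → v ∈ c ∷ concat legs → v ∈ˢ V T

  -- Rootedness accounts for the edges at `c`, closedness for those at the far ends, and the degree
  -- bound for those at inner vertices of legs. So the legs are closed under adjacency, and
  -- connectedness makes them cover the tree.
  decomposition : Decomposition
  decomposition = build (growAll singletons [] (ne _) (sp _ (λ i → i)) [] [] (subst (λ l → Unique (c ∷ l)) (sym eq) uq₀) rooted₀)
    where
    nbs : List N
    nbs = elements (tabulate (λ y → does (c ~? y)))
    eq : concat (singletons ++ []) ≡ nbs
    eq = trans (cong concat (++-identityʳ singletons)) (concat-singletons nbs)
    uq₀ : Unique (c ∷ nbs)
    uq₀ = Unique-∷ (λ i → ~-irr (∈⇒neighbour i)) (elements-Unique (tabulate (λ y → does (c ~? y))))
    ne : ∀ xs → All NonEmpty (map [_] xs)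
    ne []       = []
    ne (_ ∷ xs) = s≤s z≤n ∷ ne xs
    sp : ∀ xs → (∀ {v} → v ∈ xs → v ∈ nbs) → All (Path c) (map [_] xs)
    sp []       _ = []
    sp (x ∷ xs) h = (~-sym (∈⇒neighbour (h (here refl))) , tt) ∷ sp xs (λ i → h (there i))
    rooted₀ : Rooted (singletons ++ [])
    rooted₀ {v} e = [ v ] , [] , ∈-++⁺ˡ (∈-map⁺ [_] (neighbour⇒∈ (~-sym e))) , refl
    build : (∃ λ legs → All (Path c) legs × All Closed legs × Unique (c ∷ concat legs) × Rooted legs) → Decomposition
    build (legs , ps , cs , u , r) = record
      { legs = legs ; nonempty = All.map (λ { (_ , _ , refl , _) → s≤s z≤n }) cs ; paths = ps ; uniq = u
      ; edges = λ e → edge (covers (~⇒∈V e)) e ; covers = covers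
      ; inside = inside′ }
      where
      in-concat : ∀ {leg v} → leg ∈ legs → v ∈ leg → v ∈ concat legs
      in-concat leg∈ v∈ = ∈-concat⁺′ v∈ leg∈
      end∈ : ∀ {leg p q} → leg ∈ legs → leg ≡ p ++ q → end c q ∈ c ∷ concat legs
      end∈ {q = []}    _    _    = here refl
      end∈ {p = p} {q = x ∷ q} leg∈ refl = there (in-concat leg∈ (∈-++⁺ʳ p (here refl)))
      leg-unique : ∀ {leg} → leg ∈ legs → Unique (c ∷ leg)
      leg-unique leg∈ = Unique-resp-⊆ (refl ∷ˢ leg-⊆ leg∈) u
      inner : ∀ {u v} leg p u′ q → leg ∈ legs → leg ≡ p ++ u′ ∷ u ∷ q → u ~ v → Consecutive legs u v ⊎ Consecutive legs v u
      inner {u} {v} leg p u′ q leg∈ refl e with v Fin.≟ end c q | v Fin.≟ u′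
      ... | yes q′ | _ = inj₁ (_ , p ++ [ u′ ] , q , leg∈ , sym (++-assoc p [ u′ ] (u ∷ q)) , sym q′)
      ... | no _ | yes refl = inj₂ (_ , p , u ∷ q , leg∈ , refl , refl)
      ... | no v≢ | no v≢u′ = ⊥-elim (thin u≢c (three-neighbours uq₃ (~-sym (proj₁ path)) (proj₁ (proj₂ path)) e))
        where
        path : Path c (u′ ∷ u ∷ q)
        path = Path-++⁻ʳ p (All.lookup ps leg∈)
        uq-leg : Unique (c ∷ p ++ u′ ∷ u ∷ q)
        uq-leg = leg-unique leg∈
        u≢c : u ≢ c
        u≢c refl = ++-disjoint [ c ] uq-leg (here refl) (∈-++⁺ʳ p (there (here refl)))
        u′≢ : ∀ q → Unique (c ∷ p ++ u′ ∷ u ∷ q) → u′ ≢ end c q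
        u′≢ []      uq refl = ++-disjoint [ c ] uq (here refl) (∈-++⁺ʳ p (here refl))
        u′≢ (a ∷ q) uq refl = ++-disjoint [ u′ ] (Unique-++⁻ʳ p (Unique-++⁻ʳ [ c ] uq)) (here refl) (there (here refl))
        uq₃ : Unique (u′ ∷ end c q ∷ v ∷ [])
        uq₃ = (u′≢ q uq-leg ∷ (λ z → v≢u′ (sym z)) ∷ []) ∷ ((λ z → v≢ (sym z)) ∷ []) ∷ [] ∷ []
      edge : ∀ {u v} → u ∈ c ∷ concat legs → u ~ v → Consecutive legs u v ⊎ Consecutive legs v u
      edge (here refl) e with r (~-sym e)
      ... | leg , p , leg∈ , eq = inj₂ (leg , p , [] , leg∈ , eq , refl)
      edge {u} {v} (there i) e with ∈-concat⁻′ legs i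
      ... | leg , u∈ , leg∈ with ∈-∃++ u∈
      ... | [] , q , refl with All.lookup cs leg∈
      ...   | _ , _ , refl , closed = inj₁ (_ , [] , q , leg∈ , refl , sym (closed (~-sym e)))
      edge {u} {v} (there i) e | leg , u∈ , leg∈ | a ∷ as , q , refl with ∷-last a as
      ... | p , u′ , eq = inner leg p u′ q leg∈ (trans (cong (_++ u ∷ q) eq) (++-assoc p [ u′ ] (u ∷ q))) e
      next∈ : ∀ {u v} → Consecutive legs u v ⊎ Consecutive legs v u → v ∈ c ∷ concat legs
      next∈ (inj₁ (leg , p , q , leg∈ , eq , refl)) = end∈ {p = p ++ [ _ ]} leg∈ (trans eq (sym (++-assoc p [ _ ] q)))
      next∈ (inj₂ (leg , p , q , leg∈ , refl , _)) = there (in-concat leg∈ (∈-++⁺ʳ p (here refl)))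
      reach : ∀ {x y} → x ∈ c ∷ concat legs → Star _~_ x y → y ∈ c ∷ concat legs
      reach i ε        = i
      reach i (e ◅ es) = reach (next∈ (edge i e)) es
      covers : ∀ {v} → v ∈ˢ V T → v ∈ c ∷ concat legs
      covers v∈ = reach (here refl) (connected c∈V v∈)
      inside′ : ∀ {v} → v ∈ c ∷ concat legs → v ∈ˢ V T
      inside′ (here refl) = c∈V
      inside′ (there i) with ∈-concat⁻′ legs i
      ... | leg , v∈ , leg∈ with ∈-∃++ v∈
      ... | p , q , refl = ~⇒∈V (proj₁ (Path-++⁻ʳ p (All.lookup ps leg∈)))

-- Finite search, decidable connectedness and the passage to 2-connectedness.

∈-─⁻ : ∀ {n} (p q : Subset n) {x} → x ∈ˢ p ─ q → x ∈ˢ p × x ∉ˢ q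
∈-─⁻ p q i = p─q⊆p p q i , λ j → disjoint p q i j
  where
  disjoint : ∀ {n} (p q : Subset n) {x} → x ∈ˢ p ─ q → x ∉ˢ q
  disjoint (_ ∷ p) (true ∷ q)  {suc x} (there i) (there j) = disjoint p q i j
  disjoint (_ ∷ p) (false ∷ q) {suc x} (there i) (there j) = disjoint p q i j

-- Maps between finite sets are searched as vectors, which makes the existence of an embedding
-- decidable.
anyVec? : ∀ {n} m {P : Vec (Fin n) m → Set} → (∀ v → Dec (P v)) → Dec (∃ P)
anyVec? zero    P? = map′ (λ p → [] , p) (λ { ([] , p) → p }) (P? [])
anyVec? (suc m) P? = map′ (λ (x , v , p) → x ∷ v , p) (λ { (x ∷ v , p) → x , v , p }) (any? λ x → anyVec? m λ v → P? (x ∷ v))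

-- Supplies the connectivity as the least size of a separating set.
least : ∀ {P : ℕ → Set} → (∀ k → Dec (P k)) → ∀ {k} → P k → ∃ λ j → P j × (∀ i → P i → j ≤ i)
least {P} P? {k} p with below (suc k)
  where
  below : ∀ k → (∃ λ j → P j × (∀ i → P i → j ≤ i)) ⊎ (∀ i → i < k → ¬ P i)
  below zero    = inj₂ λ _ ()
  below (suc k) with below k
  ... | inj₁ r = inj₁ r
  ... | inj₂ h with P? k
  ...   | yes p = inj₁ (k , p , λ i q → ≮⇒≥ (λ lt → h i lt q))
  ...   | no ¬p = inj₂ λ i lt q → [ (λ lt′ → h i lt′ q) , (λ { refl → ¬p q }) ]′ (m≤n⇒m<n∨m≡n (s≤s⁻¹ lt))
... | inj₁ r = r
... | inj₂ h = ⊥-elim (h k ≤-refl p)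

module Cuts {n : ℕ} (_~_ : Rel (Fin n) 0ℓ) (_~?_ : Decidable _~_) (~-sym : Symmetric _~_) where

  open Blocks _~_ ~-sym public

  conn? : ∀ χ → Dec (Conn χ)
  conn? χ = map′ to from (¬? (anySubset? bad?))
    where
    Crossing Bad : Subset n → Set
    Crossing U = ∃₂ λ u v → χ u ≡ true × u ∈ˢ U × χ v ≡ true × v ∉ˢ U × u ~ v
    Bad U = ∃₂ λ x y → (χ x ≡ true × x ∈ˢ U) × (χ y ≡ true × y ∉ˢ U) × ¬ Crossing U
    crossing? : ∀ U → Dec (Crossing U)
    crossing? U = any? λ u → any? λ v →
      (χ u Bool.≟ true) ×-dec ((u ∈ˢ? U) ×-dec ((χ v Bool.≟ true) ×-dec (¬? (v ∈ˢ? U) ×-dec (u ~? v))))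
    bad? : ∀ U → Dec (Bad U)
    bad? U = any? λ x → any? λ y →
      ((χ x Bool.≟ true) ×-dec (x ∈ˢ? U)) ×-dec (((χ y Bool.≟ true) ×-dec ¬? (y ∈ˢ? U)) ×-dec ¬? (crossing? U))
    to : ¬ ∃ Bad → Conn χ
    to none U {x} {y} χx x∈ χy y∉ = decidable-stable (crossing? U) λ nc → none (U , x , y , (χx , x∈) , (χy , y∉) , nc)
    from : Conn χ → ¬ ∃ Bad
    from conn (U , x , y , (χx , x∈) , (χy , y∉) , nc) = nc (conn U χx x∈ χy y∉)

  nonseparable? : ∀ χ → Dec (Nonseparable χ)
  nonseparable? χ = conn? χ ×-dec all? λ v → conn? (χ ∖∖ v)

  -- The set of vertices reached from `x` is enlarged until it contains `y`; before that, the cut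
  -- condition yields an edge leaving it.
  conn⇒connected : ∀ {χ} (K : Graph n) → (∀ {x} → x ∈ˢ V K → χ x ≡ true) →
                   (∀ {x y} → χ x ≡ true → χ y ≡ true → x ~ y → Graph._~_ K x y) → Conn χ → Connected K
  conn⇒connected {χ} K V⇒χ edge conn {x} {y} x∈ y∈ =
    grow (suc n) ⁅ x ⁆ (m≤m+n (suc n) _) (x∈⁅x⁆ x) λ i → subst (Star (Graph._~_ K) x) (sym (x∈⁅y⁆⇒x≡y x i)) ε
    where
    grow : ∀ k U → n < k + ∣ U ∣ → x ∈ˢ U → (∀ {u} → u ∈ˢ U → Star (Graph._~_ K) x u) → Star (Graph._~_ K) x y
    grow zero    U lt _   _ = ⊥-elim (<⇒≱ lt (∣p∣≤n U))
    grow (suc k) U lt x∈U r with y ∈ˢ? U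
    ... | yes y∈U = r y∈U
    ... | no y∉U with conn U (V⇒χ x∈) x∈U (V⇒χ y∈) y∉U
    ... | u , v , χu , u∈ , χv , v∉ , e =
      grow k (U ∪ ⁅ v ⁆) (≤-trans lt (≤-trans (≤-reflexive (sym (+-suc k _))) (+-monoʳ-≤ k bigger))) (p⊆p∪q ⁅ v ⁆ x∈U) r′
      where
      bigger : ∣ U ∣ < ∣ U ∪ ⁅ v ⁆ ∣
      bigger = p⊂q⇒∣p∣<∣q∣ (p⊆p∪q ⁅ v ⁆ , v , q⊆p∪q U ⁅ v ⁆ (x∈⁅x⁆ v) , v∉)
      r′ : ∀ {w} → w ∈ˢ U ∪ ⁅ v ⁆ → Star (Graph._~_ K) x w
      r′ i with x∈p∪q⁻ U ⁅ v ⁆ i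
      ... | inj₁ j = r j
      ... | inj₂ j rewrite x∈⁅y⁆⇒x≡y v j = r u∈ Star.◅◅ (edge χu χv e ◅ ε)

connected? : ∀ {n} (K : Graph n) → Dec (Connected K)
connected? K with Cuts.conn? (Graph._~_ K) (Graph._~?_ K) (Graph.~-sym K) (λ x → does (x ∈ˢ? V K))
... | yes conn = yes λ {x} {y} → Cuts.conn⇒connected (Graph._~_ K) (Graph._~?_ K) (Graph.~-sym K) K
  (λ {x} → dec-true (x ∈ˢ? V K)) (λ _ _ e → e) conn {x} {y}
... | no ¬conn = no λ con → ¬conn λ U {x} {y} χx x∈ χy y∉ →
  crossing U (con (does⁻ (x ∈ˢ? V K) χx) (does⁻ (y ∈ˢ? V K) χy)) x∈ y∉
  where
  crossing : ∀ U {x y} → Star (Graph._~_ K) x y → x ∈ˢ U → y ∉ˢ U →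
             ∃₂ λ u v → does (u ∈ˢ? V K) ≡ true × u ∈ˢ U × does (v ∈ˢ? V K) ≡ true × v ∉ˢ U × Graph._~_ K u v
  crossing U ε x∈ y∉ = ⊥-elim (y∉ x∈)
  crossing U {x} (_◅_ {j = z} e es) x∈ y∉ with z ∈ˢ? U
  ... | yes z∈ = crossing U es z∈ y∉
  ... | no z∉  = x , z , dec-true (x ∈ˢ? V K) (Graph.~⇒∈V K e) , x∈ , dec-true (z ∈ˢ? V K) (Graph.~⇒∈V K (Graph.~-sym K e)) , z∉ , e

Three : ∀ {n} → (Fin n → Bool) → Set
Three χ = ∃₂ λ x y → ∃ λ z → (x ≢ y × x ≢ z × y ≢ z) × (χ x ≡ true × χ y ≡ true × χ z ≡ true)

three? : ∀ {n} (χ : Fin n → Bool) → Dec (Three χ)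
three? χ = any? λ x → any? λ y → any? λ z →
  (¬? (x Fin.≟ y) ×-dec (¬? (x Fin.≟ z) ×-dec ¬? (y Fin.≟ z))) ×-dec
  ((χ x Bool.≟ true) ×-dec ((χ y Bool.≟ true) ×-dec (χ z Bool.≟ true)))

-- Nonseparable graphs include the complete graphs on one and two vertices, which Three rules out.

module TwoConnected {n : ℕ} (G : Graph n) where

  open Cuts (Graph._~_ G) (Graph._~?_ G) (Graph.~-sym G)

  -- The set `R₀` leaves only `x` and shows that separating sets exist. A set of at most one vertex
  -- does not disconnect, and it leaves at least two of the three given vertices.
  twoConnected : ∀ {χ} S → (∀ {x} → x ∈ˢ V (G ∖ S) → χ x ≡ true) → (∀ {x} → χ x ≡ true → x ∈ˢ V (G ∖ S)) →
                 Nonseparable χ → Three χ → KConnected (G ∖ S) 2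
  twoConnected {χ} S V⇒χ χ⇒V (conn , conn′) (x , y , z , (x≢y , x≢z , y≢z) , (χx , χy , χz)) =
    let κ , (R , sepR , q) , minimal = least (λ k → anySubset? λ R → separating? R ×-dec (∣ R ∣ ≟ k)) (R₀ , sepR₀ , refl)
    in κ , ((R , sepR , q) , λ R sep → minimal ∣ R ∣ (R , sep , refl)) , subst (2 ≤_) q (large R sepR)
    where
    H : Graph n
    H = G ∖ S
    separating? : ∀ R → Dec (IsSeparating H R)
    separating? R = (R ⊆? V H) ×-dec (¬? (connected? (H ∖ R)) ⊎-dec (∣ V (H ∖ R) ∣ ≟ 1))
    R₀ : Subset n
    R₀ = V H ─ ⁅ x ⁆
    sepR₀ : IsSeparating H R₀
    sepR₀ = p─q⊆p (V H) ⁅ x ⁆ , inj₂ (trans (cong ∣_∣ (⊆-antisym to from)) (∣⁅x⁆∣≡1 x))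
      where
      to : ∀ {v} → v ∈ˢ V H ─ R₀ → v ∈ˢ ⁅ x ⁆
      to {v} i with v ∈ˢ? ⁅ x ⁆ | ∈-─⁻ (V H) R₀ i
      ... | yes j | _      = j
      ... | no v∉ | a , b = ⊥-elim (b (x∈p∧x∉q⇒x∈p─q a v∉))
      from : ∀ {v} → v ∈ˢ ⁅ x ⁆ → v ∈ˢ V H ─ R₀
      from i rewrite x∈⁅y⁆⇒x≡y x i = x∈p∧x∉q⇒x∈p─q (χ⇒V χx) λ j → proj₂ (∈-─⁻ (V H) ⁅ x ⁆ j) (x∈⁅x⁆ x)
    outside-S : ∀ {v} → χ v ≡ true → v ∉ˢ S
    outside-S χv = proj₂ (∈-─⁻ (V G) S (χ⇒V χv))
    inside-χ : ∀ R {v} → v ∈ˢ V (H ∖ R) → χ v ≡ true × v ∉ˢ R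
    inside-χ R i = let a , b = ∈-─⁻ (V H) R i in V⇒χ a , b
    AtMostOne : Subset n → Set
    AtMostOne R = ∀ {a b} → a ∈ˢ R → b ∈ˢ R → a ≡ b
    connected-∖ : ∀ R → AtMostOne R → Connected (H ∖ R)
    connected-∖ R one with any? (λ v → v ∈ˢ? R)
    ... | no none = conn⇒connected {χ} (H ∖ R) (λ i → proj₁ (inside-χ R i))
      (λ a b e → (e , outside-S a , outside-S b) , (λ i → none (_ , i)) , (λ i → none (_ , i))) conn
    ... | yes (v , v∈) = conn⇒connected {χ ∖∖ v} (H ∖ R)
      (λ i → ∖∖⁺ {χ} (proj₁ (inside-χ R i)) (λ { refl → proj₂ (inside-χ R i) v∈ }))
      (λ a b e → (e , outside-S (proj₁ (∖∖⁻ {χ} a)) , outside-S (proj₁ (∖∖⁻ {χ} b))) ,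
        (λ i → proj₂ (∖∖⁻ {χ} a) (one i v∈)) , (λ i → proj₂ (∖∖⁻ {χ} b) (one i v∈))) (conn′ v)
    two-left : ∀ R → AtMostOne R → ∣ V (H ∖ R) ∣ ≢ 1
    two-left R one q with x ∈ˢ? R | y ∈ˢ? R
    ... | yes x∈ | _ = two y≢z χy χz (λ i → x≢y (one x∈ i)) (λ i → x≢z (one x∈ i))
      where
      two : ∀ {a b} → a ≢ b → χ a ≡ true → χ b ≡ true → a ∉ˢ R → b ∉ˢ R → ⊥
      two a≢b χa χb a∉ b∉ = <⇒≱ ≤-refl (≤-trans (Unique⇒length≤∣∣ ((a≢b ∷ []) ∷ [] ∷ [])
        λ { (here refl) → x∈p∧x∉q⇒x∈p─q (χ⇒V χa) a∉ ; (there (here refl)) → x∈p∧x∉q⇒x∈p─q (χ⇒V χb) b∉ }) (≤-reflexive q))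
    ... | no x∉ | yes y∈ = <⇒≱ ≤-refl (≤-trans (Unique⇒length≤∣∣ ((x≢z ∷ []) ∷ [] ∷ [])
        λ { (here refl) → x∈p∧x∉q⇒x∈p─q (χ⇒V χx) x∉ ; (there (here refl)) → x∈p∧x∉q⇒x∈p─q (χ⇒V χz) (λ i → y≢z (one y∈ i)) }) (≤-reflexive q))
    ... | no x∉ | no y∉ = <⇒≱ ≤-refl (≤-trans (Unique⇒length≤∣∣ ((x≢y ∷ []) ∷ [] ∷ [])
        λ { (here refl) → x∈p∧x∉q⇒x∈p─q (χ⇒V χx) x∉ ; (there (here refl)) → x∈p∧x∉q⇒x∈p─q (χ⇒V χy) y∉ }) (≤-reflexive q))
    large : ∀ R → IsSeparating H R → 2 ≤ ∣ R ∣
    large R (_ , why) = ≮⇒≥ λ small → [ (λ ¬con → ¬con (connected-∖ R (one small))) , two-left R (one small) ]′ why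
      where
      one : ∣ R ∣ < 2 → AtMostOne R
      one (s≤s le) {a} {b} a∈ b∈ with a Fin.≟ b
      ... | yes p = p
      ... | no a≢b = ⊥-elim (<⇒≱ ≤-refl (≤-trans (Unique⇒length≤∣∣ ((a≢b ∷ []) ∷ [] ∷ []) (λ { (here refl) → a∈ ; (there (here refl)) → b∈ })) le))

-- The copy of `T` that a map into `G` determines.

module Image {m n : ℕ} (T : Graph m) (G : Graph n) (f : Fin m → Fin n) where

  open Graph T using () renaming (_~_ to _~ᵀ_; _~?_ to _~ᵀ?_; ~-sym to ~ᵀ-sym; ~-irr to ~ᵀ-irr; ~⇒∈V to ~ᵀ⇒∈V)
  open Graph G using (_~_; _~?_; ~-sym)
  open Cuts _~_ _~?_ ~-sym

  abstract
    image : Fin n → Bool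
    image x = does (any? λ u → (u ∈ˢ? V T) ×-dec (f u Fin.≟ x))

    image⁺ : ∀ {u} → u ∈ˢ V T → image (f u) ≡ true
    image⁺ {u} u∈ = dec-true (any? λ v → (v ∈ˢ? V T) ×-dec (f v Fin.≟ f u)) (u , u∈ , refl)

    image⁻ : ∀ {x} → image x ≡ true → ∃ λ u → u ∈ˢ V T × f u ≡ x
    image⁻ {x} = does⁻ (any? λ u → (u ∈ˢ? V T) ×-dec (f u Fin.≟ x))

  rest : Fin n → Bool
  rest x = does (x ∈ˢ? V G) ∧ not (image x)

  -- All conditions are decidable: nonseparability and three remaining vertices stand in for
  -- 2-connectedness.
  record Embedding : Set where
    field
      injective : ∀ u v → u ∈ˢ V T → v ∈ˢ V T → f u ≡ f v → u ≡ v
      into      : ∀ u → u ∈ˢ V T → f u ∈ˢ V G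
      preserves : ∀ u v → u ~ᵀ v → f u ~ f v
      remainder : Nonseparable rest
      three     : Three rest

  embedding? : Dec Embedding
  embedding? = map′
    (λ (a , b , d , e , g) → record { injective = a ; into = b ; preserves = d ; remainder = e ; three = g })
    (λ E → let open Embedding E in injective , into , preserves , remainder , three)
    ((all? λ u → all? λ v → (u ∈ˢ? V T) →-dec ((v ∈ˢ? V T) →-dec ((f u Fin.≟ f v) →-dec (u Fin.≟ v))))
      ×-dec ((all? λ u → (u ∈ˢ? V T) →-dec (f u ∈ˢ? V G))
      ×-dec ((all? λ u → all? λ v → (u ~ᵀ? v) →-dec (f u ~? f v))
      ×-dec (nonseparable? rest ×-dec three? rest))))

  module _ (E : Embedding) where
    open Embedding E

    -- Only images of edges of `T` become edges, because the copy need not be induced in `G`.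
    T′ : Graph n
    T′ = record
      { V     = tabulate image
      ; _~_   = λ x y → ∃₂ λ u v → u ~ᵀ v × f u ≡ x × f v ≡ y
      ; _~?_  = λ x y → any? λ u → any? λ v → (u ~ᵀ? v) ×-dec ((f u Fin.≟ x) ×-dec (f v Fin.≟ y))
      ; ~-sym = λ (u , v , e , p , q) → v , u , ~ᵀ-sym e , q , p
      ; ~-irr = λ (u , v , e , p , q) →
          ~ᵀ-irr (subst (u ~ᵀ_) (sym (injective u v (~ᵀ⇒∈V e) (~ᵀ⇒∈V (~ᵀ-sym e)) (trans p (sym q)))) e)
      ; ~⇒∈V  = λ { (u , v , e , refl , _) → ∈-tabulate⁺ˢ image (image⁺ (~ᵀ⇒∈V e)) } }

    open Graph T′ using () renaming (_~_ to _~′_; ~⇒∈V to ~′⇒∈V; ~-sym to ~′-sym)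

    f∈ : ∀ {u} → u ∈ˢ V T → f u ∈ˢ V T′
    f∈ u∈ = ∈-tabulate⁺ˢ image (image⁺ u∈)

    preimage : ∀ {x} → x ∈ˢ V T′ → ∃ λ u → u ∈ˢ V T × f u ≡ x
    preimage i = image⁻ (∈-tabulate⁻ˢ image i)

    ~⁺ : ∀ {u v} → u ~ᵀ v → f u ~′ f v
    ~⁺ e = _ , _ , e , refl , refl

    ~⁻ : ∀ {u v} → u ∈ˢ V T → v ∈ˢ V T → f u ~′ f v → u ~ᵀ v
    ~⁻ {u} {v} u∈ v∈ (a , b , e , p , q) =
      subst₂ _~ᵀ_ (injective a u (~ᵀ⇒∈V e) u∈ p) (injective b v (~ᵀ⇒∈V (~ᵀ-sym e)) v∈ q) e

    connected : Connected T → Connected T′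
    connected con x∈ y∈ with preimage x∈ | preimage y∈
    ... | u , u∈ , refl | v , v∈ , refl = Star.gmap f ~⁺ (con u∈ v∈)

    preimages : ∀ {xs} → All (_∈ˢ V T′) xs → ∃ λ us → All (_∈ˢ V T) us × map f us ≡ xs
    preimages []       = [] , [] , refl
    preimages (i ∷ is) with preimage i | preimages is
    ... | u , u∈ , refl | us , us∈ , refl = u ∷ us , u∈ ∷ us∈ , refl

    Linked⁻ : ∀ {us} → All (_∈ˢ V T) us → Linked _~′_ (map f us) → Linked _~ᵀ_ us
    Linked⁻ []             _       = []
    Linked⁻ (_ ∷ [])       _       = [-]
    Linked⁻ (a ∷ b ∷ us∈) (e ∷ l) = ~⁻ a b e ∷ Linked⁻ (b ∷ us∈) l

    Linked⇒∈ : ∀ {x y xs} → Linked _~′_ (x ∷ y ∷ xs) → All (_∈ˢ V T′) (x ∷ y ∷ xs)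
    Linked⇒∈ (e ∷ [-])     = ~′⇒∈V e ∷ ~′⇒∈V (~′-sym e) ∷ []
    Linked⇒∈ (e ∷ l@(_ ∷ _)) = ~′⇒∈V e ∷ Linked⇒∈ l

    acyclic : Acyclic T → Acyclic T′
    acyclic acy x []       (s≤s () , _)
    acyclic acy x (y ∷ xs) (len , uq , l)
      with preimages (Allₚ.++⁻ˡ (x ∷ y ∷ xs) (Linked⇒∈ l))
    ... | u ∷ v ∷ us , u∈ ∷ us∈ , refl = acy u (v ∷ us)
      ( subst (_≥ 3) (length-map f (u ∷ v ∷ us)) len , Uniq.map⁻ uq
      , Linked⁻ (u∈ ∷ Allₚ.++⁺ us∈ (u∈ ∷ [])) (subst (Linked _~′_) (sym (map-++ f (u ∷ v ∷ us) [ u ])) l))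

    -- Injectivity lets every edge at `f u` be pulled back to an edge at `u`.
    degree≤ : ∀ {u} → u ∈ˢ V T → degree T′ (f u) ≤ degree T u
    degree≤ {u} u∈ = ≤-trans (∣∣≤length (tabulate (λ y → does (Graph._~?_ T′ (f u) y))) {map f (elements N)} covered)
      (≤-reflexive (trans (length-map f (elements N)) (length-elements N)))
      where
      N : Subset m
      N = tabulate (λ v → does (u ~ᵀ? v))
      covered : ∀ {y} → y ∈ˢ tabulate (λ y → does (Graph._~?_ T′ (f u) y)) → y ∈ map f (elements N)
      covered {y} i with does⁻ (Graph._~?_ T′ (f u) y) (∈-tabulate⁻ˢ (λ y → does (Graph._~?_ T′ (f u) y)) i)
      ... | a , b , e , p , refl = ∈-map⁺ f (∈-elements⁺ (∈-tabulate⁺ˢ (λ v → does (u ~ᵀ? v))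
        (dec-true (u ~ᵀ? b) (subst (_~ᵀ b) (injective a u (~ᵀ⇒∈V e) u∈ p) e))))

    degree⇒∈ : ∀ {x} → degree T′ x > 2 → x ∈ˢ V T′
    degree⇒∈ {x} h with elements (tabulate (λ y → does (Graph._~?_ T′ x y))) | length-elements (tabulate (λ y → does (Graph._~?_ T′ x y)))
      | ∈-elements⁻ (tabulate (λ y → does (Graph._~?_ T′ x y)))
    ... | []    | q | _ = ⊥-elim (n≮0 (subst (2 <_) (sym q) h))
    ... | y ∷ _ | _ | g = ~′⇒∈V (does⁻ (Graph._~?_ T′ x y) (∈-tabulate⁻ˢ (λ y → does (Graph._~?_ T′ x y)) (g (here refl))))

    spider : IsSpider T → IsSpider T′
    spider (((u , u∈) , con , acy) , one) = ((f u , f∈ u∈) , connected con , acyclic acy) , one′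
      where
      one′ : ∀ {x y} → degree T′ x > 2 → degree T′ y > 2 → x ≡ y
      one′ dx dy with preimage (degree⇒∈ dx) | preimage (degree⇒∈ dy)
      ... | a , a∈ , refl | b , b∈ , refl = cong f (one (≤-trans dx (degree≤ a∈)) (≤-trans dy (degree≤ b∈)))

    vertex≡ : ∀ {k} {K : Graph k} {u v : Vertex K} → proj₁ u ≡ proj₁ v → u ≡ v
    vertex≡ {u = u , p} {v = _ , q} refl = cong (u ,_) ([]=-irrelevant p q)

    isomorphic : T ≅ T′
    isomorphic =
      mk↔ₛ′ (λ (u , u∈) → f u , f∈ u∈) (λ (x , x∈) → let u , u∈ , _ = preimage x∈ in u , u∈)
        (λ (x , x∈) → vertex≡ {K = T′} (proj₂ (proj₂ (preimage x∈))))
        (λ (u , u∈) → let v , v∈ , q = preimage (f∈ u∈) in vertex≡ {K = T} (injective v u v∈ u∈ q)) ,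
      λ (u , u∈) (v , v∈) → mk⇔ ~⁺ (~⁻ u∈ v∈)

    subgraph : T′ ⊆ᴳ G
    subgraph = (λ i → let u , u∈ , q = preimage i in subst (_∈ˢ V G) q (into u u∈)) ,
               λ { (u , v , e , refl , refl) → preserves u v e }

    result : IsSpider T → Σ[ T′ ∈ Graph n ] (T′ ⊆ᴳ G × IsSpider T′ × T ≅ T′ × KConnected (G ∖ V T′) 2)
    result sp = T′ , subgraph , spider sp , isomorphic ,
      TwoConnected.twoConnected G {rest} (V T′)
        (λ {x} i → let a , b = ∈-─⁻ (V G) (V T′) i in ∧-true (dec-true (x ∈ˢ? V G) a) (cong not (false-image (λ h → b (∈-tabulate⁺ˢ image h)))))
        (λ {x} h → let a , b = true-∧ {does (x ∈ˢ? V G)} h in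
          x∈p∧x∉q⇒x∈p─q (does⁻ (x ∈ˢ? V G) a) (λ i → case trans (sym (∈-tabulate⁻ˢ image i)) (not-injective {image x} {false} b) of λ ()))
        remainder three
      where
      false-image : ∀ {x} → (image x ≡ true → ⊥) → image x ≡ false
      false-image {x} h with image x
      ... | true  = ⊥-elim (h refl)
      ... | false = refl

-- Matching two leg systems position by position.

data Paired {A B : Set} : List A → List B → A → B → Set where
  here  : ∀ {a b as bs} → Paired (a ∷ as) (b ∷ bs) a b
  there : ∀ {a b as bs u x} → Paired as bs u x → Paired (a ∷ as) (b ∷ bs) u x

module _ {A B : Set} where

  Paired-∈ˡ : ∀ {as : List A} {bs : List B} {u x} → Paired as bs u x → u ∈ as
  Paired-∈ˡ here      = here refl
  Paired-∈ˡ (there p) = there (Paired-∈ˡ p)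

  Paired-∈ʳ : ∀ {as : List A} {bs : List B} {u x} → Paired as bs u x → x ∈ bs
  Paired-∈ʳ here      = here refl
  Paired-∈ʳ (there p) = there (Paired-∈ʳ p)

  ∈-Pairedˡ : ∀ {as : List A} {bs : List B} {u} → length as ≡ length bs → u ∈ as → ∃ (Paired as bs u)
  ∈-Pairedˡ {a ∷ as} {b ∷ bs} q (here refl) = b , here
  ∈-Pairedˡ {a ∷ as} {b ∷ bs} q (there i) with ∈-Pairedˡ {as} {bs} (suc-injective q) i
  ... | x , p = x , there p

  ∈-Pairedʳ : ∀ {as : List A} {bs : List B} {x} → length as ≡ length bs → x ∈ bs → ∃ λ u → Paired as bs u x
  ∈-Pairedʳ {a ∷ as} {b ∷ bs} q (here refl) = a , here
  ∈-Pairedʳ {a ∷ as} {b ∷ bs} q (there i) with ∈-Pairedʳ {as} {bs} (suc-injective q) i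
  ... | u , p = u , there p

  Paired-injective : ∀ {as : List A} {bs : List B} {u v x} → Unique bs → Paired as bs u x → Paired as bs v x → u ≡ v
  Paired-injective uq         here      here      = refl
  Paired-injective (h ∷ _)   here      (there p) = ⊥-elim (All.lookup h (Paired-∈ʳ p) refl)
  Paired-injective (h ∷ _)   (there p) here      = ⊥-elim (All.lookup h (Paired-∈ʳ p) refl)
  Paired-injective (_ ∷ uq)  (there p) (there q) = Paired-injective uq p q

  Paired-++ˡ : ∀ {as as′ : List A} {bs bs′ : List B} {u x} → Paired as bs u x → Paired (as ++ as′) (bs ++ bs′) u x
  Paired-++ˡ here      = here
  Paired-++ˡ (there p) = there (Paired-++ˡ p)

  Paired-++ʳ : ∀ (as : List A) {as′} (bs : List B) {bs′ u x} → length as ≡ length bs →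
               Paired as′ bs′ u x → Paired (as ++ as′) (bs ++ bs′) u x
  Paired-++ʳ []       []       _ p = p
  Paired-++ʳ (a ∷ as) (b ∷ bs) q p = there (Paired-++ʳ as bs (suc-injective q) p)

  split : ∀ (p : List A) {u q} {leg : List B} → length (p ++ u ∷ q) ≡ length leg →
          ∃₂ λ p′ x → ∃ λ q′ → leg ≡ p′ ++ x ∷ q′ × length p ≡ length p′ × length q ≡ length q′
  split []      {leg = x ∷ q′} h = [] , x , q′ , refl , refl , suc-injective h
  split (a ∷ p) {leg = b ∷ leg} h with split p {leg = leg} (suc-injective h)
  ... | p′ , x , q′ , refl , hp , hq = b ∷ p′ , x , q′ , refl , cong suc hp , hq

  Paired-concat : ∀ {legs : List (List A)} {legs′ : List (List B)} → map length legs ≡ map length legs′ →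
                  ∀ {leg} → leg ∈ legs → ∃ λ leg′ → leg′ ∈ legs′ × length leg ≡ length leg′ ×
                  (∀ {u x} → Paired leg leg′ u x → Paired (concat legs) (concat legs′) u x)
  Paired-concat {l ∷ _} {l′ ∷ _} h (here refl) = l′ , here refl , ∷-injectiveˡ h , Paired-++ˡ
  Paired-concat {l ∷ legs} {l′ ∷ legs′} h (there i) with Paired-concat {legs} {legs′} (∷-injectiveʳ h) i
  ... | leg′ , j , q , f = leg′ , there j , q , λ p → Paired-++ʳ l l′ (∷-injectiveˡ h) (f p)

  length-concat : ∀ {legs : List (List A)} {legs′ : List (List B)} → map length legs ≡ map length legs′ →
                  length (concat legs) ≡ length (concat legs′)
  length-concat {[]}       {[]}         _ = refl
  length-concat {l ∷ legs} {l′ ∷ legs′} h =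
    trans (length-++ l) (trans (cong₂ _+_ (∷-injectiveˡ h) (length-concat {legs} {legs′} (∷-injectiveʳ h))) (sym (length-++ l′)))

-- The default `d` is the value at indices outside `V T`, where the map is arbitrary.
assoc : ∀ {m} {B : Set} → List (Fin m) → List B → B → Fin m → B
assoc (a ∷ as) (b ∷ bs) d u = if does (u Fin.≟ a) then b else assoc as bs d u
assoc _        _        d _ = d

assoc-Paired : ∀ {m} {B : Set} {as : List (Fin m)} {bs : List B} {d u x} → Unique as → Paired as bs u x → assoc as bs d u ≡ x
assoc-Paired {u = u} uq here rewrite dec-true (u Fin.≟ u) refl = refl
assoc-Paired {as = a ∷ _} {u = u} (h ∷ uq) (there p)
  rewrite dec-false (u Fin.≟ a) (λ { refl → All.lookup h (Paired-∈ˡ p) refl }) = assoc-Paired uq p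

module Placement {m n : ℕ} (T : Graph m) (G : Graph n) (connected : Connected T) (acyclic : Acyclic T)
  (c : Fin m) (c∈V : c ∈ˢ V T) (thin : ∀ {u} → u ≢ c → ¬ (degree T u > 2)) where

  open Legs T connected acyclic c c∈V thin
  open Decomposition decomposition
  open Graph G using (_~_; _~?_; ~-sym)
  open Walks _~_ ~-sym
  open Cuts _~_ _~?_ ~-sym using (Nonseparable; Nonseparable-resp)

  module _ {c′ : Fin n} {legs′ : List (List (Fin n))} (lens : map length legs ≡ map length legs′)
    (paths′ : All (Path c′) legs′) (uniq′ : Unique (c′ ∷ concat legs′))
    (inside′ : ∀ {v} → v ∈ c′ ∷ concat legs′ → v ∈ˢ V G) {ρ : Fin n → Bool}
    (ρ⁺ : ∀ {v} → v ∈ˢ V G → v ∉ c′ ∷ concat legs′ → ρ v ≡ true)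
    (ρ⁻ : ∀ {v} → ρ v ≡ true → v ∈ˢ V G × v ∉ c′ ∷ concat legs′)
    (nonsep : Nonseparable ρ) (three : Three ρ) where

    φ : Vec (Fin n) m
    φ = tabulate (assoc (c ∷ concat legs) (c′ ∷ concat legs′) c′)

    f : Fin m → Fin n
    f = lookup φ

    lengths : length (c ∷ concat legs) ≡ length (c′ ∷ concat legs′)
    lengths = cong suc (length-concat {legs = legs} {legs′ = legs′} lens)

    f-Paired : ∀ {u x} → Paired (c ∷ concat legs) (c′ ∷ concat legs′) u x → f u ≡ x
    f-Paired {u} p = trans (lookup∘tabulate _ u) (assoc-Paired uniq p)

    paired : ∀ {u} → u ∈ˢ V T → Paired (c ∷ concat legs) (c′ ∷ concat legs′) u (f u)
    paired u∈ with ∈-Pairedˡ lengths (covers u∈)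
    ... | x , p = subst (Paired _ _ _) (sym (f-Paired p)) p

    consecutive : ∀ {u v} → Consecutive legs u v → f u ~ f v
    consecutive {u} (leg , p , q , leg∈ , refl , refl) with Paired-concat {legs = legs} {legs′ = legs′} lens leg∈
    ... | leg′ , leg′∈ , len , lift with split p {leg = leg′} len
    ... | p′ , x , q′ , refl , hp , hq =
      subst₂ _~_ (sym (f-Paired (there (lift (Paired-++ʳ p p′ hp here))))) (sym (f-Paired (ends q q′ hq λ z → there (lift (Paired-++ʳ p p′ hp (there z))))))
        (proj₁ (Path-++⁻ʳ p′ (All.lookup paths′ leg′∈)))
      where
      open Walks (Graph._~_ T) (Graph.~-sym T) using () renaming (end to endᵀ)
      ends : ∀ q q′ → length q ≡ length q′ →
             (∀ {u x} → Paired q q′ u x → Paired (c ∷ concat legs) (c′ ∷ concat legs′) u x) →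
             Paired (c ∷ concat legs) (c′ ∷ concat legs′) (endᵀ c q) (end c′ q′)
      ends []      []       _ _ = here
      ends (_ ∷ _) (_ ∷ _) _ g = g here

    open Image T G f using (Embedding; image; image⁺; image⁻; rest)

    image⇒∈ : ∀ {v} → image v ≡ true → v ∈ c′ ∷ concat legs′
    image⇒∈ h with image⁻ h
    ... | u , u∈ , refl = Paired-∈ʳ (paired u∈)

    ∈⇒image : ∀ {v} → v ∈ c′ ∷ concat legs′ → image v ≡ true
    ∈⇒image i with ∈-Pairedʳ lengths i
    ... | u , p = subst (λ v → image v ≡ true) (f-Paired p) (image⁺ (inside (Paired-∈ˡ p)))

    ρ⇒rest : ∀ {v} → ρ v ≡ true → rest v ≡ true
    ρ⇒rest {v} h with image v in eq
    ... | false = ∧-true (dec-true (v ∈ˢ? V G) (proj₁ (ρ⁻ h))) refl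
    ... | true  = ⊥-elim (proj₂ (ρ⁻ h) (image⇒∈ eq))

    rest⇒ρ : ∀ {v} → rest v ≡ true → ρ v ≡ true
    rest⇒ρ {v} h with true-∧ {does (v ∈ˢ? V G)} h
    ... | a , b = ρ⁺ (does⁻ (v ∈ˢ? V G) a) λ i → case trans (sym (∈⇒image i)) (not-injective {image v} {false} b) of λ ()

    embedding : Embedding
    embedding = record
      { injective = λ u v u∈ v∈ q → Paired-injective uniq′ (paired u∈) (subst (Paired _ _ v) (sym q) (paired v∈))
      ; into      = λ u u∈ → inside′ (Paired-∈ʳ (paired u∈))
      ; preserves = λ u v e → [ consecutive , (λ k → ~-sym (consecutive k)) ]′ (edges e)
      ; remainder = Nonseparable-resp ρ⇒rest rest⇒ρ nonsep
      ; three     = let x , y , z , ne , (a , b , d) = three in x , y , z , ne , (ρ⇒rest a , ρ⇒rest b , ρ⇒rest d) }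

    placement : ∃ λ φ → Image.Embedding T G (lookup φ)
    placement = φ , embedding

-- The colour classes of the spider bound those of its copies.

cnt-not : ∀ b x k → cnt (not b) (not x) k ≡ cnt b x k
cnt-not b x zero    = refl
cnt-not b x (suc k) = cong₂ _+_ (same b x) (cnt-not b (not x) k)
  where
  same : ∀ b x → bit (does (not (not x) Bool.≟ not b)) ≡ bit (does (not x Bool.≟ b))
  same true  true  = refl
  same true  false = refl
  same false true  = refl
  same false false = refl

module Capacities {m : ℕ} (T : Graph m) (connected : Connected T) (acyclic : Acyclic T)
  (c : Fin m) (c∈V : c ∈ˢ V T) (thin : ∀ {u} → u ≢ c → ¬ (degree T u > 2))
  {X Y : Subset m} (bip : IsBipartition T X Y) where

  open Legs T connected acyclic c c∈V thin
  open Decomposition decomposition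

  colour : Fin m → Bool
  colour v = does (v ∈ˢ? X)

  open Host (Graph._~_ T) (Graph.~-sym T) colour (bipartition-alternates T bip) using (hue; hue-true; count-concat)

  sides : ∀ b → count (hue b) (c ∷ concat legs) ≤ ∣ X ∣ ⊔ ∣ Y ∣
  sides b = ≤-trans (≤-reflexive (sym (length-keep (hue b) (c ∷ concat legs)))) (side b (λ i → ∈-keep⁻ (hue b) (c ∷ concat legs) i))
    where
    side : ∀ b → (∀ {v} → v ∈ keep (hue b) (c ∷ concat legs) → v ∈ c ∷ concat legs × hue b v ≡ true) →
           length (keep (hue b) (c ∷ concat legs)) ≤ ∣ X ∣ ⊔ ∣ Y ∣
    side true h = ≤-trans (Unique⇒length≤∣∣ (Unique-keep (hue true) uniq) in-X) (m≤m⊔n ∣ X ∣ ∣ Y ∣)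
      where
      in-X : ∀ {v} → v ∈ keep (hue true) (c ∷ concat legs) → v ∈ˢ X
      in-X {v} i = does⁻ (v ∈ˢ? X) (does⁻ (colour v Bool.≟ true) (proj₂ (h i)))
    side false h = ≤-trans (Unique⇒length≤∣∣ (Unique-keep (hue false) uniq) in-Y) (m≤n⊔m ∣ X ∣ ∣ Y ∣)
      where
      in-Y : ∀ {v} → v ∈ keep (hue false) (c ∷ concat legs) → v ∈ˢ Y
      in-Y {v} i with x∈p∪q⁻ X Y (subst (v ∈ˢ_) (sym (proj₁ bip)) (inside (proj₁ (h i))))
      ... | inj₂ v∈ = v∈
      ... | inj₁ v∈ = case trans (sym (dec-true (v ∈ˢ? X) v∈)) (does⁻ (colour v Bool.≟ false) (proj₂ (h i))) of λ ()

  cap-own : ∀ b → bit (does (colour c Bool.≟ b)) + sum (map (cnt b (colour c)) (map length legs)) ≤ ∣ X ∣ ⊔ ∣ Y ∣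
  cap-own b = ≤-trans (≤-reflexive (cong (bit (hue b c) +_) (sym (count-concat b c paths)))) (sides b)

  -- If the copy's centre has the other colour, its two classes are exchanged; the maximum of their
  -- sizes does not change.
  cap : ∀ x b → bit (does (x Bool.≟ b)) + sum (map (cnt b x) (map length legs)) ≤ ∣ X ∣ ⊔ ∣ Y ∣
  cap x b with x Bool.≟ colour c
  ... | yes refl = cap-own b
  ... | no x≢ = ≤-trans (≤-reflexive (cong₂ _+_ (flip x b (¬-not x≢)) (cong sum (map-cong (λ k → flip-cnt (¬-not x≢) k) (map length legs))))) (cap-own (not b))
    where
    flip : ∀ x b {y} → x ≡ not y → bit (does (x Bool.≟ b)) ≡ bit (does (y Bool.≟ not b))
    flip true  true  {false} _ = refl
    flip true  false {false} _ = refl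
    flip false true  {true}  _ = refl
    flip false false {true}  _ = refl
    flip-cnt : ∀ {y} → x ≡ not y → ∀ k → cnt b x k ≡ cnt (not b) y k
    flip-cnt {y} refl k = trans (sym (cnt-not b (not y) k)) (cong (λ z → cnt (not b) z k) (not-involutive y))

-- A spider without a branch vertex may be rooted anywhere.
choose-centre : ∀ {m} (T : Graph m) → IsSpider T → ∃ λ c → c ∈ˢ V T × (∀ {u} → u ≢ c → ¬ (degree T u > 2))
choose-centre T (((x , x∈) , _) , one) with any? (λ v → (v ∈ˢ? V T) ×-dec (3 ≤? degree T v))
... | yes (v , v∈ , d) = v , v∈ , λ u≢v d′ → u≢v (one d′ d)
... | no none = x , x∈ , λ {u} _ d → none (u , degree⇒∈ d , d)
  where
  degree⇒∈ : ∀ {u} → degree T u > 2 → u ∈ˢ V T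
  degree⇒∈ {u} d with any? (λ y → Graph._~?_ T u y)
  ... | yes (y , e) = Graph.~⇒∈V T e
  ... | no isolated = ⊥-elim (n≮0 (≤-trans d (∣∣≤length (tabulate (λ y → does (Graph._~?_ T u y))) {[]}
    λ {y} i → ⊥-elim (isolated (y , does⁻ (Graph._~?_ T u y) (∈-tabulate⁻ˢ (λ y → does (Graph._~?_ T u y)) i))))))

degree≥δ : ∀ {n} (G : Graph n) {x} → x ∈ˢ V G → δ G ≤ degree G x
degree≥δ {n} G {x} x∈ = All.lookup (min≤xs n (map (degree G) (filter (_∈ˢ? V G) (allFin n))))
  (∈-map⁺ (degree G) (∈-filter⁺ (_∈ˢ? V G) (∈-allFin x) x∈))

-- The hypotheses on `G` in the form required by the extremal argument.

module Refutation {m n : ℕ} (T : Graph m) {X Y : Subset m} (sp : IsSpider T) (bip : IsBipartition T X Y)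
  (G : Graph n) (κ₂ : KConnected G 2) {XG YG : Subset n} (bipG : IsBipartition G XG YG)
  (δ≥ : δ G ≥ (∣ X ∣ ⊔ ∣ Y ∣) + 2)
  (none : ¬ ∃ λ φ → Image.Embedding T G (lookup φ)) where

  private
    t : ℕ
    t = ∣ X ∣ ⊔ ∣ Y ∣

    connectedT : Connected T
    connectedT = proj₁ (proj₂ (proj₁ sp))

    acyclicT : Acyclic T
    acyclicT = proj₂ (proj₂ (proj₁ sp))

    centre : ∃ λ c → c ∈ˢ V T × (∀ {u} → u ≢ c → ¬ (degree T u > 2))
    centre = choose-centre T sp

  open Graph G using (_~_; _~?_; ~-sym; ~⇒∈V)
  open Legs T connectedT acyclicT (proj₁ centre) (proj₁ (proj₂ centre)) (proj₂ (proj₂ centre)) using (module Decomposition; decomposition)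
  open Decomposition decomposition using (legs; nonempty)

  ls : List ℕ
  ls = map length legs

  cap : ∀ x b → bit (does (x Bool.≟ b)) + sum (map (cnt b x) ls) ≤ t
  cap = Capacities.cap T connectedT acyclicT (proj₁ centre) (proj₁ (proj₂ centre)) (proj₂ (proj₂ centre)) bip

  colour : Fin n → Bool
  colour v = does (v ∈ˢ? XG)

  alt : ∀ {x y} → x ~ y → colour x ≡ not (colour y)
  alt = bipartition-alternates G bipG

  open Host _~_ ~-sym colour alt
  open Capacity ls t cap
  open Cuts _~_ _~?_ ~-sym using (Nonseparable)

  χ : Fin n → Bool
  χ x = does (x ∈ˢ? V G)

  χ⁻ : ∀ {x} → χ x ≡ true → x ∈ˢ V G
  χ⁻ {x} = does⁻ (x ∈ˢ? V G)

  χ⁺ : ∀ {x} → x ∈ˢ V G → χ x ≡ true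
  χ⁺ {x} = dec-true (x ∈ˢ? V G)

  deg : ∀ {x} → χ x ≡ true → Deg x (2 + t) χ
  deg {x} χx Z lt with any? (λ v → (v ~? x) ×-dec ¬? (v ∈? Z))
  ... | yes (v , e , v∉) = v , e , χ⁺ (~⇒∈V e) , v∉
  ... | no no-neighbour = ⊥-elim (<⇒≱ lt (≤-trans (≤-reflexive (+-comm 2 t)) (≤-trans δ≥ (≤-trans (degree≥δ G (χ⁻ χx))
    (∣∣≤length (tabulate (λ y → does (x ~? y))) covered)))))
    where
    covered : ∀ {y} → y ∈ˢ tabulate (λ y → does (x ~? y)) → y ∈ Z
    covered {y} i with y ∈? Z
    ... | yes j = j
    ... | no y∉ = ⊥-elim (no-neighbour (y , ~-sym (does⁻ (x ~? y) (∈-tabulate⁻ˢ (λ y → does (x ~? y)) i)) , y∉))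

  not-separating : ∀ S → ∣ S ∣ ≤ 1 → ¬ IsSeparating G S
  not-separating S le sep = let _ , (_ , minimal) , κ≥2 = κ₂ in <⇒≱ (s≤s le) (≤-trans κ≥2 (minimal S sep))

  link : ∀ {x y} → χ x ≡ true → χ y ≡ true → ¬ ¬ Star _~_ x y
  link {x} {y} χx χy h = not-separating ∅ (≤-trans (≤-reflexive (∣⊥∣≡0 n)) z≤n)
    ((λ i → ⊥-elim (∉⊥ i)) , inj₁ λ con → h (Star.map proj₁ (con (x∈p∧x∉q⇒x∈p─q (χ⁻ χx) ∉⊥) (x∈p∧x∉q⇒x∈p─q (χ⁻ χy) ∉⊥))))

  link-off : ∀ {x y} v → χ v ≡ true → χ x ≡ true → χ y ≡ true → x ≢ v → y ≢ v →
             ¬ ¬ Star (λ a b → a ~ b × a ≢ v × b ≢ v) x y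
  link-off {x} {y} v χv χx χy x≢v y≢v h = not-separating ⁅ v ⁆ (≤-reflexive (∣⁅x⁆∣≡1 v))
    ( (λ i → subst (_∈ˢ V G) (sym (x∈⁅y⁆⇒x≡y v i)) (χ⁻ χv))
    , inj₁ λ con → h (Star.map (λ (e , a∉ , b∉) → e , (λ { refl → a∉ (x∈⁅x⁆ v) }) , (λ { refl → b∉ (x∈⁅x⁆ v) }))
        (con (x∈p∧x∉q⇒x∈p─q (χ⁻ χx) (λ i → x≢v (x∈⁅y⁆⇒x≡y v i))) (x∈p∧x∉q⇒x∈p─q (χ⁻ χy) (λ i → y≢v (x∈⁅y⁆⇒x≡y v i))))))

  -- A separating set that attains the connectivity has at least two members, all of them vertices
  -- of `G`.
  some-vertex : ∃ λ x → x ∈ˢ V G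
  some-vertex = go κ₂
    where
    go : KConnected G 2 → ∃ λ x → x ∈ˢ V G
    go (κ , ((S , (S⊆ , _) , q) , _) , κ≥2) with elements S | length-elements S | ∈-elements⁻ S
    ... | []    | q′ | _ = ⊥-elim (n≮0 (≤-trans κ≥2 (≤-reflexive (trans (sym q) (sym q′)))))
    ... | x ∷ _ | _  | h = x , S⊆ (h (here refl))

  rest-of : Fin n → List (List (Fin n)) → Fin n → Bool
  rest-of c legs x = χ x ∧ off (c ∷ concat legs) x

  -- A neighbour `x` of the centre lies off the copy; at most `t` of the `t + 2` neighbours of `x`
  -- lie on it, which leaves `y` and `z`.
  three : ∀ {c legs} → Spider χ c legs → Three (rest-of c legs)
  three {c} {legs} s = pick-x (Deg-hue (deg (inside s (here refl))) vs (bound 0 (not (colour c)) z≤n))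
    where
    vs : List (Fin n)
    vs = c ∷ concat legs
    bound : ∀ k b → k ≤ 1 → k + count (hue b) vs < 2 + t
    bound k b le = s≤s (+-mono-≤ le (count-spider≤ s b))
    in-rest : ∀ {x} → χ x ≡ true → x ∉ vs → rest-of c legs x ≡ true
    in-rest χx x∉ = ∧-true χx (off-true x∉)
    distinct : ∀ {x y} → x ~ y → y ≢ x
    distinct e refl = Graph.~-irr G e
    pick-z : ∀ {x y} → χ x ≡ true → x ∉ vs → y ~ x → χ y ≡ true → y ∉ vs →
             (∃ λ z → z ~ x × χ z ≡ true × z ∉ y ∷ vs) → Three (rest-of c legs)
    pick-z {x} {y} χx x∉ e χy y∉ (z , e′ , χz , z∉) =
      x , y , z , (distinct e , distinct e′ , λ { refl → z∉ (here refl) }) ,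
      (in-rest χx x∉ , in-rest χy y∉ , in-rest χz (λ i → z∉ (there i)))
    pick-y : ∀ {x} → χ x ≡ true → x ∉ vs → (∃ λ y → y ~ x × χ y ≡ true × y ∉ vs) → Three (rest-of c legs)
    pick-y {x} χx x∉ (y , e , χy , y∉) = pick-z χx x∉ e χy y∉
      (Deg-hue (deg χx) (y ∷ vs) (bound (bit (hue (not (colour x)) y)) (not (colour x)) (bit≤1 _)))
    pick-x : (∃ λ x → x ~ c × χ x ≡ true × x ∉ vs) → Three (rest-of c legs)
    pick-x (x , _ , χx , x∉) = pick-y χx x∉ (Deg-hue (deg χx) vs (bound 0 (not (colour x)) z≤n))

  -- The leg lengths agree with those of `T` only up to a permutation, so the legs are reordered
  -- before they are matched.
  bad : ∀ {c legs} → Spider χ c legs → ¬ Nonseparable (rest-of c legs)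
  bad {c} {legs′} s nonsep = aligned (↭-map-inv length (lens s))
    where
    aligned : (∃ λ legs″ → ls ≡ map length legs″ × legs′ ↭ legs″) → ⊥
    aligned (legs″ , lens″ , perm) = none (Placement.placement T G connectedT acyclicT
      (proj₁ centre) (proj₁ (proj₂ centre)) (proj₂ (proj₂ centre)) lens″ (paths s″) (uniq s″) (λ i → χ⁻ (inside s″ i))
      {rest-of c legs′}
      (λ v∈ v∉ → ∧-true (χ⁺ v∈) (off-true (λ i → v∉ (∈-resp-↭ (prep c (concat-↭ perm)) i))))
      (λ h → let a , b = true-∧ h in χ⁻ a , λ i → true-off b (∈-resp-↭ (prep c (concat-↭ (↭-sym perm))) i))
      nonsep (three s))
      where
      s″ : Spider χ c legs″
      s″ = rearrange s perm

  absurd : ⊥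
  absurd = Extremal.Main.impossible _~_ _~?_ ~-sym colour alt ls t cap (Allₚ.map⁺ nonempty)
    χ (λ e → χ⁺ (~⇒∈V e)) deg link link-off bad {proj₁ some-vertex} (χ⁺ (proj₂ some-vertex))

theorem4p1 : ∀ {m : ℕ} (T : Graph m) (X Y : Subset m) → IsSpider T → IsBipartition T X Y →
    let t = ∣ X ∣ ⊔ ∣ Y ∣ in
    ∀ {n : ℕ} (G : Graph n) → KConnected G 2 → Bipartite G → δ G ≥ t + 2 →
    Σ[ T′ ∈ Graph n ] (T′ ⊆ᴳ G × IsSpider T′ × T ≅ T′ × KConnected (G ∖ V T′) 2)
theorem4p1 {m} T X Y sp bip G κ₂ (_ , _ , bipG) δ≥ with anyVec? m (λ φ → Image.embedding? T G (lookup φ))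
... | yes (φ , E) = Image.result T G (lookup φ) E sp
... | no none     = ⊥-elim (Refutation.absurd T sp bip G κ₂ bipG δ≥ none)
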